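{- Let $k\geq 1$ be an integer and let $\alpha\in[\frac{k}{k+1},1]$ be rational. Let $\ell$ be the smallest positive integer such that $\frac{\ell}{2k}$ and $\frac{\alpha\ell}{2k}$ are integers. There exist integers $s_0,q_0$ such that for every integer $s\geq s_0$ and every prime power $q\geq q_0$ there exists a bipartite graph $G$ with parts $M,N$, $|M|=q^{\alpha\ell}$, $|N|=q^{\ell}$, such that $G$ is $\Theta_{s,2k}$-free and \[e(G)\geq \frac12 |M|^{\frac12+\frac{1}{2k}}|N|^{\frac12}.\]
   Context: The theta graph $\Theta_{s,k}$ is the graph consisting of $s$ paths of length $k$ with the same two endpoints that are otherwise pairwise vertex-disjoint. -}

module Defs where

open import Data.Nat as ℕ using (ℕ; zero; suc; _+_; _*_; _∸_; _^_; _≤_)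
open import Data.Nat.Divisibility using (_∣_)
open import Data.Nat.Primality using (Prime)
open import Data.Nat.ListAction using (sum)
open import Data.Integer as ℤ using (ℤ; +_)
open import Data.Rational as ℚ using (ℚ; _/_)
open import Data.Fin using (Fin; toℕ)
open import Data.List using (List; map)
open import Data.List.Base using () renaming (allFin to allFinL)
open import Data.Bool using (Bool; true; false; if_then_else_)
open import Data.Sum using (_⊎_; inj₁; inj₂)
open import Data.Product using (Σ; ∃; _×_; _,_)
open import Data.Empty using (⊥)
open import Relation.Binary.PropositionalEquality using (_≡_)
open import Function.Definitions using (Injective)

ℕ→ℚ : ℕ → ℚ
ℕ→ℚ n = + n / 1

ℤ→ℚ : ℤ → ℚ
ℤ→ℚ z = z / 1

IsPrimePower : ℕ → Set
IsPrimePower q = Σ ℕ λ p → Σ ℕ λ m → Prime p × 1 ≤ m × q ≡ p ^ m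

ℓ-Cond : ℕ → ℚ → ℕ → Set
ℓ-Cond k α ℓ = (2 * k ∣ ℓ) × (Σ ℤ λ z → α ℚ.* ℕ→ℚ ℓ ≡ ℤ→ℚ z ℚ.* ℕ→ℚ (2 * k))

IsSmallestℓ : ℕ → ℚ → ℕ → Set
IsSmallestℓ k α ℓ =
  1 ≤ ℓ × ℓ-Cond k α ℓ × (∀ ℓ' → 1 ≤ ℓ' → ℓ-Cond k α ℓ' → ℓ ≤ ℓ')

record Graph : Set₁ where
  field
    V   : Set
    Adj : V → V → Set

open Graph public

_⊆G_ : Graph → Graph → Set
H ⊆G G = Σ (V H → V G) λ f →
  Injective _≡_ _≡_ f × (∀ x y → Adj H x y → Adj G (f x) (f y))

-- Theta graph: s paths of length (suc m) between `left` and `right`,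
-- internal vertices mid i j (path i, position j+1), pairwise disjoint.

data ThetaV (s m : ℕ) : Set where
  left right : ThetaV s m
  mid : Fin s → Fin m → ThetaV s m

data ThetaE {s m : ℕ} : ThetaV s m → ThetaV s m → Set where
  lr : Fin s → m ≡ 0 → ThetaE left right
  lm : (i : Fin s) (j : Fin m) → toℕ j ≡ 0 → ThetaE left (mid i j)
  mm : (i : Fin s) (j j' : Fin m) → suc (toℕ j) ≡ toℕ j' → ThetaE (mid i j) (mid i j')
  mr : (i : Fin s) (j : Fin m) → suc (toℕ j) ≡ m → ThetaE (mid i j) right

ThetaAdj : ∀ {s m} → ThetaV s m → ThetaV s m → Set
ThetaAdj x y = ThetaE x y ⊎ ThetaE y x

-- Θ_{s,L} for L ≥ 1 : s internally disjoint paths of length L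
Θ : (s L : ℕ) → Graph
Θ s L = record { V = ThetaV s (L ∸ 1) ; Adj = ThetaAdj }

BipAdj : ∀ {a b} → (Fin a → Fin b → Bool) →
         Fin a ⊎ Fin b → Fin a ⊎ Fin b → Set
BipAdj E (inj₁ x) (inj₂ y) = E x y ≡ true
BipAdj E (inj₂ y) (inj₁ x) = E x y ≡ true
BipAdj E _ _ = ⊥

BipGraph : ∀ {a b} → (Fin a → Fin b → Bool) → Graph
BipGraph {a} {b} E = record { V = Fin a ⊎ Fin b ; Adj = BipAdj E }

edges : ∀ {a b} → (Fin a → Fin b → Bool) → ℕ
edges {a} {b} E =
  sum (map (λ x → sum (map (λ y → if E x y then 1 else 0) (allFinL b))) (allFinL a))

_-free_ : Graph → Graph → Set
G -free H = (H ⊆G G) → ⊥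

{-# OPTIONS --safe #-}
-- Write ℓ = 2kℓ′ and αℓ = 2ka′, so that M = F^(2ka′) and N = F^(2kℓ′) for F = F_q. Put t = (k−1)a′ + kℓ′ and let x ∈ M
-- and y ∈ N be adjacent when the first t coordinates of y equal g₁, …, g_t at (x, other coordinates of y), the g_j being
-- polynomials of large bounded degree. Every x then has exactly q^(2kℓ′−t) neighbours, which is the required number of
-- edges, and the paths of length 2k between two given vertices are the solutions of 2kt equations in at most 2kt unknowns.
--
-- Some choice of the g_j leaves no pair of vertices with many disjoint paths. Fix the ends, and call the coefficients c bad
-- if there are ρ disjoint groups of w paths each. Picking one path z from each group, the 2kρ distinct edges determine
-- by interpolation the L = 2ktρ coefficients that matter as rational functions of the at most L unknowns z. If there were more
-- than O(q^(L−ρ)) bad c, they would contain a w-branching tree in more than L − ρ of the coordinates of c, and with the ρ groups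
-- this gives a set of pairs (c, z) on which at least w^(L+1) monomials are linearly independent. After clearing
-- denominators, however, these monomials are polynomials of degree O(w) in L variables, which span a space of dimension
-- O(w^L) only; this is a contradiction when w is large. For ρ > 2ℓ a union bound over the ends gives a choice without bad pairs.
module Submission where

-- The value of t comes from a balance. A path between two vertices of M has k inner vertices in N
-- and k - 1 in M, hence k · 2kℓ′ + (k - 1) · 2ka′ = 2kt unknown coordinates, and each of its 2k
-- edges imposes t equations. Finitely many paths are thus expected, but a system may degenerate for
-- particular ends. Degenerate systems are usually excluded by bounds on varieties over an algebraic
-- closure; the rank argument stays inside the finite field and uses only that it has no zero
-- divisors. The coefficients have to be rational functions of the paths. Interpolation in one
-- variable gives this, but edges are vectors, and no single linear form is injective on the edges
-- of all theta graphs. Hence there are T forms ψ_τ, each with its own block of coefficients: every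
-- theta graph in question is separated by some ψ_τ, and then only the block c_τ is averaged over
-- while the others stay fixed. Branching is w-fold because w distinct values are what makes the
-- powers with exponent below w independent. Every prime power q has to be served, so the field with
-- q elements is constructed as well, as the set of roots of X^q - X.

module Counting where

  open import Data.Nat using (ℕ; zero; suc; _+_; _*_; _^_; _≤_; _<_; z≤n; s≤s; _≤?_)
  open import Data.Nat.Properties hiding (suc-injective; _≟_)
  open import Data.Nat.Solver using (module +-*-Solver)
  open import Algebra.Properties.Semiring.Sum +-*-semiring using (sum; sum-cong-≗; ∑-comm; ∑-distrib-+; *-distribˡ-sum)
  open import Data.Fin using (Fin; zero; suc; combine; quotient; remainder; _↑ˡ_; _↑ʳ_)
  open import Data.Fin.Properties using (suc-injective; remQuot-combine)
  open import Data.Bool using (Bool; true; false; if_then_else_)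
  open import Data.Vec using (Vec; []; _∷_; _[_]≔_)
  open import Data.Product using (Σ; ∃; _×_; _,_; proj₁; proj₂)
  open import Data.Empty using (⊥-elim)
  open import Function using (_∘_)
  open import Relation.Nullary using (yes; no)
  open import Relation.Nullary.Decidable using (⌊_⌋)
  open import Relation.Binary.PropositionalEquality

  -- Counting by finite sums

  ind : Bool → ℕ
  ind b = if b then 1 else 0

  cnt : ∀ {n} → (Fin n → Bool) → ℕ
  cnt P = sum (λ i → ind (P i))

  sum-mono : ∀ {n} {f g : Fin n → ℕ} → (∀ i → f i ≤ g i) → sum f ≤ sum g
  sum-mono {zero}  h = z≤n
  sum-mono {suc n} h = +-mono-≤ (h zero) (sum-mono (h ∘ suc))

  sum-const : ∀ n c → sum {n} (λ _ → c) ≡ n * c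
  sum-const zero    c = refl
  sum-const (suc n) c = cong (c +_) (sum-const n c)

  sum-≤ : ∀ {n κ} {f : Fin n → ℕ} → (∀ i → f i ≤ κ) → sum f ≤ n * κ
  sum-≤ {n} {κ} h = ≤-trans (sum-mono h) (≤-reflexive (sum-const n κ))

  term≤sum : ∀ {n} (f : Fin n → ℕ) i → f i ≤ sum f
  term≤sum f zero    = m≤m+n _ _
  term≤sum f (suc i) = ≤-trans (term≤sum (f ∘ suc) i) (m≤n+m _ (f zero))

  sum<⇒term< : ∀ {n c} (f : Fin n → ℕ) → sum f < n * c → ∃ λ i → f i < c
  sum<⇒term< {zero}      f ()
  sum<⇒term< {suc n} {c} f h with c ≤? f zero
  ... | no c≰ = zero , ≰⇒> c≰
  ... | yes c≤ with sum<⇒term< (f ∘ suc) (+-cancelˡ-< c _ _ (≤-<-trans (+-monoˡ-≤ _ c≤) h))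
  ...   | i , lt = suc i , lt

  ind≤1 : ∀ b → ind b ≤ 1
  ind≤1 true  = ≤-refl
  ind≤1 false = z≤n

  cnt⇒injection : ∀ {n} w (P : Fin n → Bool) → w ≤ cnt P →
    Σ (Fin w → Fin n) λ f → (∀ {i j} → f i ≡ f j → i ≡ j) × (∀ i → P (f i) ≡ true)
  cnt⇒injection zero P h = (λ ()) , (λ { {()} }) , λ ()
  cnt⇒injection {zero} (suc w) P ()
  cnt⇒injection {suc n} (suc w) P h with P zero in eq
  ... | false with cnt⇒injection (suc w) (P ∘ suc) h
  ...   | f , inj , ok = suc ∘ f , inj ∘ suc-injective , ok
  cnt⇒injection {suc n} (suc w) P (s≤s h) | true with cnt⇒injection w (P ∘ suc) h
  ...   | f , inj , ok = f′ , inj′ , ok′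
    where
    f′ : Fin (suc w) → Fin (suc n)
    f′ zero    = zero
    f′ (suc i) = suc (f i)
    inj′ : ∀ {i j} → f′ i ≡ f′ j → i ≡ j
    inj′ {zero}  {zero}  e = refl
    inj′ {suc i} {suc j} e = cong suc (inj (suc-injective e))
    ok′ : ∀ i → P (f′ i) ≡ true
    ok′ zero    = eq
    ok′ (suc i) = ok i

  -- Double counting of the pairs (i, a) with f i = a: each i occurs in at least one of them, and
  -- each a in at most `ind (P a)`, by injectivity and `ok`.
  injection⇒cnt : ∀ {n} w (P : Fin n → Bool) (f : Fin w → Fin n) →
    (∀ {i j} → f i ≡ f j → i ≡ j) → (∀ i → P (f i) ≡ true) → w ≤ cnt P
  injection⇒cnt {n} w P f inj ok = ≤-trans (≤-reflexive (trans (sym (*-identityʳ w)) (sym (sum-const w 1))))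
      (≤-trans (sum-mono row) (≤-trans (≤-reflexive (∑-comm (λ i a → ind (hit i a)))) (sum-mono col)))
    where
    open import Data.Fin using (_≟_)
    hit : Fin w → Fin n → Bool
    hit i a = ⌊ f i ≟ a ⌋
    row : ∀ i → 1 ≤ sum (λ a → ind (hit i a))
    row i = ≤-trans hit! (term≤sum (λ a → ind (hit i a)) (f i))
      where
      hit! : 1 ≤ ind (hit i (f i))
      hit! with f i ≟ f i
      ... | yes _ = ≤-refl
      ... | no ¬e = ⊥-elim (¬e refl)
    few : ∀ {m} (g : Fin m → Fin n) → (∀ {i j} → g i ≡ g j → i ≡ j) → ∀ a → sum (λ i → ind ⌊ g i ≟ a ⌋) ≤ 1
    few {zero}  g gi a = z≤n
    few {suc m} g gi a with g zero ≟ a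
    ... | no _  = few (g ∘ suc) (suc-injective ∘ gi) a
    ... | yes e = s≤s (≤-reflexive (trans (sum-cong-≗ none) (trans (sum-const m 0) (*-zeroʳ m))))
      where
      none : ∀ i → ind ⌊ g (suc i) ≟ a ⌋ ≡ 0
      none i with g (suc i) ≟ a
      ... | no _ = refl
      ... | yes e′ with gi (trans e′ (sym e))
      ...   | ()
    col : ∀ a → sum (λ i → ind (hit i a)) ≤ ind (P a)
    col a with P a in eq
    ... | true  = few f inj a
    ... | false = ≤-reflexive (trans (sum-cong-≗ none) (trans (sum-const w 0) (*-zeroʳ w)))
      where
      none : ∀ i → ind (hit i a) ≡ 0
      none i with f i ≟ a
      ... | no _ = refl
      ... | yes refl with trans (sym (ok i)) eq
      ...   | ()

  sum-++ : ∀ m {n} (f : Fin (m + n) → ℕ) → sum f ≡ sum (λ i → f (i ↑ˡ n)) + sum (λ j → f (m ↑ʳ j))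
  sum-++ zero    f = refl
  sum-++ (suc m) f = trans (cong (f zero +_) (sum-++ m (f ∘ suc))) (sym (+-assoc (f zero) _ _))

  sum-combine : ∀ m n (f : Fin (m * n) → ℕ) → sum f ≡ sum {m} (λ i → sum {n} (λ j → f (combine i j)))
  sum-combine zero    n f = refl
  sum-combine (suc m) n f = trans (sum-++ n f) (cong (sum (λ j → f (j ↑ˡ m * n)) +_) (sum-combine m n (λ i → f (n ↑ʳ i))))

  sumV : ∀ {N} T → (Vec (Fin N) T → ℕ) → ℕ
  sumV zero    f = f []
  sumV (suc T) f = sum (λ a → sumV T (λ v → f (a ∷ v)))

  sumV-mono : ∀ {N} T {f g : Vec (Fin N) T → ℕ} → (∀ v → f v ≤ g v) → sumV T f ≤ sumV T g
  sumV-mono zero    h = h []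
  sumV-mono (suc T) h = sum-mono (λ a → sumV-mono T (λ v → h (a ∷ v)))

  sumV-const : ∀ {N} T c → sumV {N} T (λ _ → c) ≡ N ^ T * c
  sumV-const zero    c = sym (+-identityʳ c)
  sumV-const {N} (suc T) c = begin
    sum {N} (λ _ → sumV {N} T (λ _ → c)) ≡⟨ sum-cong-≗ {N} (λ _ → sumV-const T c) ⟩
    sum {N} (λ _ → N ^ T * c)           ≡⟨ sum-const N _ ⟩
    N * (N ^ T * c)                     ≡⟨ *-assoc N (N ^ T) c ⟨
    N * N ^ T * c                       ∎
    where open ≡-Reasoning

  sumV-sum-swap : ∀ {N M} T (f : Vec (Fin N) T → Fin M → ℕ) →
    sumV T (λ v → sum (f v)) ≡ sum (λ s → sumV T (λ v → f v s))
  sumV-sum-swap zero    f = refl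
  sumV-sum-swap (suc T) f =
    trans (sum-cong-≗ (λ a → sumV-sum-swap T (λ v → f (a ∷ v))))
          (∑-comm (λ a s → sumV T (λ v → f (a ∷ v) s)))

  sumV<⇒zero : ∀ {N} T (f : Vec (Fin N) T → ℕ) → sumV T f < N ^ T → ∃ λ v → f v ≡ 0
  sumV<⇒zero zero    f h = [] , n≤0⇒n≡0 (≤-pred h)
  sumV<⇒zero (suc T) f h with sum<⇒term< (λ a → sumV T (λ v → f (a ∷ v))) h
  ... | a , lt with sumV<⇒zero T (λ v → f (a ∷ v)) lt
  ...   | v , e = a ∷ v , e

  -- The sum over c does not depend on the entry of v that it overwrites. Summing the hypothesis
  -- over all v therefore counts each value of f exactly N times.
  sumV-average : ∀ {N κ} T (τ : Fin T) (f : Vec (Fin N) T → ℕ) →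
    (∀ v → sum (λ c → f (v [ τ ]≔ c)) ≤ κ) → N * sumV T f ≤ N ^ T * κ
  sumV-average {zero} (suc T) τ f h = z≤n
  sumV-average {suc N} {κ} (suc T) zero f h = begin
    suc N * sum (λ c → sumV T (λ v → f (c ∷ v))) ≡⟨ cong (suc N *_) (sumV-sum-swap T (λ v c → f (c ∷ v))) ⟨
    suc N * sumV T (λ v → sum (λ c → f (c ∷ v))) ≤⟨ *-monoʳ-≤ (suc N) (sumV-mono T (λ v → h (zero ∷ v))) ⟩
    suc N * sumV {suc N} T (λ _ → κ)             ≡⟨ cong (suc N *_) (sumV-const T κ) ⟩
    suc N * (suc N ^ T * κ)                      ≡⟨ *-assoc (suc N) (suc N ^ T) κ ⟨
    suc N * suc N ^ T * κ                        ∎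
    where open ≤-Reasoning
  sumV-average {N} {κ} (suc T) (suc τ) f h = begin
    N * sum (λ a → sumV T (λ v → f (a ∷ v)))   ≡⟨ *-distribˡ-sum N (λ a → sumV T (λ v → f (a ∷ v))) ⟩
    sum (λ a → N * sumV T (λ v → f (a ∷ v)))   ≤⟨ sum-≤ (λ a → sumV-average T τ (λ v → f (a ∷ v)) (λ v → h (a ∷ v))) ⟩
    N * (N ^ T * κ)                            ≡⟨ *-assoc N (N ^ T) κ ⟨
    N * N ^ T * κ                              ∎
    where open ≤-Reasoning

  finToVec : ∀ {N} T → Fin (N ^ T) → Vec (Fin N) T
  finToVec zero    i = []
  finToVec {N} (suc T) i = quotient {N} (N ^ T) i ∷ finToVec T (remainder {N} (N ^ T) i)

  sum-finToVec : ∀ {N} T (f : Vec (Fin N) T → ℕ) → sum (λ i → f (finToVec T i)) ≡ sumV T f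
  sum-finToVec zero    f = +-identityʳ _
  sum-finToVec {N} (suc T) f = trans (sum-combine N (N ^ T) (λ i → f (finToVec (suc T) i)))
    (sum-cong-≗ (λ a → trans
      (sum-cong-≗ (λ j → cong (λ r → f (proj₁ r ∷ finToVec T (proj₂ r))) (remQuot-combine a j)))
      (sum-finToVec T (λ v → f (a ∷ v)))))

  -- Branching trees inside large sets of points

  module Footprint {q : ℕ} (w : ℕ) where

    trues falses : ∀ {L} → Vec Bool L → ℕ
    trues []           = 0
    trues (true  ∷ μ)  = suc (trues μ)
    trues (false ∷ μ)  = trues μ
    falses []          = 0
    falses (true  ∷ μ) = falses μ
    falses (false ∷ μ) = suc (falses μ)

    -- The mask fixes the branching at each coordinate, w-fold at `true` and a single child at
    -- `false`. All branches have this same shape, but the values at later coordinates may vary with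
    -- the earlier ones.
    tree : ∀ {L} → Vec Bool L → (Vec (Fin q) L → Bool) → Bool
    tree []          B = B []
    tree (true  ∷ μ) B = ⌊ w ≤? cnt (λ a → tree μ (λ v → B (a ∷ v))) ⌋
    tree (false ∷ μ) B = ⌊ 1 ≤? cnt (λ a → tree μ (λ v → B (a ∷ v))) ⌋

    sumMask : ∀ L → (Vec Bool L → ℕ) → ℕ
    sumMask zero    f = f []
    sumMask (suc L) f = sumMask L (λ μ → f (true ∷ μ)) + sumMask L (λ μ → f (false ∷ μ))

    sumMask-+ : ∀ L (f g : Vec Bool L → ℕ) → sumMask L (λ μ → f μ + g μ) ≡ sumMask L f + sumMask L g
    sumMask-+ zero    f g = refl
    sumMask-+ (suc L) f g =
      trans (cong₂ _+_ (sumMask-+ L (f ∘ (true ∷_)) (g ∘ (true ∷_))) (sumMask-+ L (f ∘ (false ∷_)) (g ∘ (false ∷_))))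
            (solve 4 (λ a b c d → (a :+ b) :+ (c :+ d) := (a :+ c) :+ (b :+ d)) refl
               (sumMask L (f ∘ (true ∷_))) (sumMask L (g ∘ (true ∷_))) (sumMask L (f ∘ (false ∷_))) (sumMask L (g ∘ (false ∷_))))
      where open +-*-Solver

    sumMask-mono : ∀ L {f g : Vec Bool L → ℕ} → (∀ μ → f μ ≤ g μ) → sumMask L f ≤ sumMask L g
    sumMask-mono zero    h = h []
    sumMask-mono (suc L) h = +-mono-≤ (sumMask-mono L (λ μ → h (true ∷ μ))) (sumMask-mono L (λ μ → h (false ∷ μ)))

    sumMask-≤ : ∀ L {κ} {f : Vec Bool L → ℕ} → (∀ μ → f μ ≤ κ) → sumMask L f ≤ 2 ^ L * κ
    sumMask-≤ zero {κ} h = ≤-trans (h []) (m≤m+n _ _)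
    sumMask-≤ (suc L) {κ} h = begin
      _                         ≤⟨ +-mono-≤ (sumMask-≤ L (λ μ → h (true ∷ μ))) (sumMask-≤ L (λ μ → h (false ∷ μ))) ⟩
      2 ^ L * κ + 2 ^ L * κ     ≡⟨ solve 2 (λ a k → a :* k :+ a :* k := (con 2 :* a) :* k) refl (2 ^ L) κ ⟩
      2 * 2 ^ L * κ             ∎
      where
      open ≤-Reasoning
      open +-*-Solver

    sum-sumMask-swap : ∀ {n} L (f : Fin n → Vec Bool L → ℕ) →
      sum (λ a → sumMask L (f a)) ≡ sumMask L (λ μ → sum (λ a → f a μ))
    sum-sumMask-swap zero    f = refl
    sum-sumMask-swap (suc L) f = trans
      (∑-distrib-+ (λ a → sumMask L (f a ∘ (true ∷_))) (λ a → sumMask L (f a ∘ (false ∷_))))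
      (cong₂ _+_ (sum-sumMask-swap L (λ a → f a ∘ (true ∷_))) (sum-sumMask-swap L (λ a → f a ∘ (false ∷_))))

    weight : ∀ {L} → Vec Bool L → ℕ
    weight μ = w ^ falses μ * q ^ trues μ

    split-count : ∀ c → c ≤ q → c ≤ ind ⌊ w ≤? c ⌋ * q + ind ⌊ 1 ≤? c ⌋ * w
    split-count c c≤q with w ≤? c
    ... | yes _ = ≤-trans (≤-trans c≤q (≤-reflexive (sym (+-identityʳ q)))) (m≤m+n _ _)
    split-count zero c≤q | no _ = z≤n
    split-count (suc c) c≤q | no w≰ = ≤-trans (<⇒≤ (≰⇒> w≰)) (≤-reflexive (sym (+-identityʳ w)))

    -- The number of points is bounded by that of "standard monomials": a
    -- coordinate of which at least w values are rich is charged q, any other w.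
    footprint : ∀ L (B : Vec (Fin q) L → Bool) →
      sumV L (λ v → ind (B v)) ≤ sumMask L (λ μ → ind (tree μ B) * weight μ)
    footprint zero    B = ≤-reflexive (sym (*-identityʳ _))
    footprint (suc L) B = begin
      sum (λ a → sumV L (λ v → ind (B (a ∷ v))))
        ≤⟨ sum-mono (λ a → footprint L (λ v → B (a ∷ v))) ⟩
      sum (λ a → sumMask L (λ μ → ind (t μ a) * weight μ))
        ≡⟨ sum-sumMask-swap L (λ a μ → ind (t μ a) * weight μ) ⟩
      sumMask L (λ μ → sum (λ a → ind (t μ a) * weight μ))
        ≤⟨ sumMask-mono L step ⟩
      sumMask L (λ μ → f (true ∷ μ) + f (false ∷ μ))
        ≡⟨ sumMask-+ L (λ μ → f (true ∷ μ)) (λ μ → f (false ∷ μ)) ⟩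
      sumMask (suc L) f ∎
      where
      open ≤-Reasoning
      f : Vec Bool (suc L) → ℕ
      f μ = ind (tree μ B) * weight μ
      t : Vec Bool L → Fin q → Bool
      t μ a = tree μ (λ v → B (a ∷ v))
      step : ∀ μ → sum (λ a → ind (t μ a) * weight μ) ≤ f (true ∷ μ) + f (false ∷ μ)
      step μ = begin
        sum (λ a → ind (t μ a) * weight μ)   ≡⟨ sum-cong-≗ (λ a → *-comm (ind (t μ a)) (weight μ)) ⟩
        sum (λ a → weight μ * ind (t μ a))   ≡⟨ *-distribˡ-sum (weight μ) (λ a → ind (t μ a)) ⟨
        weight μ * cnt (t μ)                 ≤⟨ *-monoʳ-≤ (weight μ) (split-count (cnt (t μ))
                                                  (≤-trans (sum-≤ (λ a → ind≤1 (t μ a))) (≤-reflexive (*-identityʳ q)))) ⟩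
        weight μ * (ind ⌊ w ≤? cnt (t μ) ⌋ * q + ind ⌊ 1 ≤? cnt (t μ) ⌋ * w)
          ≡⟨ solve 6 (λ wf qt x q′ y w′ → (wf :* qt) :* (x :* q′ :+ y :* w′)
                        := x :* (wf :* (q′ :* qt)) :+ y :* ((w′ :* wf) :* qt)) refl
               (w ^ falses μ) (q ^ trues μ) (ind ⌊ w ≤? cnt (t μ) ⌋) q (ind ⌊ 1 ≤? cnt (t μ) ⌋) w ⟩
        f (true ∷ μ) + f (false ∷ μ) ∎
        where open +-*-Solver

    falses≤ : ∀ {L} (μ : Vec Bool L) → falses μ ≤ L
    falses≤ []          = z≤n
    falses≤ (true  ∷ μ) = m≤n⇒m≤1+n (falses≤ μ)
    falses≤ (false ∷ μ) = s≤s (falses≤ μ)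

    -- Exactly w distinct children are kept at a branching level, as many as the degree bound w can
    -- tell apart. Leaves are sets, since later they carry whole configurations.
    TreeOf : ∀ {L} → Vec Bool L → (Vec (Fin q) L → Set) → Set
    TreeOf []          B = B []
    TreeOf (true  ∷ μ) B = Σ (Fin w → Fin q) λ a → (∀ {i j} → a i ≡ a j → i ≡ j) × (∀ i → TreeOf μ (λ v → B (a i ∷ v)))
    TreeOf (false ∷ μ) B = Σ (Fin q) λ a → TreeOf μ (λ v → B (a ∷ v))

    tree⇒TreeOf : ∀ {L} (μ : Vec Bool L) (B : Vec (Fin q) L → Bool) → tree μ B ≡ true → TreeOf μ (λ v → B v ≡ true)
    tree⇒TreeOf []          B e = e
    tree⇒TreeOf (true  ∷ μ) B e with w ≤? cnt (λ a → tree μ (λ v → B (a ∷ v)))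
    ... | yes h with cnt⇒injection w _ h
    ...   | f , inj , ok = f , inj , λ i → tree⇒TreeOf μ (λ v → B (f i ∷ v)) (ok i)
    tree⇒TreeOf (false ∷ μ) B e with 1 ≤? cnt (λ a → tree μ (λ v → B (a ∷ v)))
    ... | yes h with cnt⇒injection 1 _ h
    ...   | f , inj , ok = f zero , tree⇒TreeOf μ (λ v → B (f zero ∷ v)) (ok zero)

    -- Each of the 2^L masks contributes at most w^L q^e. So crude a count suffices, because L and w
    -- will not depend on q.
    count-bound : ∀ L e (B : Vec (Fin q) L → Bool) → 1 ≤ w → 1 ≤ q →
      (∀ μ → tree μ B ≡ true → trues μ ≤ e) → sumV L (λ v → ind (B v)) ≤ 2 ^ L * (w ^ L * q ^ e)
    count-bound L e B (s≤s z≤n) (s≤s z≤n) h = ≤-trans (footprint L B) (sumMask-≤ L bound)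
      where
      bound : ∀ μ → ind (tree μ B) * weight μ ≤ w ^ L * q ^ e
      bound μ with tree μ B in eq
      ... | false = z≤n
      ... | true  = ≤-trans (≤-reflexive (+-identityʳ _))
                      (*-mono-≤ (^-monoʳ-≤ w (falses≤ μ)) (^-monoʳ-≤ q (h μ eq)))

-- Polynomial functions over a finite domain

module PolynomialFunctions where

  open import Level using (0ℓ)
  open import Algebra.Bundles using (CommutativeRing)
  open import Algebra.Structures using (IsCommutativeRing)
  open import Data.Nat as ℕ using (ℕ; zero; suc; _≤_; s≤s; _^_)
  import Data.Nat.Properties as ℕₚ
  open import Data.Fin using (Fin; zero; suc; combine; remQuot)
  open import Data.Fin.Properties using (suc-injective; remQuot-combine)
  open import Data.Bool using (Bool)
  open import Data.Vec using (Vec; []; _∷_; lookup)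
  open import Data.Product using (Σ; _,_; proj₁; proj₂)
  open import Data.Sum using (_⊎_; inj₁; inj₂)
  open import Data.Empty using (⊥; ⊥-elim)
  open import Function using (_∘_)
  open import Relation.Nullary using (¬_)
  open import Relation.Binary.PropositionalEquality

  -- Fractions are cross-multiplied throughout, so a field is only ever used through cancellation.
  -- With the carrier `Fin q`, coordinate vectors are numbers below powers of q.
  record FiniteDomain (q : ℕ) : Set where
    infixl 6 _+_
    infixl 7 _*_
    infix  8 -_
    field
      _+_ _*_ : Fin q → Fin q → Fin q
      -_      : Fin q → Fin q
      0# 1#   : Fin q
      isCommutativeRing : IsCommutativeRing _≡_ _+_ _*_ -_ 0# 1#
      noZeroDivisors    : ∀ {x y} → x * y ≡ 0# → x ≡ 0# ⊎ y ≡ 0#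
      1≢0               : ¬ (1# ≡ 0#)

    commutativeRing : CommutativeRing 0ℓ 0ℓ
    commutativeRing = record { isCommutativeRing = isCommutativeRing }

  module Polynomials {q : ℕ} (𝔽 : FiniteDomain q) where
    open FiniteDomain 𝔽
    open CommutativeRing commutativeRing
      using (+-comm; +-identityˡ; zeroʳ; -‿inverseʳ; commutativeSemiring; ring; _-_)
    open import Algebra.Properties.Ring ring using (+-cancelˡ; -1*x≈-x; x[y-z]≈xy-xz)
      renaming (x∙y⁻¹≈ε⇒x≈y to x-y≡0⇒x≡y; x≈y⇒x∙y⁻¹≈ε to x≡y⇒x-y≡0)
    open import Algebra.Solver.Ring.NaturalCoefficients.Default commutativeSemiring using (solve; _:=_; _:+_; _:*_; con)

    F : Set
    F = Fin q

    *-cancel : ∀ {x y z} → ¬ (x ≡ 0#) → x * y ≡ x * z → y ≡ z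
    *-cancel {x} {y} {z} x≢0 e with noZeroDivisors {x} {y - z} lemma
      where
      lemma : x * (y - z) ≡ 0#
      lemma = trans (x[y-z]≈xy-xz x y z) (x≡y⇒x-y≡0 e)
    ... | inj₁ x≡0 = ⊥-elim (x≢0 x≡0)
    ... | inj₂ d   = x-y≡0⇒x≡y y z d

    *-nonzero : ∀ {x y} → ¬ (x ≡ 0#) → ¬ (y ≡ 0#) → ¬ (x * y ≡ 0#)
    *-nonzero x≢0 y≢0 e with noZeroDivisors e
    ... | inj₁ x≡0 = x≢0 x≡0
    ... | inj₂ y≡0 = y≢0 y≡0

    -- Horner's scheme for the polynomial with coefficients b, lowest first, of degree below r.
    hor : ∀ {r} → (Fin r → F) → F → F
    hor {zero}  b x = 0#
    hor {suc r} b x = b zero + x * hor (b ∘ suc) x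

    hor-cong : ∀ {r} {b c : Fin r → F} → (∀ i → b i ≡ c i) → ∀ x → hor b x ≡ hor c x
    hor-cong {zero}  h x = refl
    hor-cong {suc r} h x = cong₂ (λ u v → u + x * v) (h zero) (hor-cong (h ∘ suc) x)

    hor-+ : ∀ {r} (b c : Fin r → F) x → hor (λ i → b i + c i) x ≡ hor b x + hor c x
    hor-+ {zero}  b c x = sym (+-identityˡ 0#)
    hor-+ {suc r} b c x = trans (cong (λ h → b zero + c zero + x * h) (hor-+ (b ∘ suc) (c ∘ suc) x))
      (solve 5 (λ b0 c0 x h k → (b0 :+ c0) :+ x :* (h :+ k) := (b0 :+ x :* h) :+ (c0 :+ x :* k)) refl
         (b zero) (c zero) x (hor (b ∘ suc) x) (hor (c ∘ suc) x))

    hor-*ˡ : ∀ {r} s (b : Fin r → F) x → hor (λ i → s * b i) x ≡ s * hor b x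
    hor-*ˡ {zero}  s b x = sym (zeroʳ s)
    hor-*ˡ {suc r} s b x = trans (cong (λ h → s * b zero + x * h) (hor-*ˡ s (b ∘ suc) x))
      (solve 4 (λ s b0 x h → s :* b0 :+ x :* (s :* h) := s :* (b0 :+ x :* h)) refl s (b zero) x (hor (b ∘ suc) x))

    hor-0 : ∀ r x → hor {r} (λ _ → 0#) x ≡ 0#
    hor-0 zero    x = refl
    hor-0 (suc r) x = trans (+-identityˡ _) (trans (cong (x *_) (hor-0 r x)) (zeroʳ x))

    hor-swap : ∀ {r s} (b : Fin r → Fin s → F) x y →
      hor (λ i → hor (b i) y) x ≡ hor (λ j → hor (λ i → b i j) x) y
    hor-swap {zero} {s} b x y = sym (hor-0 s y)
    hor-swap {suc r} {s} b x y = begin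
      hor (b zero) y + x * hor (λ i → hor (b (suc i)) y) x
        ≡⟨ cong (λ h → hor (b zero) y + x * h) (hor-swap (b ∘ suc) x y) ⟩
      hor (b zero) y + x * hor (λ j → hor (λ i → b (suc i) j) x) y
        ≡⟨ cong (hor (b zero) y +_) (hor-*ˡ x (λ j → hor (λ i → b (suc i) j) x) y) ⟨
      hor (b zero) y + hor (λ j → x * hor (λ i → b (suc i) j) x) y
        ≡⟨ hor-+ (b zero) _ y ⟨
      hor (λ j → b zero j + x * hor (λ i → b (suc i) j) x) y ∎
      where open ≡-Reasoning

    -- Synthetic division: the coefficients of (b(Y) - b(x)) / (Y - x).
    quot : ∀ {r} → (Fin (suc r) → F) → F → Fin r → F
    quot b x zero    = hor (b ∘ suc) x
    quot {suc r} b x (suc i) = quot (b ∘ suc) x i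

    hor-quot : ∀ {r} (b : Fin (suc r) → F) x y →
      hor b y + x * hor (quot b x) y ≡ hor b x + y * hor (quot b x) y
    hor-quot {zero}  b x y = solve 3 (λ b x y → (b :+ y :* con 0) :+ x :* con 0 := (b :+ x :* con 0) :+ y :* con 0) refl (b zero) x y
    hor-quot {suc r} b x y = begin
      (b zero + y * H y) + x * (H x + y * K)  ≡⟨ solve 6 (λ b x y hy hx k → (b :+ y :* hy) :+ x :* (hx :+ y :* k)
                                                     := (b :+ x :* hx) :+ y :* (hy :+ x :* k)) refl (b zero) x y (H y) (H x) K ⟩
      (b zero + x * H x) + y * (H y + x * K)  ≡⟨ cong (λ h → b zero + x * H x + y * h) (hor-quot (b ∘ suc) x y) ⟩
      (b zero + x * H x) + y * (H x + y * K)  ∎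
      where
      open ≡-Reasoning
      H = hor (b ∘ suc)
      K = hor (quot (b ∘ suc) x) y

    quot-cong-injective : ∀ {r} (b c : Fin (suc r) → F) x →
      hor b x ≡ hor c x → (∀ i → quot b x i ≡ quot c x i) → ∀ i → b i ≡ c i
    quot-cong-injective {zero} b c x e h zero =
      trans (sym (simp (b zero))) (trans e (simp (c zero)))
      where
      simp : ∀ u → u + x * 0# ≡ u
      simp u = solve 2 (λ u x → u :+ x :* con 0 := u) refl u x
    quot-cong-injective {suc r} b c x e h (suc i) =
      quot-cong-injective (b ∘ suc) (c ∘ suc) x (h zero) (h ∘ suc) i
    quot-cong-injective {suc r} b c x e h zero =
      +-cancelˡ (x * hor (c ∘ suc) x) (b zero) (c zero)
        (trans (+-comm _ (b zero)) (trans (trans (cong (λ z → b zero + x * z) (sym (h zero))) e) (+-comm (c zero) _)))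

    private
      cross : ∀ {u v k k′ x y} → ¬ (y ≡ x) → u + x * k ≡ v + y * k → u + x * k′ ≡ v + y * k′ → k ≡ k′
      cross {u} {v} {k} {k′} {x} {y} y≢x e e′ =
        *-cancel (λ d → y≢x (x-y≡0⇒x≡y y x d)) (+-cancelˡ v _ _ (trans (sym (move e)) (move e′)))
        where
        move : ∀ {k} → u + x * k ≡ v + y * k → u ≡ v + (y - x) * k
        move {k} e = +-cancelˡ (x * k) _ _ (trans (+-comm (x * k) u) (trans e (sym (begin
          x * k + (v + (y + - x) * k)     ≡⟨ solve 5 (λ x k v y m → x :* k :+ (v :+ (y :+ m) :* k)
                                                := v :+ y :* k :+ (x :+ m) :* k) refl x k v y (- x) ⟩
          v + y * k + (x + - x) * k       ≡⟨ cong (λ z → v + y * k + z * k) (-‿inverseʳ x) ⟩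
          v + y * k + 0# * k              ≡⟨ solve 3 (λ v y k → v :+ y :* k :+ con 0 :* k := v :+ y :* k) refl v y k ⟩
          v + y * k                       ∎))))
          where open ≡-Reasoning

    -- Division by X - x₀ leaves one coefficient and one node fewer. By `cross`, the quotients of b
    -- and c agree at the remaining nodes, where X - x₀ can be cancelled.
    hor-injective : ∀ {r} (b c : Fin r → F) (x : Fin r → F) → (∀ {i j} → x i ≡ x j → i ≡ j) →
      (∀ i → hor b (x i) ≡ hor c (x i)) → ∀ i → b i ≡ c i
    hor-injective {zero}  b c x inj e ()
    hor-injective {suc r} b c x inj e = quot-cong-injective b c x₀ (e zero)
      (hor-injective (quot b x₀) (quot c x₀) (x ∘ suc) (suc-injective ∘ inj) λ i →
        cross {hor b (x (suc i))} {hor b x₀} (λ p → case (inj p)) (hor-quot b x₀ (x (suc i)))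
          (trans (cong (_+ x₀ * hor (quot c x₀) (x (suc i))) (e (suc i)))
            (trans (hor-quot c x₀ (x (suc i))) (cong (_+ x (suc i) * hor (quot c x₀) (x (suc i))) (sym (e zero))))))
      where
      x₀ = x zero
      case : ∀ {i : Fin r} → _≡_ {A = Fin (suc r)} (suc i) zero → ⊥
      case ()

    pow : F → ℕ → F
    pow x zero    = 1#
    pow x (suc n) = x * pow x n

    pow-nonzero : ∀ {x} n → ¬ (x ≡ 0#) → ¬ (pow x n ≡ 0#)
    pow-nonzero zero    x≢0 = 1≢0
    pow-nonzero (suc n) x≢0 = *-nonzero x≢0 (pow-nonzero n x≢0)

    -- Degrees are bounded in each variable separately: by D, except by m in the first variable of IsPoly₁.
    data IsPoly : ∀ {Z} → ℕ → (Vec F Z → F) → Set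
    record IsPoly₁ {Z : ℕ} (m D : ℕ) (h : Vec F (suc Z) → F) : Set

    data IsPoly where
      nullary : ∀ {D} {h : Vec F 0 → F} → IsPoly D h
      step    : ∀ {Z D} {h : Vec F (suc Z) → F} → IsPoly₁ D D h → IsPoly D h

    record IsPoly₁ {Z} m D h where
      inductive
      constructor mkPoly
      field
        coeffs   : Fin (suc m) → Vec F Z → F
        areCoeff : ∀ i → IsPoly D (coeffs i)
        expand   : ∀ z zs → h (z ∷ zs) ≡ hor (λ i → coeffs i zs) z

    poly-resp : ∀ {Z D} {h k : Vec F Z → F} → (∀ z → h z ≡ k z) → IsPoly D h → IsPoly D k
    poly-resp e nullary = nullary
    poly-resp e (step (mkPoly hs ps r)) = step (mkPoly hs ps λ z zs → trans (sym (e (z ∷ zs))) (r z zs))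

    poly-const : ∀ {Z D} c → IsPoly {Z} D (λ _ → c)
    poly-const {zero}  c = nullary
    poly-const {suc Z} {D} c = step (mkPoly hs ps λ z zs → sym (trans (cong (λ h → c + z * h) (hor-0 D z))
        (solve 2 (λ c z → c :+ z :* con 0 := c) refl c z)))
      where
      hs : Fin (suc D) → Vec F Z → F
      hs zero    _ = c
      hs (suc _) _ = 0#
      ps : ∀ i → IsPoly D (hs i)
      ps zero    = poly-const c
      ps (suc i) = poly-const 0#

    poly₁-+ : ∀ {Z m D} {h k : Vec F (suc Z) → F} → IsPoly₁ m D h → IsPoly₁ m D k → IsPoly₁ m D (λ z → h z + k z)
    poly-+  : ∀ {Z D} {h k : Vec F Z → F} → IsPoly D h → IsPoly D k → IsPoly D (λ z → h z + k z)
    poly₁-+ (mkPoly hs ps r) (mkPoly ks qs s) = mkPoly (λ i zs → hs i zs + ks i zs) (λ i → poly-+ (ps i) (qs i))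
      λ z zs → trans (cong₂ _+_ (r z zs) (s z zs)) (sym (hor-+ (λ i → hs i zs) (λ i → ks i zs) z))
    poly-+ nullary  nullary   = nullary
    poly-+ (step p) (step p′) = step (poly₁-+ p p′)

    poly₁-pad : ∀ {Z m m′ D} {h : Vec F (suc Z) → F} → m ≤ m′ → IsPoly₁ m D h → IsPoly₁ m′ D h
    poly₁-pad {Z} {m} {m′} {D} m≤ (mkPoly hs ps r) = mkPoly (λ i → ext hs i) (λ i → ext-poly hs ps i) λ z zs → trans (r z zs) (sym (ext-hor m≤ hs z zs))
      where
      ext : ∀ {m m′} → (Fin (suc m) → Vec F Z → F) → Fin (suc m′) → Vec F Z → F
      ext hs zero = hs zero
      ext {zero}  {suc m′} hs (suc i) = λ _ → 0#
      ext {suc m} {suc m′} hs (suc i) = ext (hs ∘ suc) i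
      ext-poly : ∀ {m m′} (hs : Fin (suc m) → Vec F Z → F) → (∀ i → IsPoly D (hs i)) → ∀ i → IsPoly D (ext {m} {m′} hs i)
      ext-poly hs ps zero = ps zero
      ext-poly {zero}  {suc m′} hs ps (suc i) = poly-const 0#
      ext-poly {suc m} {suc m′} hs ps (suc i) = ext-poly (hs ∘ suc) (ps ∘ suc) i
      ext-hor : ∀ {m m′} → m ≤ m′ → (hs : Fin (suc m) → Vec F Z → F) → ∀ z zs →
        hor (λ i → ext {m} {m′} hs i zs) z ≡ hor (λ i → hs i zs) z
      ext-hor {zero}  {zero}   _ hs z zs = refl
      ext-hor {zero}  {suc m′} _ hs z zs = cong (λ h → hs zero zs + z * h) (hor-0 (suc m′) z)
      ext-hor {suc m} {suc m′} (s≤s l) hs z zs = cong (λ h → hs zero zs + z * h) (ext-hor l (hs ∘ suc) z zs)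

    poly-weaken : ∀ {Z D D′} {h : Vec F Z → F} → D ≤ D′ → IsPoly D h → IsPoly D′ h
    poly-weaken l nullary = nullary
    poly-weaken l (step (mkPoly hs ps r)) = step (poly₁-pad l (mkPoly hs (λ i → poly-weaken l (ps i)) r))

    poly-* : ∀ {Z D D′} {h k : Vec F Z → F} → IsPoly D h → IsPoly D′ k → IsPoly (D ℕ.+ D′) (λ z → h z * k z)
    poly-* nullary nullary = nullary
    poly-* {suc Z} {D} {D′} {h} {k} (step (mkPoly hs ps r)) (step (mkPoly ks qs s)) =
      poly-resp (λ { (z ∷ zs) → cong (_* k (z ∷ zs)) (sym (r z zs)) }) (step (go D hs ps))
      where
      -- The recursion peels off the Horner form of the first factor. Only the degree in the leading
      -- variable changes on the way, which is why `IsPoly₁` bounds that degree separately.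
      go : ∀ m (hs : Fin (suc m) → Vec F Z → F) → (∀ i → IsPoly D (hs i)) →
        IsPoly₁ (m ℕ.+ D′) (D ℕ.+ D′) (λ { (z ∷ zs) → hor (λ i → hs i zs) z * k (z ∷ zs) })
      scale : (g : Vec F Z → F) → IsPoly D g → IsPoly₁ D′ (D ℕ.+ D′) (λ { (z ∷ zs) → g zs * k (z ∷ zs) })
      scale g pg = mkPoly (λ i zs → g zs * ks i zs) (λ i → poly-* pg (qs i))
        λ z zs → trans (cong (g zs *_) (s z zs)) (sym (hor-*ˡ (g zs) (λ i → ks i zs) z))
      shift : ∀ {m} {g : Vec F (suc Z) → F} → IsPoly₁ m (D ℕ.+ D′) g → IsPoly₁ (suc m) (D ℕ.+ D′) (λ { (z ∷ zs) → z * g (z ∷ zs) })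
      shift {m} (mkPoly gs pg t) = mkPoly gs′ pg′ λ z zs → trans (cong (z *_) (t z zs)) (sym (+-identityˡ _))
        where
        gs′ : Fin (suc (suc m)) → Vec F Z → F
        gs′ zero    _ = 0#
        gs′ (suc i)   = gs i
        pg′ : ∀ i → IsPoly (D ℕ.+ D′) (gs′ i)
        pg′ zero    = poly-const 0#
        pg′ (suc i) = pg i
      resp₁ : ∀ {m D} {h k : Vec F (suc Z) → F} → (∀ z → h z ≡ k z) → IsPoly₁ m D h → IsPoly₁ m D k
      resp₁ e (mkPoly hs ps r) = mkPoly hs ps λ z zs → trans (sym (e (z ∷ zs))) (r z zs)
      go zero hs ps = resp₁ (λ { (z ∷ zs) → cong (_* k (z ∷ zs)) (solve 2 (λ a z → a := a :+ z :* con 0) refl (hs zero zs) z) })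
                        (scale (hs zero) (ps zero))
      go (suc m) hs ps = resp₁
        (λ { (z ∷ zs) → solve 4 (λ a z h k → a :* k :+ z :* (h :* k) := (a :+ z :* h) :* k) refl
                          (hs zero zs) z (hor (λ i → hs (suc i) zs) z) (k (z ∷ zs)) })
        (poly₁-+ (poly₁-pad (ℕₚ.m≤n+m D′ (suc m)) (scale (hs zero) (ps zero)))
                 (shift (go m (hs ∘ suc) (ps ∘ suc))))

    poly-lookup : ∀ {Z} (i : Fin Z) → IsPoly 1 (λ z → lookup z i)
    poly-lookup {suc Z} zero = step (mkPoly hs (λ { zero → poly-const 0# ; (suc zero) → poly-const 1# })
        λ z zs → solve 1 (λ z → z := con 0 :+ z :* (con 1 :+ z :* con 0)) refl z)
      where
      hs : Fin 2 → Vec F Z → F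
      hs zero    _ = 0#
      hs (suc _) _ = 1#
    poly-lookup {suc Z} (suc i) = step (mkPoly hs (λ { zero → poly-lookup i ; (suc zero) → poly-const 0# })
        λ z zs → solve 2 (λ a z → a := a :+ z :* (con 0 :+ z :* con 0)) refl (lookup zs i) z)
      where
      hs : Fin 2 → Vec F Z → F
      hs zero    zs = lookup zs i
      hs (suc _) _  = 0#

    poly-neg : ∀ {Z D} {h : Vec F Z → F} → IsPoly D h → IsPoly D (λ z → - h z)
    poly-neg {Z} {h = h} p = poly-resp (λ z → -1*x≈-x (h z))
      (poly-* {D = 0} (poly-const (- 1#)) p)

    poly-hor : ∀ {Z D r} (b : Fin r → F) {x : Vec F Z → F} → IsPoly D x → IsPoly (r ℕ.* D) (λ z → hor b (x z))
    poly-hor {r = zero}  b p = poly-const 0#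
    poly-hor {r = suc r} b p = poly-+ (poly-const (b zero)) (poly-* p (poly-hor (b ∘ suc) p))

    -- The point x is constant, so the degree does not grow with r. Applied to the coordinates of an
    -- edge, this keeps the nodes ψ_τ(e) of degree 1 in the unknowns.
    poly-horᵛ : ∀ {Z D r} {b : Fin r → Vec F Z → F} → (∀ i → IsPoly D (b i)) → ∀ x → IsPoly D (λ z → hor (λ i → b i z) x)
    poly-horᵛ {r = zero}  p x = poly-const 0#
    poly-horᵛ {r = suc r} p x = poly-+ (p zero) (poly-* {D = 0} (poly-const x) (poly-horᵛ (p ∘ suc) x))

    poly-pow : ∀ {Z D} {h : Vec F Z → F} n → IsPoly D h → IsPoly (n ℕ.* D) (λ z → pow (h z) n)
    poly-pow zero    p = poly-const 1#
    poly-pow (suc n) p = poly-* p (poly-pow n p)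

    -- A tensor b of w^E coefficients is the polynomial in E variables of degree < w in each of them.
    contract : ∀ w E → (Fin (w ^ suc E) → F) → F → Fin (w ^ E) → F
    contract w E b x α = hor (λ i → b (combine {w} i α)) x

    evalT : ∀ w E → (Fin (w ^ E) → F) → Vec F E → F
    evalT w zero    b []      = b zero
    evalT w (suc E) b (x ∷ v) = evalT w E (contract w E b x) v

    evalT-cong : ∀ w E {b c : Fin (w ^ E) → F} → (∀ i → b i ≡ c i) → ∀ v → evalT w E b v ≡ evalT w E c v
    evalT-cong w zero    h []      = h zero
    evalT-cong w (suc E) h (x ∷ v) = evalT-cong w E (λ α → hor-cong (λ i → h (combine {w} i α)) x) v

    evalT-hor : ∀ w E {r} (b : Fin r → Fin (w ^ E) → F) x v →
      evalT w E (λ α → hor (λ i → b i α) x) v ≡ hor (λ i → evalT w E (b i) v) x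
    evalT-hor w zero    b x []      = refl
    evalT-hor w (suc E) b x (y ∷ v) = trans
      (evalT-cong w E (λ α → hor-swap (λ j i → b i (combine {w} j α)) y x) v)
      (evalT-hor w E (λ i → contract w E (b i) y) x v)

    evalT-*ˡ : ∀ w E s (b : Fin (w ^ E) → F) v → evalT w E (λ α → s * b α) v ≡ s * evalT w E b v
    evalT-*ˡ w zero    s b []      = refl
    evalT-*ˡ w (suc E) s b (x ∷ v) = trans
      (evalT-cong w E (λ α → hor-*ˡ s (λ i → b (combine {w} i α)) x) v)
      (evalT-*ˡ w E s (contract w E b x) v)

    -- Bounds the number of polynomial functions: each comes from a table of (D + 1)^Z field
    -- elements. This replaces the dimension of a space of polynomials.
    poly-coeff : ∀ {Z D} {h : Vec F Z → F} → IsPoly D h →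
      Σ (Fin (suc D ^ Z) → F) λ b → ∀ z → h z ≡ evalT (suc D) Z b z
    poly-coeff {h = h} nullary = (λ _ → h []) , λ { [] → refl }
    poly-coeff {suc Z} {D} {h} (step (mkPoly hs ps r)) = b , eq
      where
      c : Fin (suc D) → Fin (suc D ^ Z) → F
      c i = proj₁ (poly-coeff (ps i))
      b : Fin (suc D ^ suc Z) → F
      b j = c (proj₁ (remQuot (suc D ^ Z) j)) (proj₂ (remQuot {suc D} (suc D ^ Z) j))
      eq : ∀ z → h z ≡ evalT (suc D) (suc Z) b z
      eq (z ∷ zs) = begin
        h (z ∷ zs)                                 ≡⟨ r z zs ⟩
        hor (λ i → hs i zs) z                      ≡⟨ hor-cong (λ i → proj₂ (poly-coeff (ps i)) zs) z ⟩
        hor (λ i → evalT (suc D) Z (c i) zs) z     ≡⟨ evalT-hor (suc D) Z c z zs ⟨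
        evalT (suc D) Z (λ α → hor (λ i → c i α) z) zs
          ≡⟨ evalT-cong (suc D) Z (λ α → hor-cong (λ i → cong (λ p → c (proj₁ p) (proj₂ p)) (sym (remQuot-combine {suc D} i α))) z) zs ⟩
        evalT (suc D) (suc Z) b (z ∷ zs)           ∎
        where open ≡-Reasoning

-- Rational functions and the rank argument

module RichTrees where

  open import Algebra.Bundles using (CommutativeRing)
  open import Data.Nat as ℕ using (ℕ; zero; suc; _≤_; _<_; _^_)
  import Data.Nat.Properties as ℕₚ
  open import Data.Nat.Solver using (module +-*-Solver)
  open import Data.Fin using (Fin; zero; suc; combine; finToFun; funToFin)
  open import Data.Fin.Properties using (combine-surjective; finToFun-funToFin; funToFin-finToFin; pigeonhole; <⇒≢; suc-injective)
  open import Data.Bool using (Bool; true; false)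
  open import Data.Vec using (Vec; []; _∷_; lookup; replicate; tail)
  open import Data.Product using (Σ; _×_; _,_; proj₁; proj₂)
  open import Data.Empty using (⊥)
  open import Function using (_∘_)
  open import Relation.Nullary using (¬_)
  open import Relation.Binary.PropositionalEquality
  open Counting
  open PolynomialFunctions

  -- The degree bound that `interpolate` produces from values of degree D and nodes of degree d.
  -- Divided differences have degree D + D + d, and undoing the division turns a common bound E into
  -- E + (d + E).
  degS : ℕ → ℕ → ℕ → ℕ
  degS zero    D d = 0
  degS (suc r) D d = E ℕ.+ (d ℕ.+ E)
    where E = D ℕ.+ degS r ((D ℕ.+ D) ℕ.+ d) d

  funToFin-cong : ∀ {m n} {f g : Fin m → Fin n} → (∀ i → f i ≡ g i) → funToFin f ≡ funToFin g
  funToFin-cong {zero}  h = refl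
  funToFin-cong {suc m} h = cong₂ combine (h zero) (funToFin-cong (h ∘ suc))

  module RationalFunctions {q : ℕ} (𝔽 : FiniteDomain q) {Ω : Set} {Z : ℕ} (pt : Ω → Vec (Fin q) Z) where
    open FiniteDomain 𝔽
    open Polynomials 𝔽
    open CommutativeRing commutativeRing
      using (+-assoc; *-assoc; *-identityˡ; -‿inverseʳ; -‿inverseˡ; commutativeSemiring; ring; _-_)
    open import Algebra.Properties.Ring ring using (+-cancelʳ; -‿distribʳ-*)
      renaming (x∙y⁻¹≈ε⇒x≈y to x-y≡0⇒x≡y)
    open import Algebra.Solver.Ring.NaturalCoefficients.Default commutativeSemiring using (solve; _:=_; _:+_; _:*_; con)

    -- The denominator has to be nonzero only at the points `pt ω`. Differences of interpolation
    -- nodes are then admissible denominators, as Ω will contain only configurations with distinct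
    -- nodes.
    record Rat (D : ℕ) (h : Ω → F) : Set where
      constructor mkRat
      field
        num den  : Vec F Z → F
        num-poly : IsPoly D num
        den-poly : IsPoly D den
        den≢0    : ∀ ω → ¬ (den (pt ω) ≡ 0#)
        fraction : ∀ ω → den (pt ω) * h ω ≡ num (pt ω)

    rat-resp : ∀ {D} {h k : Ω → F} → (∀ ω → h ω ≡ k ω) → Rat D h → Rat D k
    rat-resp e (mkRat n d pn pd nz f) = mkRat n d pn pd nz λ ω → trans (cong (d (pt ω) *_) (sym (e ω))) (f ω)

    rat-weaken : ∀ {D D′} {h : Ω → F} → D ≤ D′ → Rat D h → Rat D′ h
    rat-weaken l (mkRat n d pn pd nz f) = mkRat n d (poly-weaken l pn) (poly-weaken l pd) nz f

    rat-poly : ∀ {D g} → IsPoly D g → Rat D (g ∘ pt)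
    rat-poly {g = g} p = mkRat g (λ _ → 1#) p (poly-const 1#) (λ _ → 1≢0) λ ω → *-identityˡ _

    rat-+ : ∀ {D D′} {h k : Ω → F} → Rat D h → Rat D′ k → Rat (D ℕ.+ D′) (λ ω → h ω + k ω)
    rat-+ {D} {D′} {h} {k} (mkRat n d pn pd nz f) (mkRat n′ d′ pn′ pd′ nz′ f′) = mkRat
      (λ z → n z * d′ z + d z * n′ z) (λ z → d z * d′ z)
      (poly-+ (poly-* pn pd′) (poly-* pd pn′)) (poly-* pd pd′) (λ ω → *-nonzero (nz ω) (nz′ ω))
      λ ω → trans (solve 4 (λ d d′ h k → (d :* d′) :* (h :+ k) := (d :* h) :* d′ :+ d :* (d′ :* k)) refl
                     (d (pt ω)) (d′ (pt ω)) (h ω) (k ω))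
                  (cong₂ (λ a b → a * d′ (pt ω) + d (pt ω) * b) (f ω) (f′ ω))

    rat-* : ∀ {D D′} {h k : Ω → F} → Rat D h → Rat D′ k → Rat (D ℕ.+ D′) (λ ω → h ω * k ω)
    rat-* {D} {D′} {h} {k} (mkRat n d pn pd nz f) (mkRat n′ d′ pn′ pd′ nz′ f′) = mkRat
      (λ z → n z * n′ z) (λ z → d z * d′ z)
      (poly-* pn pn′) (poly-* pd pd′) (λ ω → *-nonzero (nz ω) (nz′ ω))
      λ ω → trans (solve 4 (λ d d′ h k → (d :* d′) :* (h :* k) := (d :* h) :* (d′ :* k)) refl
                     (d (pt ω)) (d′ (pt ω)) (h ω) (k ω))
                  (cong₂ _*_ (f ω) (f′ ω))

    rat-neg : ∀ {D} {h : Ω → F} → Rat D h → Rat D (λ ω → - h ω)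
    rat-neg {h = h} (mkRat n d pn pd nz f) = mkRat (λ z → - n z) d (poly-neg pn) pd nz
      λ ω → trans (sym (-‿distribʳ-* (d (pt ω)) (h ω))) (cong -_ (f ω))

    rat-div : ∀ {D D′} {g : Vec F Z → F} {h k : Ω → F} → IsPoly D′ g → (∀ ω → ¬ (g (pt ω) ≡ 0#)) →
      (∀ ω → g (pt ω) * h ω ≡ k ω) → Rat D k → Rat (D ℕ.+ D′) h
    rat-div {g = g} {h} pg g≢0 e (mkRat n d pn pd nz f) = mkRat n (λ z → d z * g z)
      (poly-weaken (ℕₚ.m≤m+n _ _) pn) (poly-* pd pg) (λ ω → *-nonzero (nz ω) (g≢0 ω))
      λ ω → trans (*-assoc (d (pt ω)) (g (pt ω)) (h ω)) (trans (cong (d (pt ω) *_) (e ω)) (f ω))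

    -- Inverts synthetic division. The constant coefficient is the value at x minus x times the
    -- first quotient coefficient; that quotient coefficient is in turn the value at x of the
    -- remaining polynomial.
    recover : ∀ {r E d} (c : Fin (suc r) → Ω → F) {x : Vec F Z → F} → IsPoly d x →
      Rat E (λ ω → hor (λ b → c b ω) (x (pt ω))) →
      (∀ i → Rat E (λ ω → quot (λ b → c b ω) (x (pt ω)) i)) → ∀ b → Rat (E ℕ.+ (d ℕ.+ E)) (c b)
    recover {zero} c {x} px top qs zero = rat-weaken (ℕₚ.m≤m+n _ _)
      (rat-resp (λ ω → solve 2 (λ c x → c :+ x :* con 0 := c) refl (c zero ω) (x (pt ω))) top)
    recover {suc r} {E} {d} c {x} px top qs (suc b) = recover (c ∘ suc) px (qs zero) (qs ∘ suc) b
    recover {suc r} {E} {d} c {x} px top qs zero =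
      rat-resp (λ ω → cancel (c zero ω) (x (pt ω) * hor (λ b → c (suc b) ω) (x (pt ω))))
        (rat-+ top (rat-neg (rat-* (rat-poly px) (qs zero))))
      where
      cancel : ∀ u v → u + v + - v ≡ u
      cancel u v = trans (+-assoc u v (- v)) (trans (cong (u +_) (-‿inverseʳ v))
        (solve 1 (λ u → u :+ con 0 := u) refl u))

    -- The coefficients of a polynomial of degree < r are rational functions of
    -- r distinct nodes and the values there.
    interpolate : ∀ r {D d} (c : Fin r → Ω → F) (ψ : Fin r → Vec F Z → F) (v : Fin r → Ω → F) →
      (∀ i → IsPoly d (ψ i)) → (∀ i → Rat D (v i)) →
      (∀ i ω → hor (λ b → c b ω) (ψ i (pt ω)) ≡ v i ω) →
      (∀ ω {i j} → ψ i (pt ω) ≡ ψ j (pt ω) → i ≡ j) →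
      ∀ b → Rat (degS r D d) (c b)
    interpolate (suc r) {D} {d} c ψ v pψ rv e sep = recover c (pψ zero)
        (rat-weaken (ℕₚ.m≤m+n _ _) (rat-resp (λ ω → sym (e zero ω)) (rv zero)))
        (λ i → rat-weaken (ℕₚ.m≤n+m _ D) (interpolate r c′ (ψ ∘ suc) v′ (pψ ∘ suc) rv′ (λ i ω → refl)
           (λ ω p → suc-injective (sep ω p)) i))
      where
      c′ : Fin r → Ω → F
      c′ b ω = quot (λ b → c b ω) (ψ zero (pt ω)) b
      v′ : Fin r → Ω → F
      v′ i ω = hor (λ b → c′ b ω) (ψ (suc i) (pt ω))
      key : ∀ {hy hx x y K} → hy + x * K ≡ hx + y * K → (y + - x) * K ≡ hy + - hx
      key {hy} {hx} {x} {y} {K} p = +-cancelʳ (hx + x * K) _ _ (begin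
        (y + - x) * K + (hx + x * K)      ≡⟨ solve 5 (λ y m K hx x → (y :+ m) :* K :+ (hx :+ x :* K)
                                                := (hx :+ y :* K) :+ (x :+ m) :* K) refl y (- x) K hx x ⟩
        (hx + y * K) + (x + - x) * K      ≡⟨ cong₂ (λ a b → a + b * K) (sym p) (-‿inverseʳ x) ⟩
        (hy + x * K) + 0# * K             ≡⟨ solve 3 (λ hy x K → (hy :+ x :* K) :+ con 0 :* K := con 0 :+ (hy :+ x :* K)) refl hy x K ⟩
        0# + (hy + x * K)                 ≡⟨ cong (_+ (hy + x * K)) (-‿inverseˡ hx) ⟨
        - hx + hx + (hy + x * K)          ≡⟨ solve 5 (λ m hx hy x K → (m :+ hx) :+ (hy :+ x :* K)
                                                := (hy :+ m) :+ (hx :+ x :* K)) refl (- hx) hx hy x K ⟩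
        (hy + - hx) + (hx + x * K)        ∎)
        where open ≡-Reasoning
      -- The values of the quotient at the other nodes are the divided differences (v_i - v_0) /
      -- (ψ_i - ψ_0), and `sep` keeps their denominators away from zero.
      rv′ : ∀ i → Rat ((D ℕ.+ D) ℕ.+ d) (v′ i)
      rv′ i = rat-div {g = λ z → ψ (suc i) z + - ψ zero z} (poly-+ (pψ (suc i)) (poly-neg (pψ zero)))
        (λ ω p → zero≢suc (sep ω (x-y≡0⇒x≡y (ψ (suc i) (pt ω)) (ψ zero (pt ω)) p)))
        (λ ω → trans (key (hor-quot (λ b → c b ω) (ψ zero (pt ω)) (ψ (suc i) (pt ω))))
                     (cong₂ (λ a b → a + - b) (e (suc i) ω) (e zero ω)))
        (rat-+ (rv (suc i)) (rat-neg (rv zero)))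
        where
        zero≢suc : _≡_ {A = Fin (suc r)} (suc i) zero → ⊥
        zero≢suc ()

    -- This is d^r · b(n/d). The exponent is the number of coefficients, so the empty polynomial
    -- needs no separate treatment.
    homog : ∀ {r} → (Fin r → F) → F → F → F
    homog {zero}  b n d = 0#
    homog {suc r} b n d = b zero * pow d (suc r) + n * homog (b ∘ suc) n d

    homog-hor : ∀ {r} (b : Fin r → F) {n d x} → d * x ≡ n → homog b n d ≡ pow d r * hor b x
    homog-hor {zero}  b e = solve 0 (con 0 := con 1 :* con 0) refl
    homog-hor {suc r} b {n} {d} {x} e = begin
      b zero * (d * pow d r) + n * homog (b ∘ suc) n d
        ≡⟨ cong₂ (λ u v → b zero * (d * pow d r) + u * v) (sym e) (homog-hor (b ∘ suc) e) ⟩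
      b zero * (d * pow d r) + d * x * (pow d r * hor (b ∘ suc) x)
        ≡⟨ solve 5 (λ b d p x h → b :* (d :* p) :+ (d :* x) :* (p :* h) := (d :* p) :* (b :+ x :* h)) refl
             (b zero) d (pow d r) x (hor (b ∘ suc) x) ⟩
      d * pow d r * (b zero + x * hor (b ∘ suc) x) ∎
      where open ≡-Reasoning

    poly-homog : ∀ {r D K} {b : Fin r → Vec F Z → F} {n d : Vec F Z → F} → (∀ i → IsPoly D (b i)) →
      IsPoly K n → IsPoly K d → IsPoly (D ℕ.+ r ℕ.* K) (λ z → homog (λ i → b i z) (n z) (d z))
    poly-homog {zero}  pb pn pd = poly-const 0#
    poly-homog {suc r} {D} {K} pb pn pd = poly-+
      (poly-* (pb zero) (poly-pow (suc r) pd))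
      (poly-weaken (ℕₚ.≤-reflexive (+-*-Solver.solve 3 (λ D K rK → K +-*-Solver.:+ (D +-*-Solver.:+ rK) +-*-Solver.:= D +-*-Solver.:+ (K +-*-Solver.:+ rK)) refl D K (r ℕ.* K)))
         (poly-* pn (poly-homog (pb ∘ suc) pn pd)))

    Coords : ℕ → ℕ → Set
    Coords K E = Σ (Ω → Vec F E) λ v → ∀ i → Rat K (λ ω → lookup (v ω) i)

    module _ (w : ℕ) {K : ℕ} where

      rest : ∀ {E} → Coords K (suc E) → Coords K E
      rest (v , rs) = (tail ∘ v) , λ i → rat-resp (λ ω → lookup-tail (v ω) i) (rs (suc i))
        where
        lookup-tail : ∀ {n} (v : Vec F (suc n)) i → lookup v (suc i) ≡ lookup (tail v) i
        lookup-tail (x ∷ v) i = refl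

      common-den : ∀ {E} → Coords K E → Vec F Z → F
      common-den {zero}  _ z        = 1#
      common-den {suc E} c@(_ , rs) z = pow (Rat.den (rs zero) z) w * common-den (rest c) z

      common-den≢0 : ∀ {E} (c : Coords K E) ω → ¬ (common-den c (pt ω) ≡ 0#)
      common-den≢0 {zero}  c ω = 1≢0
      common-den≢0 {suc E} c@(_ , rs) ω = *-nonzero (pow-nonzero w (Rat.den≢0 (rs zero) ω)) (common-den≢0 (rest c) ω)

      -- The polynomial b in the rational coordinates, multiplied by `common-den`. Homogenising one
      -- coordinate at a time costs w · K in the degree each, which makes the total linear in w for
      -- fixed E and K.
      cleared : ∀ {E} → Coords K E → (Fin (w ^ E) → Vec F Z → F) → Vec F Z → F
      cleared {zero}  _ b = b zero
      cleared {suc E} c@(_ , rs) b = cleared (rest c) λ α z →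
        homog (λ i → b (combine {w} i α) z) (Rat.num (rs zero) z) (Rat.den (rs zero) z)

      cleared-poly : ∀ {E D} (c : Coords K E) {b : Fin (w ^ E) → Vec F Z → F} → (∀ α → IsPoly D (b α)) →
        IsPoly (D ℕ.+ E ℕ.* (w ℕ.* K)) (cleared c b)
      cleared-poly {zero} c pb = poly-weaken (ℕₚ.m≤m+n _ _) (pb zero)
      cleared-poly {suc E} {D} c@(_ , rs) pb = poly-weaken (ℕₚ.≤-reflexive (ℕₚ.+-assoc D (w ℕ.* K) _))
        (cleared-poly (rest c) λ α → poly-homog (λ i → pb (combine {w} i α)) (Rat.num-poly (rs zero)) (Rat.den-poly (rs zero)))

      cleared-eq : ∀ {E} (c : Coords K E) (b : Fin (w ^ E) → Vec F Z → F) ω →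
        cleared c b (pt ω) ≡ common-den c (pt ω) * evalT w E (λ α → b α (pt ω)) (proj₁ c ω)
      cleared-eq {zero} (v , _) b ω with [] ← v ω = sym (*-identityˡ _)
      cleared-eq {suc E} c@(v , rs) b ω = begin
        cleared (rest c) _ (pt ω)
          ≡⟨ cleared-eq (rest c) _ ω ⟩
        common-den (rest c) (pt ω) * evalT w E (λ α → homog (λ i → b (combine {w} i α) (pt ω)) (Rat.num (rs zero) (pt ω)) (Rat.den (rs zero) (pt ω))) (tail (v ω))
          ≡⟨ cong (common-den (rest c) (pt ω) *_) (trans
               (evalT-cong w E (λ α → homog-hor (λ i → b (combine {w} i α) (pt ω)) (Rat.fraction (rs zero) ω)) (tail (v ω)))
               (evalT-*ˡ w E δ (contract w E (λ α → b α (pt ω)) x) (tail (v ω)))) ⟩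
        common-den (rest c) (pt ω) * (δ * evalT w E (contract w E (λ α → b α (pt ω)) x) (tail (v ω)))
          ≡⟨ solve 3 (λ a b c → a :* (b :* c) := (b :* a) :* c) refl (common-den (rest c) (pt ω)) δ _ ⟩
        δ * common-den (rest c) (pt ω) * evalT w E (contract w E (λ α → b α (pt ω)) x) (tail (v ω))
          ≡⟨ cong (δ * common-den (rest c) (pt ω) *_) (evalT-uncons (v ω)) ⟩
        δ * common-den (rest c) (pt ω) * evalT w (suc E) (λ α → b α (pt ω)) (v ω) ∎
        where
        open ≡-Reasoning
        x = lookup (v ω) zero
        δ = pow (Rat.den (rs zero) (pt ω)) w
        evalT-uncons : ∀ (u : Vec F (suc E)) → evalT w E (contract w E (λ α → b α (pt ω)) (lookup u zero)) (tail u) ≡ evalT w (suc E) (λ α → b α (pt ω)) u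
        evalT-uncons (y ∷ u) = refl

    module _ (w : ℕ) where
      open Footprint {q} w

      levels : ∀ {L} → Vec Bool L → ℕ → ℕ
      levels []          ρ = ρ
      levels (true  ∷ μ) ρ = suc (levels μ ρ)
      levels (false ∷ μ) ρ = levels μ ρ

      -- Along a tree, the entries at `false` levels are determined by the earlier branching
      -- choices. Only the branching entries and ζ can carry independent monomials.
      select : ∀ {L ρ} (μ : Vec Bool L) → Vec F L → Vec F ρ → Vec F (levels μ ρ)
      select []          v ζ = ζ
      select (true  ∷ μ) v ζ = lookup v zero ∷ select μ (tail v) ζ
      select (false ∷ μ) v ζ = select μ (tail v) ζ

      select-rat : ∀ {L ρ K} (μ : Vec Bool L) (c : Coords K L) (ζ : Coords K ρ) →
        ∀ i → Rat K (λ ω → lookup (select μ (proj₁ c ω) (proj₁ ζ ω)) i)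
      select-rat []          c ζ i       = proj₂ ζ i
      select-rat (true  ∷ μ) c ζ zero    = proj₂ c zero
      select-rat (true  ∷ μ) c ζ (suc i) = select-rat μ (rest w c) ζ i
      select-rat (false ∷ μ) c ζ i       = select-rat μ (rest w c) ζ i

      tensor-step : ∀ E {b c : Fin (w ^ suc E) → F} (a : Fin w → F) → (∀ {i j} → a i ≡ a j → i ≡ j) →
        (∀ i α → contract w E b (a i) α ≡ contract w E c (a i) α) → ∀ α → b α ≡ c α
      tensor-step E {b} {c} a inj e α with combine-surjective {w} {w ^ E} α
      ... | i , β , refl = hor-injective (λ i → b (combine i β)) (λ i → c (combine i β)) a inj (λ j → e j β) i

      grid-independent : ∀ ρ {G : Vec F ρ → Set} {b c : Fin (w ^ ρ) → F} → TreeOf (replicate ρ true) G →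
        (∀ ζ → G ζ → evalT w ρ b ζ ≡ evalT w ρ c ζ) → ∀ α → b α ≡ c α
      grid-independent zero    t e zero = e [] t
      grid-independent (suc ρ) (a , inj , ts) e = tensor-step ρ a inj
        (λ i → grid-independent ρ (ts i) (λ ζ g → e (a i ∷ ζ) g))

      -- A Vandermonde argument at each branching level, from the root down. It tolerates different
      -- subtrees under different children, because each child yields equality of the whole
      -- contracted tensor.
      tree-independent : ∀ {L ρ} (μ : Vec Bool L) {B : Vec F L → Set} {G : Vec F L → Vec F ρ → Set}
        {b c : Fin (w ^ levels μ ρ) → F} → TreeOf μ B → (∀ v → B v → TreeOf (replicate ρ true) (G v)) →
        (∀ v ζ → G v ζ → evalT w (levels μ ρ) b (select μ v ζ) ≡ evalT w (levels μ ρ) c (select μ v ζ)) →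
        ∀ α → b α ≡ c α
      tree-independent {ρ = ρ} [] t leaf e = grid-independent ρ (leaf [] t) (e [])
      tree-independent {ρ = ρ} (true ∷ μ) (a , inj , ts) leaf e = tensor-step (levels μ ρ) a inj
        (λ i → tree-independent μ (ts i) (λ v → leaf (a i ∷ v)) (λ v → e (a i ∷ v)))
      tree-independent (false ∷ μ) (a , t) leaf e =
        tree-independent μ t (λ v → leaf (a ∷ v)) (λ v → e (a ∷ v))

      -- A w-branching tree with E levels carries w^E independent monomials, but
      -- after clearing denominators these become polynomials in Z variables.
      no-rich-tree : ∀ {L ρ K} (μ : Vec Bool L) {B : Vec F L → Set} (c : Coords K L) (ζ : Coords K ρ) → 2 ≤ q →
        TreeOf μ B → (∀ v → B v → TreeOf (replicate ρ true) (λ y → Σ Ω λ ω → proj₁ c ω ≡ v × proj₁ ζ ω ≡ y)) →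
        suc (levels μ ρ ℕ.* (w ℕ.* K)) ^ Z < w ^ levels μ ρ → ⊥
      no-rich-tree {ρ = ρ} {K} μ c ζ q≥2 t leaf small =
        -- The dimension count, done with cardinalities: there are q^(w^E) tensors and fewer tables
        -- of cleared coefficients, so two different tensors would agree at all leaves.
        let i , j , i<j , eq = pigeonhole (ℕₚ.^-monoʳ-< q q≥2 small) (λ j → funToFin (coeff j)) in
        <⇒≢ i<j (trans (sym (funToFin-finToFin {w ^ E} i))
          (trans (funToFin-cong (same i j eq)) (funToFin-finToFin {w ^ E} j)))
        where
        E = levels μ ρ
        s : Coords K E
        s = (λ ω → select μ (proj₁ c ω) (proj₁ ζ ω)) , select-rat μ c ζ
        poly : (j : Fin (q ^ (w ^ E))) → IsPoly (E ℕ.* (w ℕ.* K)) (cleared w s (λ α _ → finToFun j α))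
        poly j = cleared-poly w s (λ α → poly-const _)
        coeff : Fin (q ^ (w ^ E)) → Fin (suc (E ℕ.* (w ℕ.* K)) ^ Z) → F
        coeff j = proj₁ (poly-coeff (poly j))
        module _ (i j : Fin (q ^ (w ^ E))) (eq : funToFin (coeff i) ≡ funToFin (coeff j)) where
          open ≡-Reasoning
          same-coeff : ∀ α → coeff i α ≡ coeff j α
          same-coeff α = trans (sym (finToFun-funToFin (coeff i) α))
            (trans (cong (λ x → finToFun x α) eq) (finToFun-funToFin (coeff j) α))
          agree : ∀ ω → evalT w E (finToFun i) (proj₁ s ω) ≡ evalT w E (finToFun j) (proj₁ s ω)
          agree ω = *-cancel (common-den≢0 w s ω) (begin
            common-den w s (pt ω) * evalT w E (finToFun i) (proj₁ s ω) ≡⟨ cleared-eq w s (λ α _ → finToFun i α) ω ⟨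
            cleared w s (λ α _ → finToFun i α) (pt ω)                  ≡⟨ proj₂ (poly-coeff (poly i)) (pt ω) ⟩
            evalT _ _ (coeff i) (pt ω)                                 ≡⟨ evalT-cong _ _ same-coeff (pt ω) ⟩
            evalT _ _ (coeff j) (pt ω)                                 ≡⟨ proj₂ (poly-coeff (poly j)) (pt ω) ⟨
            cleared w s (λ α _ → finToFun j α) (pt ω)                  ≡⟨ cleared-eq w s (λ α _ → finToFun j α) ω ⟩
            common-den w s (pt ω) * evalT w E (finToFun j) (proj₁ s ω) ∎)
          same : ∀ α → finToFun i α ≡ finToFun j α
          same = tree-independent μ t leaf λ { v y (ω , refl , refl) → agree ω }

-- Configurations of paths and the number of bad coefficients

module Configurations where

  open import Algebra.Bundles using (CommutativeRing)
  open import Data.Nat as ℕ using (ℕ; zero; suc; _≤_; _<_; z≤n; s≤s; _^_; _∸_)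
  import Data.Nat.Properties as ℕₚ
  import Data.Nat.Solver
  open import Data.Fin using (Fin; zero; suc; combine; remQuot; finToFun; funToFin; splitAt; _↑ˡ_; _↑ʳ_)
  open import Data.Fin.Properties using (combine-surjective; remQuot-combine; combine-remQuot; any?; all?; _≟_; finToFun-funToFin; combine-injectiveˡ; combine-injectiveʳ)
  open import Data.Bool using (Bool; true; false)
  open import Data.Vec using (Vec; []; _∷_; lookup; replicate; tabulate; _[_]≔_)
  open import Data.Vec.Properties using (lookup∘tabulate; lookup-replicate)
  open import Data.Product using (Σ; ∃; _×_; _,_; proj₁; proj₂)
  open import Data.Sum using (_⊎_; inj₁; inj₂; [_,_]′)
  open import Function using (_∘_)
  open import Relation.Nullary using (Dec; yes; no; does)
  open import Relation.Nullary.Decidable using (_×-dec_; _→-dec_; dec-true)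
  open import Relation.Binary.PropositionalEquality
  open Counting
  open PolynomialFunctions
  open RichTrees

  module S = Data.Nat.Solver.+-*-Solver

  ^-distribʳ-* : ∀ n x y → (x ℕ.* y) ^ n ≡ x ^ n ℕ.* y ^ n
  ^-distribʳ-* zero    x y = refl
  ^-distribʳ-* (suc n) x y = trans (cong (x ℕ.* y ℕ.*_) (^-distribʳ-* n x y))
    (S.solve 4 (λ x y a b → x S.:* y S.:* (a S.:* b) S.:= x S.:* a S.:* (y S.:* b)) refl x y (x ^ n) (y ^ n))

  -- A coordinate of a path vertex is either an unknown or, at the two ends, a given constant.
  Term : ℕ → ℕ → Set
  Term q n = Fin n ⊎ Fin q

  term : ∀ {q n} → (Fin n → Fin q) → Term q n → Fin q
  term z = [ z , (λ c → c) ]′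

  TreeOf-map : ∀ {q w L} (μ : Vec Bool L) {B B′ : Vec (Fin q) L → Set} → (∀ v → B v → B′ v) →
    Footprint.TreeOf w μ B → Footprint.TreeOf w μ B′
  TreeOf-map []          f t              = f [] t
  TreeOf-map (true  ∷ μ) f (a , inj , ts) = a , inj , λ i → TreeOf-map μ (λ v → f (a i ∷ v)) (ts i)
  TreeOf-map (false ∷ μ) f (a , t)        = a , TreeOf-map μ (λ v → f (a ∷ v)) t

  -- A product of ρ sets of size w, seen as a full tree. The leaves remember the choice u, from
  -- which the configuration point is rebuilt.
  grid-tree : ∀ {q w} ρ (h : Fin ρ → Fin w → Fin q) → (∀ r {i j} → h r i ≡ h r j → i ≡ j) →
    Footprint.TreeOf w (replicate ρ true) (λ y → Σ (Vec (Fin w) ρ) λ u → tabulate (λ r → h r (lookup u r)) ≡ y)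
  grid-tree zero    h inj = [] , refl
  grid-tree (suc ρ) h inj = h zero , inj zero , λ i →
    TreeOf-map (replicate ρ true) (λ v (u , e) → (i ∷ u) , cong (h zero i ∷_) e) (grid-tree ρ (h ∘ suc) (inj ∘ suc))

  module Construction {q : ℕ} (𝔽 : FiniteDomain q) (a t u ρ nE T : ℕ) (θ : Fin T → Fin q) where
    open FiniteDomain 𝔽
    open Polynomials 𝔽
    open CommutativeRing commutativeRing
      using (+-assoc; +-identityˡ; +-identityʳ; -‿inverseʳ; commutativeSemiring)
    open import Algebra.Solver.Ring.NaturalCoefficients.Default commutativeSemiring using (solve; _:=_; _:+_; _:*_; con)

    r L : ℕ
    r = ρ ℕ.* nE
    L = t ℕ.* r

    -- The first t coordinates of y are left out, since they are the values that the equations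
    -- prescribe. This makes the condition in `Adjacent` explicit instead of circular.
    edgeVec : (Fin a → F) → (Fin (t ℕ.+ u) → F) → Fin (a ℕ.+ u) → F
    edgeVec x y i = [ x , (λ j → y (t ↑ʳ j)) ]′ (splitAt a i)

    -- With ψ_τ(e) = Σ_i e_i θ_τ^i, the j-th equation of the graph is g_j(e) = Σ_τ c_{τ,j}(ψ_τ(e)) for univariate
    -- c_{τ,j} of degree < r. The block c_τ alone controls the paths whose edges are separated by ψ_τ.
    coeff : Vec F L → Fin t → Fin r → F
    coeff c j b = lookup c (combine j b)

    g : ∀ {T} → (Fin T → F) → Vec (Vec F L) T → Fin t → (Fin (a ℕ.+ u) → F) → F
    g θ []      j e = 0#
    g θ (c ∷ l) j e = hor (coeff c j) (hor e (θ zero)) + g (θ ∘ suc) l j e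

    g-cong : ∀ {T} (θ : Fin T → F) l j {e e′} → (∀ i → e i ≡ e′ i) → g θ l j e ≡ g θ l j e′
    g-cong θ []      j h = refl
    g-cong θ (c ∷ l) j h = cong₂ _+_ (cong (hor (coeff c j)) (hor-cong h (θ zero))) (g-cong (θ ∘ suc) l j h)

    -- A vertex y has t coordinates determined by its neighbour x and by its u free coordinates.
    Adjacent : Vec (Vec F L) T → (Fin a → F) → (Fin (t ℕ.+ u) → F) → Set
    Adjacent l x y = ∀ j → y (j ↑ˡ u) ≡ g θ l j (edgeVec x y)

    adjacent? : ∀ l x y → Dec (Adjacent l x y)
    adjacent? l x y = all? λ j → _ ≟ _

    edgeVec-cong : ∀ {x x′ y y′} → (∀ i → x i ≡ x′ i) → (∀ i → y i ≡ y′ i) → ∀ i → edgeVec x y i ≡ edgeVec x′ y′ i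
    edgeVec-cong hx hy i with splitAt a i
    ... | inj₁ j = hx j
    ... | inj₂ j = hy (t ↑ʳ j)

    Adjacent-resp : ∀ l {x x′ y y′} → (∀ i → x i ≡ x′ i) → (∀ i → y i ≡ y′ i) → Adjacent l x y → Adjacent l x′ y′
    Adjacent-resp l hx hy adj j = trans (sym (hy (j ↑ˡ u))) (trans (adj j) (g-cong θ l j (edgeVec-cong hx hy)))

    zeros : Vec F L
    zeros = replicate L 0#

    coeff-zeros : ∀ j b → coeff zeros j b ≡ 0#
    coeff-zeros j b = lookup-replicate (combine j b) 0#

    -- The block τ enters additively. With the other blocks frozen, adjacency thus prescribes values
    -- of the univariate polynomials of c_τ at the nodes ψ_τ(e).
    g-update : ∀ {T} (θ : Fin T → F) l τ c j e →
      g θ (l [ τ ]≔ c) j e ≡ hor (coeff c j) (hor e (θ τ)) + g θ (l [ τ ]≔ zeros) j e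
    g-update θ (c₀ ∷ l) zero c j e = cong (hor (coeff c j) (hor e (θ zero)) +_) (sym (trans
      (cong (_+ g (θ ∘ suc) l j e) (trans (hor-cong (coeff-zeros j) (hor e (θ zero))) (hor-0 r _))) (+-identityˡ _)))
    g-update θ (c₀ ∷ l) (suc τ) c j e = trans
      (cong (hor (coeff c₀ j) (hor e (θ zero)) +_) (g-update (θ ∘ suc) l τ c j e))
      (solve 3 (λ x y z → x :+ (y :+ z) := y :+ (x :+ z)) refl
         (hor (coeff c₀ j) (hor e (θ zero))) (hor (coeff c j) (hor e (θ (suc τ)))) (g (θ ∘ suc) (l [ τ ]≔ zeros) j e))

    poly-g : ∀ {Z T} (θ : Fin T → F) l j {e : Vec F Z → Fin (a ℕ.+ u) → F} → (∀ i → IsPoly 1 (λ z → e z i)) →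
      IsPoly r (λ z → g θ l j (e z))
    poly-g θ []      j pe = poly-const 0#
    poly-g θ (c ∷ l) j pe = poly-+
      (poly-weaken (ℕₚ.≤-reflexive (ℕₚ.*-identityʳ r)) (poly-hor (coeff c j) (poly-horᵛ pe (θ zero))))
      (poly-g (θ ∘ suc) l j pe)

    -- A template describes the coordinates of the nE edges of a path in terms of nz unknowns.
    module Template (w nz : ℕ) (xT : Fin nE → Fin a → Term q nz) (yT : Fin nE → Fin (t ℕ.+ u) → Term q nz) where

      dec : Fin (q ^ nz) → Fin nz → F
      dec = finToFun

      xAt : (Fin nz → F) → Fin nE → Fin a → F
      xAt z e i = term z (xT e i)

      yAt : (Fin nz → F) → Fin nE → Fin (t ℕ.+ u) → F
      yAt z e i = term z (yT e i)

      eAt : (Fin nz → F) → Fin nE → Fin (a ℕ.+ u) → F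
      eAt z e = edgeVec (xAt z e) (yAt z e)

      Paths : Set
      Paths = Fin (ρ ℕ.* w) → Fin (q ^ nz)

      -- The same θ_τ serves twice: `edges-sep` makes the interpolation nodes distinct, and
      -- `points-sep` compresses each path to one field element, so that the w paths of a group can
      -- be the children of a tree node.
      record Configuration (l : Vec (Vec F L) T) (τ : Fin T) (P : Paths) : Set where
        field
          adjacent   : ∀ i e → Adjacent l (xAt (dec (P i)) e) (yAt (dec (P i)) e)
          edges-sep  : ∀ i e i′ e′ → hor (eAt (dec (P i)) e) (θ τ) ≡ hor (eAt (dec (P i′)) e′) (θ τ) →
                       i ≡ i′ × e ≡ e′
          points-sep : ∀ i i′ → hor (dec (P i)) (θ τ) ≡ hor (dec (P i′)) (θ τ) → i ≡ i′

      Configuration-resp : ∀ {l τ P P′} → (∀ i → P i ≡ P′ i) → Configuration l τ P → Configuration l τ P′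
      Configuration-resp {l} {τ} h c = record
        { adjacent   = λ i e → subst (λ p → Adjacent l (xAt (dec p) e) (yAt (dec p) e)) (h i) (adjacent i e)
        ; edges-sep  = λ i e i′ e′ eq → edges-sep i e i′ e′
            (trans (cong (λ p → hor (eAt (dec p) e) (θ τ)) (h i))
              (trans eq (cong (λ p → hor (eAt (dec p) e′) (θ τ)) (sym (h i′)))))
        ; points-sep = λ i i′ eq → points-sep i i′
            (trans (cong (λ p → hor (dec p) (θ τ)) (h i)) (trans eq (cong (λ p → hor (dec p) (θ τ)) (sym (h i′)))))
        }
        where open Configuration c

      configuration? : ∀ l τ P → Dec (Configuration l τ P)
      configuration? l τ P with
        (all? λ i → all? λ e → adjacent? l (xAt (dec (P i)) e) (yAt (dec (P i)) e))
        ×-dec (all? λ i → all? λ e → all? λ i′ → all? λ e′ →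
          (hor (eAt (dec (P i)) e) (θ τ) ≟ hor (eAt (dec (P i′)) e′) (θ τ)) →-dec ((i ≟ i′) ×-dec (e ≟ e′)))
        ×-dec (all? λ i → all? λ i′ → (hor (dec (P i)) (θ τ) ≟ hor (dec (P i′)) (θ τ)) →-dec (i ≟ i′))
      ... | yes (x , y , z) = yes record { adjacent = x ; edges-sep = y ; points-sep = z }
      ... | no ¬p = no λ c → ¬p (Configuration.adjacent c , Configuration.edges-sep c , Configuration.points-sep c)

      bad? : ∀ l τ → Dec (∃ λ (i : Fin ((q ^ nz) ^ (ρ ℕ.* w))) → Configuration l τ (finToFun i))
      bad? l τ = any? λ i → configuration? l τ (finToFun i)

      bad : Vec (Vec F L) T → Fin T → Bool
      bad l τ = does (bad? l τ)

      Configuration⇒bad : ∀ l τ P → Configuration l τ P → bad l τ ≡ true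
      Configuration⇒bad l τ P c = dec-true (bad? l τ) (funToFin P ,
        Configuration-resp (λ i → sym (finToFun-funToFin P i)) c)

      module Bound (l : Vec (Vec F L) T) (τ : Fin T) where

        B : Vec F L → Bool
        B c = bad (l [ τ ]≔ c) τ

        -- A block with a configuration witnessing its badness and one path picked from each of the
        -- ρ groups. Only the ρ · nz coordinates of the picked paths survive in `pt`, and everything
        -- else has to be rational in them.
        record Ω : Set where
          constructor mkΩ
          field
            c      : Vec F L
            P      : Paths
            config : Configuration (l [ τ ]≔ c) τ P
            pick   : Vec (Fin w) ρ
        open Ω

        path : Ω → Fin ρ → Fin nz → F
        path ω s = dec (P ω (combine s (lookup (pick ω) s)))

        pt : Ω → Vec F (ρ ℕ.* nz)
        pt ω = tabulate λ i → path ω (proj₁ (remQuot nz i)) (proj₂ (remQuot {ρ} nz i))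

        open RationalFunctions 𝔽 pt

        pathAt : Vec F (ρ ℕ.* nz) → Fin ρ → Fin nz → F
        pathAt z s v = lookup z (combine s v)

        pathAt-pt : ∀ ω s v → pathAt (pt ω) s v ≡ path ω s v
        pathAt-pt ω s v = trans (lookup∘tabulate _ (combine s v))
          (cong (λ p → path ω (proj₁ p) (proj₂ p)) (remQuot-combine s v))

        poly-term : ∀ s (m : Term q nz) → IsPoly 1 (λ z → term (pathAt z s) m)
        poly-term s (inj₁ v) = poly-lookup (combine s v)
        poly-term s (inj₂ x) = poly-const x

        term-pt : ∀ ω s (m : Term q nz) → term (pathAt (pt ω) s) m ≡ term (path ω s) m
        term-pt ω s (inj₁ v) = pathAt-pt ω s v
        term-pt ω s (inj₂ x) = refl

        poly-eAt : ∀ s e i → IsPoly 1 (λ z → eAt (pathAt z s) e i)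
        poly-eAt s e i with splitAt a i
        ... | inj₁ j = poly-term s (xT e j)
        ... | inj₂ j = poly-term s (yT e (t ↑ʳ j))

        eAt-pt : ∀ ω s e i → eAt (pathAt (pt ω) s) e i ≡ eAt (path ω s) e i
        eAt-pt ω s e = edgeVec-cong (λ i → term-pt ω s (xT e i)) (λ i → term-pt ω s (yT e i))

        node : Fin r → Fin ρ × Fin nE
        node = remQuot {ρ} nE

        node-injective : ∀ {i j} → node i ≡ node j → i ≡ j
        node-injective {i} {j} e = trans (sym (combine-remQuot {ρ} nE i))
          (trans (cong (λ p → combine (proj₁ p) (proj₂ p)) e) (combine-remQuot {ρ} nE j))

        ψ : Fin r → Vec F (ρ ℕ.* nz) → F
        ψ i z = hor (eAt (pathAt z (proj₁ (node i))) (proj₂ (node i))) (θ τ)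

        value : Fin t → Fin r → Vec F (ρ ℕ.* nz) → F
        value j i z = term (pathAt z s) (yT e (j ↑ˡ u)) + - g θ (l [ τ ]≔ zeros) j (eAt (pathAt z s) e)
          where
          s = proj₁ (node i)
          e = proj₂ (node i)

        -- Values have degree at most r + 1 and nodes degree 1. The outer `suc` ensures K ≥ 1, the
        -- degree that `spread` has.
        K : ℕ
        K = suc (degS r (suc r) 1)

        coords : Coords K L
        coords = c , λ i → rat i
          where
          rat : ∀ i → Rat K (λ ω → lookup (c ω) i)
          rat i with combine-surjective {t} {r} i
          ... | j , b , refl = rat-weaken (ℕₚ.n≤1+n _) (interpolate r (λ b ω → coeff (c ω) j b) ψ (λ i ω → value j i (pt ω))
              (λ i → poly-horᵛ (poly-eAt _ _) (θ τ))
              (λ i → rat-poly {g = value j i} (poly-+ (poly-weaken (s≤s z≤n) (poly-term (proj₁ (node i)) (yT (proj₂ (node i)) (j ↑ˡ u))))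
                       (poly-neg (poly-weaken (ℕₚ.n≤1+n r) (poly-g θ (l [ τ ]≔ zeros) j (poly-eAt _ _))))))
              equation separate b)
            where
            equation : ∀ i ω → hor (coeff (c ω) j) (ψ i (pt ω)) ≡ value j i (pt ω)
            equation i ω = begin
              hor (coeff (c ω) j) (ψ i (pt ω))
                ≡⟨ cancel _ _ ⟨
              hor (coeff (c ω) j) (ψ i (pt ω)) + G + - G
                ≡⟨ cong (_+ - G) (g-update θ l τ (c ω) j ep) ⟨
              g θ (l [ τ ]≔ c ω) j ep + - G
                ≡⟨ cong (_+ - G) (g-cong θ (l [ τ ]≔ c ω) j (eAt-pt ω s e)) ⟩
              g θ (l [ τ ]≔ c ω) j (eAt (path ω s) e) + - G
                ≡⟨ cong (_+ - G) (Configuration.adjacent (config ω) (combine s (lookup (pick ω) s)) e j) ⟨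
              yAt (path ω s) e (j ↑ˡ u) + - G
                ≡⟨ cong (_+ - G) (term-pt ω s (yT e (j ↑ˡ u))) ⟨
              value j i (pt ω) ∎
              where
              open ≡-Reasoning
              s = proj₁ (node i)
              e = proj₂ (node i)
              ep = eAt (pathAt (pt ω) s) e
              G = g θ (l [ τ ]≔ zeros) j ep
              cancel : ∀ x y → x + y + - y ≡ x
              cancel x y = trans (+-assoc x y (- y)) (trans (cong (x +_) (-‿inverseʳ y)) (+-identityʳ x))
            separate : ∀ ω {i j} → ψ i (pt ω) ≡ ψ j (pt ω) → i ≡ j
            separate ω {i} {j} p
              with Configuration.edges-sep (config ω) (combine (proj₁ (node i)) _) (proj₂ (node i)) (combine (proj₁ (node j)) _) (proj₂ (node j))
                     (trans (sym (hor-cong (eAt-pt ω (proj₁ (node i)) (proj₂ (node i))) (θ τ)))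
                       (trans p (hor-cong (eAt-pt ω (proj₁ (node j)) (proj₂ (node j))) (θ τ))))
            ... | e₁ , e₂ = node-injective (cong₂ _,_ (combine-injectiveˡ _ _ _ _ e₁) e₂)

        -- One number for each picked path. It takes w values within a group, so it supplies ρ
        -- further branching levels beneath every bad block.
        spread : Coords K ρ
        spread = (λ ω → tabulate (λ s → hor (path ω s) (θ τ))) ,
          λ s → rat-weaken (s≤s z≤n) (rat-resp
            (λ ω → trans (hor-cong (pathAt-pt ω s) (θ τ)) (sym (lookup∘tabulate (λ s → hor (path ω s) (θ τ)) s)))
            (rat-poly {g = λ z → hor (pathAt z s) (θ τ)} (poly-horᵛ (λ v → poly-lookup (combine s v)) (θ τ))))

        leaf : ∀ v → B v ≡ true → Footprint.TreeOf w (replicate ρ true) (λ y → Σ Ω λ ω → c ω ≡ v × proj₁ spread ω ≡ y)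
        leaf v e with bad? (l [ τ ]≔ v) τ
        ... | yes (code , cfg) = TreeOf-map (replicate ρ true)
            (λ { y (pk , eq) → mkΩ v (finToFun code) cfg pk , refl , eq })
            (grid-tree ρ (λ s i → hor (dec (finToFun code (combine s i))) (θ τ))
              (λ s {i} {j} eq → combine-injectiveʳ s i s j (Configuration.points-sep cfg _ _ eq)))

        levels≡ : ∀ {L} (μ : Vec Bool L) → levels w μ ρ ≡ Footprint.trues {q} w μ ℕ.+ ρ
        levels≡ []          = refl
        levels≡ (true  ∷ μ) = cong suc (levels≡ μ)
        levels≡ (false ∷ μ) = levels≡ μ

        trues≤ : ∀ {L} (μ : Vec Bool L) → Footprint.trues {q} w μ ≤ L
        trues≤ []          = z≤n
        trues≤ (true  ∷ μ) = s≤s (trues≤ μ)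
        trues≤ (false ∷ μ) = ℕₚ.m≤n⇒m≤1+n (trues≤ μ)

        -- A tree with more than L - ρ branching coordinates has, with the ρ groups, E ≥ L + 1
        -- levels. Then (1 + E w K)^(ρ nz) ≤ (w C)^L = w^L C^L < w^(L+1) ≤ w^E contradicts
        -- `no-rich-tree`: w occurs to the power L on one side and at least L + 1 on the other.
        few-bad : 2 ≤ q → ρ ≤ L → ρ ℕ.* nz ≤ L → (1 ℕ.+ (L ℕ.+ ρ) ℕ.* K) ^ L < w →
          sumV L (λ c → ind (B c)) ≤ 2 ^ L ℕ.* (w ^ L ℕ.* q ^ (L ∸ ρ))
        few-bad q≥2 ρ≤L Z≤L w-big = Footprint.count-bound w L (L ∸ ρ) B w≥1 (ℕₚ.≤-trans (s≤s z≤n) q≥2) shallow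
          where
          C = 1 ℕ.+ (L ℕ.+ ρ) ℕ.* K
          w≥1 : 1 ≤ w
          w≥1 = ℕₚ.≤-trans (s≤s z≤n) w-big
          shallow : ∀ μ → Footprint.tree w μ B ≡ true → Footprint.trues {q} w μ ≤ L ∸ ρ
          shallow μ tr = ℕₚ.≮⇒≥ λ deep → no-rich-tree w μ coords spread q≥2 (Footprint.tree⇒TreeOf w μ B tr) leaf (small deep)
            where
            E = levels w μ ρ
            E≤ : E ≤ L ℕ.+ ρ
            E≤ = ℕₚ.≤-trans (ℕₚ.≤-reflexive (levels≡ μ)) (ℕₚ.+-monoˡ-≤ ρ (trues≤ μ))
            small : L ∸ ρ < Footprint.trues {q} w μ → suc (E ℕ.* (w ℕ.* K)) ^ (ρ ℕ.* nz) < w ^ E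
            small deep = begin-strict
              suc (E ℕ.* (w ℕ.* K)) ^ (ρ ℕ.* nz)   ≤⟨ ℕₚ.^-monoˡ-≤ (ρ ℕ.* nz) base ⟩
              (w ℕ.* C) ^ (ρ ℕ.* nz)               ≤⟨ ℕₚ.^-monoʳ-≤ (w ℕ.* C) {{ℕₚ.m*n≢0 w C {{ℕ.>-nonZero w≥1}}}} Z≤L ⟩
              (w ℕ.* C) ^ L                        ≡⟨ ^-distribʳ-* L w C ⟩
              w ^ L ℕ.* C ^ L                      <⟨ ℕₚ.*-monoʳ-< (w ^ L) {{ℕₚ.m^n≢0 w L {{ℕ.>-nonZero w≥1}}}} w-big ⟩
              w ^ L ℕ.* w                          ≡⟨ ℕₚ.*-comm (w ^ L) w ⟩
              w ^ suc L                            ≤⟨ ℕₚ.^-monoʳ-≤ w {{ℕ.>-nonZero w≥1}} E≥ ⟩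
              w ^ E                                ∎
              where
              open ℕₚ.≤-Reasoning
              E≥ : suc L ≤ E
              E≥ = begin
                suc L                                  ≡⟨ cong suc (ℕₚ.m∸n+n≡m ρ≤L) ⟨
                suc (L ∸ ρ) ℕ.+ ρ                      ≤⟨ ℕₚ.+-monoˡ-≤ ρ deep ⟩
                Footprint.trues {q} w μ ℕ.+ ρ          ≡⟨ levels≡ μ ⟨
                E                                      ∎
              base : suc (E ℕ.* (w ℕ.* K)) ≤ w ℕ.* C
              base = begin
                1 ℕ.+ E ℕ.* (w ℕ.* K)              ≤⟨ ℕₚ.+-mono-≤ w≥1 (ℕₚ.*-monoˡ-≤ (w ℕ.* K) E≤) ⟩
                w ℕ.+ (L ℕ.+ ρ) ℕ.* (w ℕ.* K)      ≡⟨ S.solve 3 (λ w e k → w S.:+ e S.:* (w S.:* k) S.:= w S.:* (S.con 1 S.:+ e S.:* k)) refl w (L ℕ.+ ρ) K ⟩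
                w ℕ.* C                            ∎

-- Separating the edges and locating the vertices of a theta graph

module ThetaEmbeddings where

  open import Defs
  open import Data.Nat as ℕ using (ℕ; zero; suc; _≤_; _<_; s≤s; _^_; _∸_)
  import Data.Nat.Properties as ℕₚ
  open import Data.Fin using (Fin; zero; suc; toℕ; fromℕ<; inject₁; combine; remQuot; finToFun; funToFin; splitAt; _↑ˡ_; _↑ʳ_)
  open import Data.Fin.Properties using (suc-injective; combine-injective; toℕ-fromℕ<; toℕ-injective; toℕ-inject₁; toℕ<n; remQuot-combine; combine-remQuot; _≟_; finToFun-funToFin; funToFin-finToFin; splitAt-↑ˡ; splitAt-↑ʳ; join-splitAt)
  open import Data.Fin.Induction using (<-weakInduction)
  open import Data.Bool using (Bool; true)
  open import Data.Vec using (Vec)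
  open import Data.Product using (Σ; ∃; _×_; _,_; proj₁; proj₂)
  open import Data.Sum using (_⊎_; inj₁; inj₂; [_,_]′)
  import Data.Sum as Sum
  open import Data.Unit using (⊤; tt)
  open import Data.Empty using (⊥; ⊥-elim)
  open import Relation.Nullary using (¬_; Dec; yes; no; does)
  open import Relation.Nullary.Decidable using (_×-dec_; ¬?)
  open import Relation.Binary.PropositionalEquality
  open import Algebra.Properties.Semiring.Sum ℕₚ.+-*-semiring using (sum; ∑-comm; ∑-distrib-+)
  open Counting
  open PolynomialFunctions
  open RichTrees
  open Configurations

  does-true : ∀ {A : Set} (d : Dec A) → does d ≡ true → A
  does-true (yes x) e = x

  does-false : ∀ {A : Set} (d : Dec A) → ind (does d) ≤ 0 → ¬ A
  does-false (no ¬x) e = ¬x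

  module Separation {q : ℕ} (𝔽 : FiniteDomain q) {T : ℕ} (θ : Fin T → Fin q) (θ-inj : ∀ {i j} → θ i ≡ θ j → i ≡ j) where
    open Polynomials 𝔽

    clash? : ∀ {N d} (A : Fin N → Fin d → F) (i j : Fin N) τ → Dec (¬ (i ≡ j) × hor (A i) (θ τ) ≡ hor (A j) (θ τ))
    clash? A i j τ = ¬? (i ≟ j) ×-dec (hor (A i) (θ τ) ≟ hor (A j) (θ τ))

    clashes : ∀ {N d} → (Fin N → Fin d → F) → Fin T → ℕ
    clashes A τ = sum (λ i → sum (λ j → ind (does (clash? A i j τ))))

    -- Summed pair by pair: two different vectors of length d are different polynomials in θ of
    -- degree below d, so they collide at few of the θ_τ.
    few-clashes : ∀ {N d} (A : Fin N → Fin d → F) → (∀ {i j} → (∀ v → A i v ≡ A j v) → i ≡ j) →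
      sum (clashes A) ≤ N ℕ.* (N ℕ.* d)
    few-clashes {N} {d} A inj = ℕₚ.≤-trans (ℕₚ.≤-reflexive (∑-comm (λ τ i → sum (λ j → ind (does (clash? A i j τ))))))
      (sum-≤ λ i → ℕₚ.≤-trans (ℕₚ.≤-reflexive (∑-comm (λ τ j → ind (does (clash? A i j τ))))) (sum-≤ λ j → pair i j))
      where
      pair : ∀ i j → cnt (λ τ → does (clash? A i j τ)) ≤ d
      pair i j = ℕₚ.≮⇒≥ λ lt → contra (cnt⇒injection (suc d) (λ τ → does (clash? A i j τ)) lt)
        where
        contra : (Σ (Fin (suc d) → Fin T) λ f → (∀ {x y} → f x ≡ f y → x ≡ y) × (∀ x → does (clash? A i j (f x)) ≡ true)) → ⊥
        -- Of the d + 1 collisions, the first only supplies i ≠ j; the other d already force the two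
        -- vectors to be equal.
        contra (f , f-inj , ok) = proj₁ (clash zero) (inj (hor-injective (A i) (A j) (λ x → θ (f (suc x)))
            (λ e → suc-injective (f-inj (θ-inj e))) (λ x → proj₂ (clash (suc x)))))
          where
          clash : ∀ x → ¬ (i ≡ j) × hor (A i) (θ (f x)) ≡ hor (A j) (θ (f x))
          clash x = does-true (clash? A i j (f x)) (ok x)

    clashes≡0 : ∀ {N d} (A : Fin N → Fin d → F) τ → clashes A τ ≡ 0 →
      ∀ i j → hor (A i) (θ τ) ≡ hor (A j) (θ τ) → i ≡ j
    clashes≡0 A τ e i j p with i ≟ j
    ... | yes i≡j = i≡j
    ... | no  i≢j = ⊥-elim (does-false (clash? A i j τ) below-sum (i≢j , p))
      where
      below-sum : ind (does (clash? A i j τ)) ≤ 0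
      below-sum = ℕₚ.≤-trans (term≤sum (λ j → ind (does (clash? A i j τ))) j)
        (ℕₚ.≤-trans (term≤sum (λ i → sum (λ j → ind (does (clash? A i j τ)))) i) (ℕₚ.≤-reflexive e))

    separate : ∀ {N N′ d d′} (A : Fin N → Fin d → F) (A′ : Fin N′ → Fin d′ → F) →
      (∀ {i j} → (∀ v → A i v ≡ A j v) → i ≡ j) → (∀ {i j} → (∀ v → A′ i v ≡ A′ j v) → i ≡ j) →
      N ℕ.* (N ℕ.* d) ℕ.+ N′ ℕ.* (N′ ℕ.* d′) < T →
      ∃ λ τ → (∀ i j → hor (A i) (θ τ) ≡ hor (A j) (θ τ) → i ≡ j) × (∀ i j → hor (A′ i) (θ τ) ≡ hor (A′ j) (θ τ) → i ≡ j)
    separate A A′ inj inj′ lt =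
      let τ , e = sum<⇒term< (λ τ → clashes A τ ℕ.+ clashes A′ τ) total
          z = ℕₚ.n≤0⇒n≡0 (ℕₚ.≤-pred e)
      in τ , clashes≡0 A τ (ℕₚ.m+n≡0⇒m≡0 _ z) , clashes≡0 A′ τ (ℕₚ.m+n≡0⇒n≡0 (clashes A τ) z)
      where
      total : sum (λ τ → clashes A τ ℕ.+ clashes A′ τ) < T ℕ.* 1
      total = ℕₚ.≤-<-trans (ℕₚ.≤-reflexive (∑-distrib-+ (clashes A) (clashes A′)))
        (ℕₚ.≤-<-trans (ℕₚ.+-mono-≤ (few-clashes A inj) (few-clashes A′ inj′))
          (ℕₚ.<-≤-trans lt (ℕₚ.≤-reflexive (sym (ℕₚ.*-identityʳ T)))))

  finToFun-injective : ∀ {m n} {i j : Fin (m ^ n)} → (∀ v → finToFun {m} {n} i v ≡ finToFun {m} {n} j v) → i ≡ j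
  finToFun-injective {m} {n} {i} {j} h = trans (sym (funToFin-finToFin {n} {m} i)) (trans (funToFin-cong h) (funToFin-finToFin {n} {m} j))

  module FindBad {q : ℕ} (𝔽 : FiniteDomain q) (a t u ρ nE T : ℕ) (θ : Fin T → Fin q) (θ-inj : ∀ {i j} → θ i ≡ θ j → i ≡ j)
    (w nz : ℕ) (xT : Fin nE → Fin a → Term q nz) (yT : Fin nE → Fin (t ℕ.+ u) → Term q nz) where
    open Polynomials 𝔽
    open Construction 𝔽 a t u ρ nE T θ
    open Template w nz xT yT
    open Separation 𝔽 θ θ-inj

    decA : Fin (q ^ a) → Fin a → F
    decA = finToFun

    decN : Fin (q ^ (t ℕ.+ u)) → Fin (t ℕ.+ u) → F
    decN = finToFun

    -- The t omitted coordinates of y are recovered from the equations, which depend on the edge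
    -- vector alone.
    edgeVec-injective : ∀ l {x x′ y y′} → Adjacent l x y → Adjacent l x′ y′ →
      (∀ i → edgeVec x y i ≡ edgeVec x′ y′ i) → (∀ i → x i ≡ x′ i) × (∀ i → y i ≡ y′ i)
    edgeVec-injective l {x} {x′} {y} {y′} adj adj′ h = hx , hy
      where
      hx : ∀ i → x i ≡ x′ i
      hx i with h (i ↑ˡ u)
      ... | e rewrite splitAt-↑ˡ a i u = e
      hu : ∀ i → y (t ↑ʳ i) ≡ y′ (t ↑ʳ i)
      hu i with h (a ↑ʳ i)
      ... | e rewrite splitAt-↑ʳ a u i = e
      hy : ∀ i → y i ≡ y′ i
      hy i with splitAt t i | join-splitAt t u i
      ... | inj₁ j | refl = trans (adj j) (trans (g-cong θ l j h) (sym (adj′ j)))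
      ... | inj₂ j | refl = hu j

    -- The ρ · w paths are given by the vertices `X`, `Y` of their edges and by their unknowns `z`,
    -- which covers ends in either part. T exceeds the number of collisions of edges and of paths
    -- over all parameters, so some τ has none.
    find-bad : ∀ l (X : Fin (ρ ℕ.* w) → Fin nE → Fin (q ^ a)) (Y : Fin (ρ ℕ.* w) → Fin nE → Fin (q ^ (t ℕ.+ u)))
      (z : Fin (ρ ℕ.* w) → Fin nz → F) →
      (∀ p e i → term (z p) (xT e i) ≡ decA (X p e) i) → (∀ p e i → term (z p) (yT e i) ≡ decN (Y p e) i) →
      (∀ p e → Adjacent l (decA (X p e)) (decN (Y p e))) →
      (∀ {p e p′ e′} → X p e ≡ X p′ e′ → Y p e ≡ Y p′ e′ → p ≡ p′ × e ≡ e′) →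
      (∀ {p p′} → (∀ v → z p v ≡ z p′ v) → p ≡ p′) →
      (ρ ℕ.* w ℕ.* nE) ℕ.* ((ρ ℕ.* w ℕ.* nE) ℕ.* (a ℕ.+ u)) ℕ.+ (ρ ℕ.* w) ℕ.* ((ρ ℕ.* w) ℕ.* nz) < T →
      ∃ λ τ → bad l τ ≡ true
    find-bad l X Y z xe ye adj X-inj z-inj T-big =
      let τ , sep , sep′ = separate A (λ p → dec (P p)) A-inj P-inj T-big in
      τ , Configuration⇒bad l τ P record
        { adjacent   = adjP
        ; edges-sep  = λ p e p′ e′ eq → unpair (sep (combine p e) (combine p′ e′)
            (trans (cong (λ i → hor (A′ i) (θ τ)) (remQuot-combine p e))
              (trans eq (cong (λ i → hor (A′ i) (θ τ)) (sym (remQuot-combine p′ e′))))))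
        ; points-sep = sep′
        }
      where
      P : Paths
      P p = funToFin (z p)
      term-P : ∀ p m → term (dec (P p)) m ≡ term (z p) m
      term-P p (inj₁ v) = finToFun-funToFin (z p) v
      term-P p (inj₂ c) = refl
      xP : ∀ p e i → decA (X p e) i ≡ xAt (dec (P p)) e i
      xP p e i = sym (trans (term-P p (xT e i)) (xe p e i))
      yP : ∀ p e i → decN (Y p e) i ≡ yAt (dec (P p)) e i
      yP p e i = sym (trans (term-P p (yT e i)) (ye p e i))
      adjP : ∀ p e → Adjacent l (xAt (dec (P p)) e) (yAt (dec (P p)) e)
      adjP p e = Adjacent-resp l (xP p e) (yP p e) (adj p e)
      A′ : Fin (ρ ℕ.* w) × Fin nE → Fin (a ℕ.+ u) → F
      A′ (p , e) = eAt (dec (P p)) e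
      A : Fin (ρ ℕ.* w ℕ.* nE) → Fin (a ℕ.+ u) → F
      A i = A′ (remQuot nE i)
      unpair : ∀ {p e p′ e′} → combine p e ≡ combine p′ e′ → p ≡ p′ × e ≡ e′
      unpair = combine-injective _ _ _ _
      A-inj : ∀ {i j} → (∀ v → A i v ≡ A j v) → i ≡ j
      A-inj {i} {j} h = trans (sym (combine-remQuot {ρ ℕ.* w} nE i))
        (trans (cong (λ p → combine (proj₁ p) (proj₂ p)) (same (remQuot nE i) (remQuot nE j) h)) (combine-remQuot {ρ ℕ.* w} nE j))
        where
        same : ∀ i j → (∀ v → A′ i v ≡ A′ j v) → i ≡ j
        same (p , e) (p′ , e′) h with edgeVec-injective l (adjP p e) (adjP p′ e′) h
        ... | hx , hy with X-inj {p} {e} {p′} {e′} (finToFun-injective λ i → trans (xP p e i) (trans (hx i) (sym (xP p′ e′ i))))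
                                (finToFun-injective λ i → trans (yP p e i) (trans (hy i) (sym (yP p′ e′ i))))
        ...   | e₁ , e₂ = cong₂ _,_ e₁ e₂
      P-inj : ∀ {p p′} → (∀ v → dec (P p) v ≡ dec (P p′) v) → p ≡ p′
      P-inj {p} {p′} h = z-inj λ v → trans (sym (finToFun-funToFin (z p) v)) (trans (h v) (finToFun-funToFin (z p′) v))

  -- Recognises the last index, where a path reaches its right end and unknowns give way to
  -- constants.
  below : ∀ {n} → Fin (suc n) → Fin n ⊎ ⊤
  below {zero}  zero    = inj₂ tt
  below {suc n} zero    = inj₁ zero
  below {suc n} (suc i) = Sum.map suc (λ x → x) (below i)

  below-inj₁ : ∀ {n} (i : Fin (suc n)) {j} → below i ≡ inj₁ j → toℕ i ≡ toℕ j
  below-inj₁ {suc n} zero    refl = refl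
  below-inj₁ {suc n} (suc i) e with below i in eq
  below-inj₁ {suc n} (suc i) refl | inj₁ j = cong suc (below-inj₁ i eq)

  below-inj₂ : ∀ {n} (i : Fin (suc n)) {x} → below i ≡ inj₂ x → toℕ i ≡ n
  below-inj₂ {zero}  zero    e = refl
  below-inj₂ {suc n} (suc i) e with below i in eq
  below-inj₂ {suc n} (suc i) refl | inj₂ _ = cong suc (below-inj₂ i eq)

  -- The vertices of the i-th path of a theta graph, split into those on the side of its
  -- endpoints (ends included) and those on the opposite side.
  module ThetaPath (s k′ : ℕ) where
    m = 2 ℕ.* suc k′ ∸ 1

    private
      m≡ : m ≡ suc (k′ ℕ.+ k′)
      m≡ = trans (ℕₚ.+-suc k′ (k′ ℕ.+ 0)) (cong (λ x → suc (k′ ℕ.+ x)) (ℕₚ.+-identityʳ k′))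

    -- The vertex `mid i j` has distance j + 1 from `left`, so odd indices lie on the side of the
    -- ends and even indices opposite.
    oddIx : Fin k′ → Fin m
    oddIx h = fromℕ< {suc (toℕ h ℕ.+ toℕ h)} (ℕₚ.<-≤-trans (s≤s (ℕₚ.+-mono-<-≤ (toℕ<n h) (ℕₚ.<⇒≤ (toℕ<n h)))) (ℕₚ.≤-reflexive (sym m≡)))

    evenIx : Fin (suc k′) → Fin m
    evenIx h = fromℕ< {toℕ h ℕ.+ toℕ h} (ℕₚ.<-≤-trans (s≤s (ℕₚ.+-mono-≤ (ℕₚ.≤-pred (toℕ<n h)) (ℕₚ.≤-pred (toℕ<n h)))) (ℕₚ.≤-reflexive (sym m≡)))

    toℕ-odd : ∀ h → toℕ (oddIx h) ≡ suc (toℕ h ℕ.+ toℕ h)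
    toℕ-odd h = toℕ-fromℕ< _

    toℕ-even : ∀ h → toℕ (evenIx h) ≡ toℕ h ℕ.+ toℕ h
    toℕ-even h = toℕ-fromℕ< _

    same : Fin s → Fin (suc (suc k′)) → ThetaV s m
    same i zero    = left
    same i (suc h) = [ (λ h′ → mid i (oddIx h′)) , (λ _ → right) ]′ (below h)

    opp : Fin s → Fin (suc k′) → ThetaV s m
    opp i h = mid i (evenIx h)

    forth : ∀ i h → ThetaE {s} {m} (same i (inject₁ h)) (opp i h)
    forth i zero = lm i (evenIx zero) (toℕ-even zero)
    forth i (suc h) with below (inject₁ h) in eq
    ... | inj₁ h′ = mm i (oddIx h′) (evenIx (suc h)) (trans (cong suc (toℕ-odd h′))
            (trans (cong (λ x → suc (suc (x ℕ.+ x))) (sym h≡)) (trans (cong suc (sym (ℕₚ.+-suc (toℕ h) (toℕ h)))) (sym (toℕ-even (suc h))))))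
      where
      h≡ : toℕ h ≡ toℕ h′
      h≡ = trans (sym (toℕ-inject₁ h)) (below-inj₁ (inject₁ h) eq)
    ... | inj₂ _ = ⊥-elim (ℕₚ.<-irrefl (trans (sym (toℕ-inject₁ h)) (below-inj₂ (inject₁ h) eq)) (toℕ<n h))

    back : ∀ i h → ThetaE {s} {m} (opp i h) (same i (suc h))
    back i h with below h in eq
    ... | inj₁ h′ = mm i (evenIx h) (oddIx h′) (trans (cong suc (toℕ-even h))
            (trans (cong (λ x → suc (x ℕ.+ x)) (below-inj₁ h eq)) (sym (toℕ-odd h′))))
    ... | inj₂ _  = mr i (evenIx h) (trans (cong suc (toℕ-even h)) (trans (cong (λ x → suc (x ℕ.+ x)) (below-inj₂ h eq)) (sym m≡)))

    mid-injective : ∀ {i i′ : Fin s} {j j′ : Fin m} → mid i j ≡ mid i′ j′ → i ≡ i′ × j ≡ j′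
    mid-injective refl = refl , refl

    private
      double-injective : ∀ {x y} → x ℕ.+ x ≡ y ℕ.+ y → x ≡ y
      double-injective {zero}  {zero}  e = refl
      double-injective {suc x} {suc y} e = cong suc (double-injective (ℕₚ.suc-injective
        (trans (sym (ℕₚ.+-suc x x)) (trans (ℕₚ.suc-injective e) (ℕₚ.+-suc y y)))))

    opp-injective : ∀ {i h i′ h′} → opp i h ≡ opp i′ h′ → i ≡ i′ × h ≡ h′
    opp-injective {h = h} {h′ = h′} e with mid-injective e
    ... | e₁ , e₂ = e₁ , toℕ-injective (double-injective (trans (sym (toℕ-even h)) (trans (cong toℕ e₂) (toℕ-even h′))))

    -- The two neighbours of an opposite vertex on its path differ. This distinguishes the two edges
    -- that meet there.
    same-distinct : ∀ i h → same i (inject₁ h) ≡ same i (suc h) → ⊥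
    same-distinct i zero e with below (zero {k′})
    same-distinct i zero () | inj₁ _
    same-distinct i zero () | inj₂ _
    same-distinct i (suc h) e with below (inject₁ h) in eq | below (suc h) in eq′
    ... | inj₂ _  | _       = ℕₚ.<-irrefl (trans (sym (toℕ-inject₁ h)) (below-inj₂ (inject₁ h) eq)) (toℕ<n h)
    ... | inj₁ h₁ | inj₁ h₂ = ℕₚ.<-irrefl (trans (sym (toℕ-inject₁ h)) (trans (below-inj₁ (inject₁ h) eq)
          (trans (double-injective (ℕₚ.suc-injective (trans (sym (toℕ-odd h₁)) (trans (cong toℕ (proj₂ (mid-injective e))) (toℕ-odd h₂)))))
            (sym (below-inj₁ (suc h) eq′))))) (ℕₚ.n<1+n (toℕ h))
    same-distinct i (suc h) () | inj₁ h₁ | inj₂ _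

    module _ {V A B : Set} (ι : A → V) (κ : B → V) (_~_ : V → V → Set)
             (ι-step : ∀ {x v} → ι x ~ v → ∃ λ y → v ≡ κ y) (κ-step : ∀ {y v} → κ y ~ v → ∃ λ x → v ≡ ι x)
             (f : ThetaV s m → V) (hom : ∀ x y → ThetaAdj x y → f x ~ f y) (P : A) (eP : f left ≡ ι P) where

      next-opp : ∀ i h → (∃ λ x → f (same i (inject₁ h)) ≡ ι x) → ∃ λ y → f (opp i h) ≡ κ y
      next-opp i h (x , e) = ι-step (subst (_~ f (opp i h)) e (hom _ _ (inj₁ (forth i h))))

      -- Induction along the path: each edge crosses between the parts. The injections ι and κ are
      -- arbitrary so that the end may lie in M or in N.
      same-side : ∀ i n → ∃ λ x → f (same i n) ≡ ι x
      same-side i = <-weakInduction (λ n → ∃ λ x → f (same i n) ≡ ι x) (P , eP) λ h ih →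
        let y , e = next-opp i h ih in κ-step (subst (_~ f (same i (suc h))) e (hom _ _ (inj₁ (back i h))))

      opp-side : ∀ i h → ∃ λ y → f (opp i h) ≡ κ y
      opp-side i h = next-opp i h (same-side i (inject₁ h))

-- Choosing the coefficients and building the graphs

module AlgebraicGraphs where

  open import Defs
  open import Data.Nat as ℕ using (ℕ; zero; suc; _≤_; _<_; z≤n; s≤s; _^_; _∸_)
  import Data.Nat.Properties as ℕₚ
  import Data.Nat.ListAction as ListAction
  open import Data.Fin using (Fin; zero; suc; fromℕ; fromℕ<; inject₁; inject≤; combine; remQuot; finToFun; funToFin; splitAt; _↑ˡ_; _↑ʳ_)
  open import Data.Fin.Properties using (toℕ-injective; toℕ-inject₁; remQuot-combine; combine-remQuot; finToFun-funToFin; splitAt-↑ˡ; splitAt-↑ʳ; inject≤-injective)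
  open import Data.Bool using (Bool; true)
  import Data.List as List
  import Data.List.Properties as Listₚ
  open import Data.Vec using (Vec; map; _[_]≔_)
  open import Data.Vec.Properties using (map-[]≔)
  open import Data.Product using (Σ; ∃; _×_; _,_; proj₁; proj₂)
  open import Data.Sum using (_⊎_; inj₁; inj₂; [_,_]′)
  open import Data.Sum.Properties using (inj₁-injective; inj₂-injective)
  open import Data.Unit using (tt)
  open import Data.Empty using (⊥; ⊥-elim)
  open import Function using (_∘_; id)
  open import Relation.Nullary using (¬_; Dec; does)
  open import Relation.Nullary.Decidable using (dec-true)
  open import Relation.Binary.PropositionalEquality
  open import Algebra.Properties.Semiring.Sum ℕₚ.+-*-semiring using (sum; sum-cong-≗; ∑-distrib-+; *-distribˡ-sum)
  open Counting
  open PolynomialFunctions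
  open RichTrees
  open Configurations
  open ThetaEmbeddings

  below-fromℕ : ∀ n → below (fromℕ n) ≡ inj₂ tt
  below-fromℕ zero    = refl
  below-fromℕ (suc n) rewrite below-fromℕ n = refl

  module PathTerms {q : ℕ} (k′ dS dO : ℕ) where

    -- A path of length 2(k′ + 1) has k′ + 1 inner vertices opposite its ends, with dO coordinates
    -- each, and k′ on the side of its ends, with dS coordinates each.
    nz : ℕ
    nz = suc k′ ℕ.* dO ℕ.+ k′ ℕ.* dS

    oppVar : Fin (suc k′) → Fin dO → Fin nz
    oppVar h j = combine h j ↑ˡ (k′ ℕ.* dS)

    sameVar : Fin k′ → Fin dS → Fin nz
    sameVar h j = (suc k′ ℕ.* dO) ↑ʳ combine h j

    -- An edge is numbered by its opposite vertex together with one bit that tells which of the two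
    -- neighbours is meant.
    hIx : Fin (suc k′ ℕ.* 2) → Fin (suc k′)
    hIx e = proj₁ (remQuot 2 e)

    end : Fin (suc k′) × Fin 2 → Fin (suc (suc k′))
    end (h , zero)  = inject₁ h
    end (h , suc _) = suc h

    nIx : Fin (suc k′ ℕ.* 2) → Fin (suc (suc k′))
    nIx e = end (remQuot 2 e)

    oppTerm : Fin (suc k′) → Fin dO → Term q nz
    oppTerm h j = inj₁ (oppVar h j)

    sameTerm : (P Q : Fin dS → Fin q) → Fin (suc (suc k′)) → Fin dS → Term q nz
    sameTerm P Q zero    j = inj₂ (P j)
    sameTerm P Q (suc h) j = [ (λ h′ → inj₁ (sameVar h′ j)) , (λ _ → inj₂ (Q j)) ]′ (below h)

    module _ (S : Fin (suc (suc k′)) → Fin dS → Fin q) (O : Fin (suc k′) → Fin dO → Fin q) where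

      unknowns : Fin nz → Fin q
      unknowns v = [ (λ i → O (proj₁ (remQuot dO i)) (proj₂ (remQuot {suc k′} dO i)))
                   , (λ i → S (suc (inject₁ (proj₁ (remQuot dS i)))) (proj₂ (remQuot {k′} dS i))) ]′ (splitAt (suc k′ ℕ.* dO) v)

      unknowns-opp : ∀ h j → unknowns (oppVar h j) ≡ O h j
      unknowns-opp h j rewrite splitAt-↑ˡ (suc k′ ℕ.* dO) (combine h j) (k′ ℕ.* dS) =
        cong (λ p → O (proj₁ p) (proj₂ p)) (remQuot-combine h j)

      unknowns-same : ∀ h j → unknowns (sameVar h j) ≡ S (suc (inject₁ h)) j
      unknowns-same h j rewrite splitAt-↑ʳ (suc k′ ℕ.* dO) (k′ ℕ.* dS) (combine h j) =
        cong (λ p → S (suc (inject₁ (proj₁ p))) (proj₂ p)) (remQuot-combine h j)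

      term-same : ∀ P Q → (∀ j → P j ≡ S zero j) → (∀ h → below h ≡ inj₂ tt → ∀ j → Q j ≡ S (suc h) j) →
        ∀ n j → term unknowns (sameTerm P Q n j) ≡ S n j
      term-same P Q eP eQ zero    j = eP j
      term-same P Q eP eQ (suc h) j with below h in eq
      ... | inj₂ tt = eQ h eq j
      ... | inj₁ h′ = trans (unknowns-same h′ j) (cong (λ x → S (suc x) j)
            (toℕ-injective (trans (toℕ-inject₁ h′) (sym (below-inj₁ h eq)))))

  module Side {q : ℕ} (k′ dS dO : ℕ) {s s₀ : ℕ} (s₀≤s : s₀ ≤ s) {V : Set}
    (ι : Fin (q ^ dS) → V) (κ : Fin (q ^ dO) → V) (κ-inj : ∀ {x y} → κ x ≡ κ y → x ≡ y) (ι-inj : ∀ {x y} → ι x ≡ ι y → x ≡ y)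
    (_~_ : V → V → Set) (ι-step : ∀ {x v} → ι x ~ v → ∃ λ y → v ≡ κ y) (κ-step : ∀ {y v} → κ y ~ v → ∃ λ x → v ≡ ι x)
    (f : ThetaV s (2 ℕ.* suc k′ ∸ 1) → V) (f-inj : ∀ {x y} → f x ≡ f y → x ≡ y) (hom : ∀ x y → ThetaAdj x y → f x ~ f y)
    (P Q : Fin (q ^ dS)) (eP : f left ≡ ι P) (eQ : f right ≡ ι Q) where
    open ThetaPath s k′
    open PathTerms {q} k′ dS dO

    decS : Fin (q ^ dS) → Fin dS → Fin q
    decS = finToFun
    decO : Fin (q ^ dO) → Fin dO → Fin q
    decO = finToFun

    -- Only the first s₀ of the s paths are read, so that no constant depends on s.
    SV : Fin s₀ → Fin (suc (suc k′)) → Fin (q ^ dS)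
    SV p n = proj₁ (same-side ι κ _~_ ι-step κ-step f hom P eP (inject≤ p s₀≤s) n)

    OV : Fin s₀ → Fin (suc k′) → Fin (q ^ dO)
    OV p h = proj₁ (opp-side ι κ _~_ ι-step κ-step f hom P eP (inject≤ p s₀≤s) h)

    SV-eq : ∀ p n → f (same (inject≤ p s₀≤s) n) ≡ ι (SV p n)
    SV-eq p n = proj₂ (same-side ι κ _~_ ι-step κ-step f hom P eP (inject≤ p s₀≤s) n)

    OV-eq : ∀ p h → f (opp (inject≤ p s₀≤s) h) ≡ κ (OV p h)
    OV-eq p h = proj₂ (opp-side ι κ _~_ ι-step κ-step f hom P eP (inject≤ p s₀≤s) h)

    OV-injective : ∀ {p h p′ h′} → OV p h ≡ OV p′ h′ → p ≡ p′ × h ≡ h′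
    OV-injective {p} {h} {p′} {h′} e with opp-injective (f-inj (trans (OV-eq p h) (trans (cong κ e) (sym (OV-eq p′ h′)))))
    ... | e₁ , e₂ = inject≤-injective s₀≤s s₀≤s p p′ e₁ , e₂

    -- The opposite vertices are inner vertices and hence distinct over all paths and positions,
    -- which settles p and h. Its two neighbours then settle the bit.
    edge-injective : ∀ {p e p′ e′} → SV p (nIx e) ≡ SV p′ (nIx e′) → OV p (hIx e) ≡ OV p′ (hIx e′) → p ≡ p′ × e ≡ e′
    edge-injective {p} {e} {p′} {e′} eS eO with OV-injective eO
    ... | refl , eh = refl , trans (sym (combine-remQuot {suc k′} 2 e))
            (trans (cong (λ x → combine (proj₁ x) (proj₂ x)) (ends (remQuot 2 e) (remQuot 2 e′) eh
               (f-inj (trans (SV-eq p (nIx e)) (trans (cong ι eS) (sym (SV-eq p (nIx e′))))))))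
              (combine-remQuot {suc k′} 2 e′))
      where
      ends : ∀ (x y : Fin (suc k′) × Fin 2) → proj₁ x ≡ proj₁ y →
        same (inject≤ p s₀≤s) (end x) ≡ same (inject≤ p s₀≤s) (end y) → x ≡ y
      ends (h , zero)     (h , zero)     refl _ = refl
      ends (h , zero)     (h , suc zero) refl e = ⊥-elim (same-distinct _ h e)
      ends (h , suc zero) (h , zero)     refl e = ⊥-elim (same-distinct _ h (sym e))
      ends (h , suc zero) (h , suc zero) refl _ = refl

    adjacent : ∀ p e → ι (SV p (nIx e)) ~ κ (OV p (hIx e))
    adjacent p e = subst₂ _~_ (SV-eq p (nIx e)) (OV-eq p (hIx e)) (hom _ _ (edge (remQuot 2 e)))
      where
      edge : ∀ x → ThetaAdj (same (inject≤ p s₀≤s) (end x)) (opp (inject≤ p s₀≤s) (proj₁ x))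
      edge (h , zero)  = inj₁ (forth _ h)
      edge (h , suc _) = inj₂ (back _ h)

    z : Fin s₀ → Fin nz → Fin q
    z p = unknowns (λ n → decS (SV p n)) (λ h → decO (OV p h))

    -- The first opposite vertex alone tells the paths apart; it exists because there are k′ + 1 of
    -- them.
    z-injective : ∀ {p p′} → (∀ v → z p v ≡ z p′ v) → p ≡ p′
    z-injective {p} {p′} h = proj₁ (OV-injective {h = zero} {h′ = zero} (finToFun-injective λ j →
      trans (sym (unknowns-opp (λ n → decS (SV p n)) (λ h → decO (OV p h)) zero j))
        (trans (h (oppVar zero j)) (unknowns-opp (λ n → decS (SV p′ n)) (λ h → decO (OV p′ h)) zero j))))

    z-opp : ∀ p h j → term (z p) (oppTerm h j) ≡ decO (OV p h) j
    z-opp p = unknowns-opp (λ n → decS (SV p n)) (λ h → decO (OV p h))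

    z-same : ∀ p n j → term (z p) (sameTerm (decS P) (decS Q) n j) ≡ decS (SV p n) j
    z-same p = term-same (λ n → decS (SV p n)) (λ h → decO (OV p h)) (decS P) (decS Q)
      (λ j → cong (λ x → decS x j) (ι-inj (trans (sym eP) (SV-eq p zero))))
      (λ h e j → cong (λ x → decS x j) (ι-inj (trans (sym eQ) (trans (cong f (last h e)) (SV-eq p (suc h))))))
      where
      last : ∀ h → below h ≡ inj₂ tt → right ≡ same (inject≤ p s₀≤s) (suc h)
      last h e rewrite e = refl

  sumV-+ : ∀ {N} T (f g : Vec (Fin N) T → ℕ) → sumV T (λ v → f v ℕ.+ g v) ≡ sumV T f ℕ.+ sumV T g
  sumV-+ zero    f g = refl
  sumV-+ (suc T) f g = trans (sum-cong-≗ (λ a → sumV-+ T (λ v → f (a Data.Vec.∷ v)) (λ v → g (a Data.Vec.∷ v))))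
    (∑-distrib-+ (λ a → sumV T (λ v → f (a Data.Vec.∷ v))) (λ a → sumV T (λ v → g (a Data.Vec.∷ v))))

  sumV-sum-≤ : ∀ {N M} T c {κ} (f : Fin M → Vec (Fin N) T → ℕ) → (∀ i → c ℕ.* sumV T (f i) ≤ κ) →
    c ℕ.* sumV T (λ v → sum (λ i → f i v)) ≤ M ℕ.* κ
  sumV-sum-≤ T c f h = ℕₚ.≤-trans (ℕₚ.≤-reflexive (trans (cong (c ℕ.*_) (sumV-sum-swap T (λ v i → f i v)))
    (*-distribˡ-sum c (λ i → sumV T (f i))))) (sum-≤ h)

  sum≡0 : ∀ {n} (f : Fin n → ℕ) → sum f ≡ 0 → ∀ i → f i ≡ 0
  sum≡0 f e i = ℕₚ.n≤0⇒n≡0 (ℕₚ.≤-trans (term≤sum f i) (ℕₚ.≤-reflexive e))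

  sum-allFin : ∀ n (f : Fin n → ℕ) → ListAction.sum (List.map f (List.allFin n)) ≡ sum f
  sum-allFin n f = trans (cong ListAction.sum (Listₚ.map-tabulate id f)) (go n f)
    where
    go : ∀ n (f : Fin n → ℕ) → ListAction.sum (List.tabulate f) ≡ sum f
    go zero    f = refl
    go (suc n) f = cong (f zero ℕ.+_) (go n (f ∘ suc))

  module Graphs {q : ℕ} (𝔽 : FiniteDomain q) (k′ a t u ρ w T : ℕ) (q≥2 : 2 ≤ q) (T≤q : T ≤ q) where
    open Polynomials 𝔽 using (F)

    ℓ nE r L K nzM nzN : ℕ
    ℓ   = t ℕ.+ u
    nE  = suc k′ ℕ.* 2
    r   = ρ ℕ.* nE
    L   = t ℕ.* r
    K   = suc (degS r (suc r) 1)
    nzM = suc k′ ℕ.* ℓ ℕ.+ k′ ℕ.* a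
    nzN = suc k′ ℕ.* a ℕ.+ k′ ℕ.* ℓ

    instance
      q-nonZero : ℕ.NonZero q
      q-nonZero = ℕ.>-nonZero (ℕₚ.≤-trans (s≤s z≤n) q≥2)

    θ : Fin T → F
    θ τ = inject≤ τ T≤q

    θ-inj : ∀ {i j} → θ i ≡ θ j → i ≡ j
    θ-inj = inject≤-injective T≤q T≤q _ _

    open Construction 𝔽 a t u ρ nE T θ hiding (L; r)

    module PM = PathTerms {q} k′ a ℓ
    module PN = PathTerms {q} k′ ℓ a

    module TM (P Q : Fin (q ^ a)) where
      xT : Fin nE → Fin a → Term q PM.nz
      xT e = PM.sameTerm (finToFun P) (finToFun Q) (PM.nIx e)
      yT : Fin nE → Fin ℓ → Term q PM.nz
      yT e = PM.oppTerm (PM.hIx e)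
      open Template w PM.nz xT yT public

    module TN (P Q : Fin (q ^ ℓ)) where
      xT : Fin nE → Fin a → Term q PN.nz
      xT e = PN.oppTerm (PN.hIx e)
      yT : Fin nE → Fin ℓ → Term q PN.nz
      yT e = PN.sameTerm (finToFun P) (finToFun Q) (PN.nIx e)
      open Template w PN.nz xT yT public

    κ : ℕ
    κ = 2 ^ L ℕ.* (w ^ L ℕ.* q ^ (L ∸ ρ))

    -- L counts the equations of ρ paths, t for each of the ρ · nE edges, so the balance for one
    -- path carries over.
    vars≤L : ∀ {nz} → nz ≤ nE ℕ.* t → ρ ℕ.* nz ≤ L
    vars≤L {nz} h = begin
      ρ ℕ.* nz               ≤⟨ ℕₚ.*-monoʳ-≤ ρ h ⟩
      ρ ℕ.* (nE ℕ.* t)       ≡⟨ ℕₚ.*-assoc ρ nE t ⟨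
      ρ ℕ.* nE ℕ.* t         ≡⟨ ℕₚ.*-comm (ρ ℕ.* nE) t ⟩
      L                      ∎
      where open ℕₚ.≤-Reasoning

    -- Each block is packed into one number below q^L. The averaging lemma for vectors then changes
    -- a whole block at once.
    Code : Set
    Code = Vec (Fin (q ^ L)) T

    decode : Code → Vec (Vec F L) T
    decode = map (finToVec L)

    average : (b : Vec (Vec F L) T → Fin T → Bool) → (∀ l τ → sumV L (λ c → ind (b (l [ τ ]≔ c) τ)) ≤ κ) →
      ∀ τ → q ^ L ℕ.* sumV T (λ v → ind (b (decode v) τ)) ≤ (q ^ L) ^ T ℕ.* κ
    average b h τ = sumV-average T τ (λ v → ind (b (decode v) τ)) λ v → begin
      sum (λ c → ind (b (decode (v [ τ ]≔ c)) τ))            ≡⟨ sum-cong-≗ {q ^ L} (λ c → cong (λ l → ind (b l τ)) (map-[]≔ (finToVec L) v τ)) ⟩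
      sum (λ c → ind (b (decode v [ τ ]≔ finToVec L c) τ))   ≡⟨ sum-finToVec L (λ c → ind (b (decode v [ τ ]≔ c) τ)) ⟩
      sumV L (λ c → ind (b (decode v [ τ ]≔ c) τ))           ≤⟨ h (decode v) τ ⟩
      κ                                                      ∎
      where open ℕₚ.≤-Reasoning

    badM badN badness : Code → ℕ
    badM v = sum (λ P → sum (λ Q → sum (λ τ → ind (TM.bad P Q (decode v) τ))))
    badN v = sum (λ P → sum (λ Q → sum (λ τ → ind (TN.bad P Q (decode v) τ))))
    badness v = badM v ℕ.+ badN v

    module Choice (a≤ : a ≤ ℓ) (balanced : nzM ≤ nE ℕ.* t) (ρ≤L : ρ ≤ L) (w-big : (1 ℕ.+ (L ℕ.+ ρ) ℕ.* K) ^ L < w)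
                  (ρ≡ : ρ ≡ suc (ℓ ℕ.+ ℓ)) (q-big : 2 ℕ.* (T ℕ.* (2 ^ L ℕ.* w ^ L)) < q) where

      -- Swapping the parts swaps a and ℓ. As one more inner vertex lies opposite the ends than
      -- beside them and a ≤ ℓ, ends in M are the worse case.
      nzN≤ : nzN ≤ nE ℕ.* t
      nzN≤ = ℕₚ.≤-trans swap balanced
        where
        swap : suc k′ ℕ.* a ℕ.+ k′ ℕ.* ℓ ≤ suc k′ ℕ.* ℓ ℕ.+ k′ ℕ.* a
        swap = begin
          (a ℕ.+ k′ ℕ.* a) ℕ.+ k′ ℕ.* ℓ  ≤⟨ ℕₚ.+-monoˡ-≤ (k′ ℕ.* ℓ) (ℕₚ.+-monoˡ-≤ (k′ ℕ.* a) a≤) ⟩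
          (ℓ ℕ.+ k′ ℕ.* a) ℕ.+ k′ ℕ.* ℓ  ≡⟨ S.solve 3 (λ x y z → (x S.:+ y) S.:+ z S.:= (x S.:+ z) S.:+ y) refl ℓ (k′ ℕ.* a) (k′ ℕ.* ℓ) ⟩
          (ℓ ℕ.+ k′ ℕ.* ℓ) ℕ.+ k′ ℕ.* a  ∎
          where open ℕₚ.≤-Reasoning

      total : q ^ L ℕ.* sumV T badness ≤
              q ^ a ℕ.* (q ^ a ℕ.* (T ℕ.* ((q ^ L) ^ T ℕ.* κ))) ℕ.+ q ^ ℓ ℕ.* (q ^ ℓ ℕ.* (T ℕ.* ((q ^ L) ^ T ℕ.* κ)))
      total = ℕₚ.≤-trans (ℕₚ.≤-reflexive (trans (cong (q ^ L ℕ.*_) (sumV-+ T badM badN)) (ℕₚ.*-distribˡ-+ (q ^ L) (sumV T badM) (sumV T badN))))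
        (ℕₚ.+-mono-≤
          (sumV-sum-≤ T (q ^ L) _ λ P → sumV-sum-≤ T (q ^ L) _ λ Q → sumV-sum-≤ T (q ^ L) _
            (average (TM.bad P Q) λ l τ → TM.Bound.few-bad P Q l τ q≥2 ρ≤L (vars≤L balanced) w-big))
          (sumV-sum-≤ T (q ^ L) _ λ P → sumV-sum-≤ T (q ^ L) _ λ Q → sumV-sum-≤ T (q ^ L) _
            (average (TN.bad P Q) λ l τ → TN.Bound.few-bad P Q l τ q≥2 ρ≤L (vars≤L nzN≤) w-big)))

      -- A fixed pair of ends and a fixed τ make a proportion of at most 2^L w^L q^(-ρ) of the codes
      -- bad. With ρ = 2ℓ + 1, the at most 2 q^(2ℓ) pairs of ends leave one factor q to spare, and
      -- this absorbs the constant.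
      total< : sumV T badness < (q ^ L) ^ T
      total< = ℕₚ.*-cancelˡ-< (q ^ L) _ _ (begin-strict
        q ^ L ℕ.* sumV T badness ≤⟨ total ⟩
        q ^ a ℕ.* (q ^ a ℕ.* (T ℕ.* (X ℕ.* κ))) ℕ.+ q ^ ℓ ℕ.* (q ^ ℓ ℕ.* (T ℕ.* (X ℕ.* κ)))
          ≤⟨ ℕₚ.+-monoˡ-≤ _ (ℕₚ.*-mono-≤ qa (ℕₚ.*-monoˡ-≤ (T ℕ.* (X ℕ.* κ)) qa)) ⟩
        q ^ ℓ ℕ.* (q ^ ℓ ℕ.* (T ℕ.* (X ℕ.* κ))) ℕ.+ q ^ ℓ ℕ.* (q ^ ℓ ℕ.* (T ℕ.* (X ℕ.* κ)))
          ≡⟨ S.solve 6 (λ p T X α β γ → p S.:* (p S.:* (T S.:* (X S.:* (α S.:* (β S.:* γ))))) S.:+ p S.:* (p S.:* (T S.:* (X S.:* (α S.:* (β S.:* γ)))))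
                         S.:= (S.con 2 S.:* (T S.:* (α S.:* β))) S.:* ((p S.:* p) S.:* γ S.:* X)) refl
               (q ^ ℓ) T X (2 ^ L) (w ^ L) (q ^ (L ∸ ρ)) ⟩
        2 ℕ.* (T ℕ.* (2 ^ L ℕ.* w ^ L)) ℕ.* (q ^ ℓ ℕ.* q ^ ℓ ℕ.* q ^ (L ∸ ρ) ℕ.* X)
          <⟨ ℕₚ.*-monoˡ-< (q ^ ℓ ℕ.* q ^ ℓ ℕ.* q ^ (L ∸ ρ) ℕ.* X) {{factor-nonZero}} q-big ⟩
        q ℕ.* (q ^ ℓ ℕ.* q ^ ℓ ℕ.* q ^ (L ∸ ρ) ℕ.* X)
          ≡⟨ S.solve 4 (λ q p γ X → q S.:* (p S.:* p S.:* γ S.:* X) S.:= (q S.:* (p S.:* p) S.:* γ) S.:* X) refl q (q ^ ℓ) (q ^ (L ∸ ρ)) X ⟩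
        q ℕ.* (q ^ ℓ ℕ.* q ^ ℓ) ℕ.* q ^ (L ∸ ρ) ℕ.* X
          ≡⟨ cong (λ x → q ℕ.* x ℕ.* q ^ (L ∸ ρ) ℕ.* X) (ℕₚ.^-distribˡ-+-* q ℓ ℓ) ⟨
        q ^ suc (ℓ ℕ.+ ℓ) ℕ.* q ^ (L ∸ ρ) ℕ.* X
          ≡⟨ cong (λ x → q ^ x ℕ.* q ^ (L ∸ ρ) ℕ.* X) ρ≡ ⟨
        q ^ ρ ℕ.* q ^ (L ∸ ρ) ℕ.* X
          ≡⟨ cong (ℕ._* X) (trans (sym (ℕₚ.^-distribˡ-+-* q ρ (L ∸ ρ))) (cong (q ^_) (ℕₚ.m+[n∸m]≡n ρ≤L))) ⟩
        q ^ L ℕ.* X ∎)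
        where
        open ℕₚ.≤-Reasoning
        X = (q ^ L) ^ T
        qa : q ^ a ≤ q ^ ℓ
        qa = ℕₚ.^-monoʳ-≤ q a≤
        pow-nonZero : ∀ n → ℕ.NonZero (q ^ n)
        pow-nonZero n = ℕₚ.m^n≢0 q n
        factor-nonZero : ℕ.NonZero (q ^ ℓ ℕ.* q ^ ℓ ℕ.* q ^ (L ∸ ρ) ℕ.* X)
        factor-nonZero = ℕₚ.m*n≢0 (q ^ ℓ ℕ.* q ^ ℓ ℕ.* q ^ (L ∸ ρ)) X
          {{ℕₚ.m*n≢0 (q ^ ℓ ℕ.* q ^ ℓ) (q ^ (L ∸ ρ)) {{ℕₚ.m*n≢0 (q ^ ℓ) (q ^ ℓ) {{pow-nonZero ℓ}} {{pow-nonZero ℓ}}}} {{pow-nonZero (L ∸ ρ)}}}}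
          {{ℕₚ.m^n≢0 (q ^ L) T {{pow-nonZero L}}}}

      good : ∃ λ v → badness v ≡ 0
      good = sumV<⇒zero T badness total<

    Good : Vec (Vec F L) T → Set
    Good l = (∀ P Q τ → ¬ (TM.bad P Q l τ ≡ true)) × (∀ P Q τ → ¬ (TN.bad P Q l τ ≡ true))

    badness⇒Good : ∀ v → badness v ≡ 0 → Good (decode v)
    badness⇒Good v e = (λ P Q τ b → ind-true b (sum≡0 _ (sum≡0 _ (sum≡0 _ (ℕₚ.m+n≡0⇒m≡0 _ e) P) Q) τ)) ,
                       (λ P Q τ b → ind-true b (sum≡0 _ (sum≡0 _ (sum≡0 _ (ℕₚ.m+n≡0⇒n≡0 (badM v) e) P) Q) τ))
      where
      ind-true : ∀ {b} → b ≡ true → ind b ≡ 0 → ⊥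
      ind-true refl ()

    module Realisation (l : Vec (Vec F L) T) where

      adj? : ∀ (x : Fin (q ^ a)) (y : Fin (q ^ ℓ)) → Dec (Adjacent l (finToFun x) (finToFun y))
      adj? x y = adjacent? l (finToFun x) (finToFun y)

      E : Fin (q ^ a) → Fin (q ^ ℓ) → Bool
      E x y = does (adj? x y)

      step₁ : ∀ {x v} → BipAdj E (inj₁ x) v → ∃ λ y → v ≡ inj₂ y
      step₁ {v = inj₂ y} _ = y , refl

      step₂ : ∀ {y v} → BipAdj E (inj₂ y) v → ∃ λ x → v ≡ inj₁ x
      step₂ {v = inj₁ x} _ = x , refl

      module _ (l-good : Good l) (T-big : (ρ ℕ.* w ℕ.* nE) ℕ.* ((ρ ℕ.* w ℕ.* nE) ℕ.* (a ℕ.+ u)) ℕ.+ ρ ℕ.* w ℕ.* (ρ ℕ.* w ℕ.* (nzM ℕ.+ nzN)) < T)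
               {s : ℕ} (i₀ : Fin s) (s₀≤s : ρ ℕ.* w ≤ s) (f : ThetaV s (2 ℕ.* suc k′ ∸ 1) → Fin (q ^ a) ⊎ Fin (q ^ ℓ))
               (f-inj : ∀ {x y} → f x ≡ f y → x ≡ y) (hom : ∀ x y → ThetaAdj x y → BipAdj E (f x) (f y)) where

        T-bound : ∀ {nz} → nz ≤ nzM ℕ.+ nzN →
          (ρ ℕ.* w ℕ.* nE) ℕ.* ((ρ ℕ.* w ℕ.* nE) ℕ.* (a ℕ.+ u)) ℕ.+ ρ ℕ.* w ℕ.* (ρ ℕ.* w ℕ.* nz) < T
        T-bound h = ℕₚ.≤-<-trans (ℕₚ.+-monoʳ-≤ ((ρ ℕ.* w ℕ.* nE) ℕ.* ((ρ ℕ.* w ℕ.* nE) ℕ.* (a ℕ.+ u)))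
          (ℕₚ.*-monoʳ-≤ (ρ ℕ.* w) (ℕₚ.*-monoʳ-≤ (ρ ℕ.* w) h))) T-big

        right-end : right ≡ ThetaPath.same s k′ i₀ (suc (fromℕ k′))
        right-end rewrite below-fromℕ k′ = refl

        no-theta-M : ∀ P Q → f left ≡ inj₁ P → f right ≡ inj₁ Q → ⊥
        no-theta-M P Q eP eQ =
          let τ , b = FindBad.find-bad 𝔽 a t u ρ nE T θ θ-inj w PM.nz (TM.xT P Q) (TM.yT P Q) l
                        (λ p e → Sd.SV p (PM.nIx e)) (λ p e → Sd.OV p (PM.hIx e)) Sd.z
                        (λ p e → Sd.z-same p (PM.nIx e)) (λ p e → Sd.z-opp p (PM.hIx e))
                        (λ p e → does-true (adj? (Sd.SV p (PM.nIx e)) (Sd.OV p (PM.hIx e))) (Sd.adjacent p e))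
                        Sd.edge-injective Sd.z-injective (T-bound (ℕₚ.m≤m+n nzM nzN))
          in proj₁ l-good P Q τ b
          where
          module Sd = Side k′ a ℓ s₀≤s inj₁ inj₂ inj₂-injective inj₁-injective (BipAdj E)
                        (λ {x} {v} → step₁ {x} {v}) (λ {y} {v} → step₂ {y} {v}) f f-inj hom P Q eP eQ

        no-theta-N : ∀ P Q → f left ≡ inj₂ P → f right ≡ inj₂ Q → ⊥
        no-theta-N P Q eP eQ =
          let τ , b = FindBad.find-bad 𝔽 a t u ρ nE T θ θ-inj w PN.nz (TN.xT P Q) (TN.yT P Q) l
                        (λ p e → Sd.OV p (PN.hIx e)) (λ p e → Sd.SV p (PN.nIx e)) Sd.z
                        (λ p e → Sd.z-opp p (PN.hIx e)) (λ p e → Sd.z-same p (PN.nIx e))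
                        (λ p e → does-true (adj? (Sd.OV p (PN.hIx e)) (Sd.SV p (PN.nIx e))) (Sd.adjacent p e))
                        (λ eO eS → Sd.edge-injective eS eO) Sd.z-injective (T-bound (ℕₚ.m≤n+m nzN nzM))
          in proj₂ l-good P Q τ b
          where
          module Sd = Side k′ ℓ a s₀≤s inj₂ inj₁ inj₁-injective inj₂-injective (BipAdj E)
                        (λ {x} {v} → step₂ {x} {v}) (λ {y} {v} → step₁ {y} {v}) f f-inj hom P Q eP eQ

        -- The ends have even distance, so following the path `i₀` shows that `right` lies in the
        -- same part as `left`.
        no-theta : ⊥
        no-theta with f left in eP
        ... | inj₁ P with ThetaPath.same-side s k′ inj₁ inj₂ (BipAdj E) (λ {x} {v} → step₁ {x} {v}) (λ {y} {v} → step₂ {y} {v}) f hom P eP i₀ (suc (fromℕ k′))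
        ...   | Q , eQ = no-theta-M P Q eP (trans (cong f right-end) eQ)
        no-theta | inj₂ P with ThetaPath.same-side s k′ inj₂ inj₁ (BipAdj E) (λ {x} {v} → step₂ {x} {v}) (λ {y} {v} → step₁ {y} {v}) f hom P eP i₀ (suc (fromℕ k′))
        ...   | Q , eQ = no-theta-N P Q eP (trans (cong f right-end) eQ)

      row : ∀ x → q ^ u ≤ cnt (E x)
      row x = injection⇒cnt (q ^ u) (E x) nbr nbr-inj λ v → dec-true (adj? x (nbr v)) (ok v)
        where
        fill : Fin (q ^ u) → Fin t ⊎ Fin u → F
        decU : Fin (q ^ u) → Fin u → F
        decU = finToFun
        base : Fin (q ^ u) → Fin ℓ → F
        -- The zeros are placeholders: `edgeVec` reads only the u free coordinates, so g can be
        -- evaluated before the first t coordinates are known.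
        base v i = [ (λ _ → zero′) , decU v ]′ (splitAt t i)
          where
          zero′ : F
          zero′ = FiniteDomain.0# 𝔽
        fill v (inj₁ j) = g θ l j (edgeVec (finToFun x) (base v))
        fill v (inj₂ j) = decU v j
        yv : Fin (q ^ u) → Fin ℓ → F
        yv v i = fill v (splitAt t i)
        nbr : Fin (q ^ u) → Fin (q ^ ℓ)
        nbr v = funToFin (yv v)
        yv-t : ∀ v j → yv v (j ↑ˡ u) ≡ g θ l j (edgeVec (finToFun x) (base v))
        yv-t v j rewrite splitAt-↑ˡ t j u = refl
        yv-u : ∀ v j → yv v (t ↑ʳ j) ≡ decU v j
        yv-u v j rewrite splitAt-↑ʳ t u j = refl
        base-u : ∀ v j → base v (t ↑ʳ j) ≡ decU v j
        base-u v j rewrite splitAt-↑ʳ t u j = refl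
        nbr-inj : ∀ {i j} → nbr i ≡ nbr j → i ≡ j
        nbr-inj {i} {j} e = finToFun-injective {q} {u} λ v → trans (sym (yv-u i v)) (trans (sym (finToFun-funToFin (yv i) (t ↑ʳ v)))
          (trans (cong (λ c → finToFun {q} {ℓ} c (t ↑ʳ v)) e) (trans (finToFun-funToFin (yv j) (t ↑ʳ v)) (yv-u j v))))
        same-edge : ∀ v i → edgeVec (finToFun x) (base v) i ≡ edgeVec (finToFun x) (finToFun {q} {ℓ} (nbr v)) i
        same-edge v i with splitAt a i
        ... | inj₁ j = refl
        ... | inj₂ j = trans (base-u v j) (sym (trans (finToFun-funToFin (yv v) (t ↑ʳ j)) (yv-u v j)))
        ok : ∀ v → Adjacent l (finToFun x) (finToFun {q} {ℓ} (nbr v))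
        ok v j = trans (finToFun-funToFin (yv v) (j ↑ˡ u)) (trans (yv-t v j) (g-cong θ l j (same-edge v)))

      edges≥ : q ^ (a ℕ.+ u) ≤ edges E
      edges≥ = begin
        q ^ (a ℕ.+ u)               ≡⟨ ℕₚ.^-distribˡ-+-* q a u ⟩
        q ^ a ℕ.* q ^ u             ≡⟨ sum-const (q ^ a) (q ^ u) ⟨
        sum {q ^ a} (λ _ → q ^ u)   ≤⟨ sum-mono row ⟩
        sum (λ x → cnt (E x))       ≡⟨ sum-cong-≗ (λ x → sym (sum-allFin (q ^ ℓ) (λ y → ind (E x y)))) ⟩
        sum (λ x → ListAction.sum (List.map (λ y → ind (E x y)) (List.allFin (q ^ ℓ))))
                                    ≡⟨ sum-allFin (q ^ a) _ ⟨
        edges E                     ∎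
        where open ℕₚ.≤-Reasoning

    realise : a ≤ ℓ → nzM ≤ nE ℕ.* t → ρ ≤ L → (1 ℕ.+ (L ℕ.+ ρ) ℕ.* K) ^ L < w → ρ ≡ suc (ℓ ℕ.+ ℓ) →
      2 ℕ.* (T ℕ.* (2 ^ L ℕ.* w ^ L)) < q →
      (ρ ℕ.* w ℕ.* nE) ℕ.* ((ρ ℕ.* w ℕ.* nE) ℕ.* (a ℕ.+ u)) ℕ.+ ρ ℕ.* w ℕ.* (ρ ℕ.* w ℕ.* (nzM ℕ.+ nzN)) < T →
      ∀ s → ρ ℕ.* w ≤ s → Σ (Fin (q ^ a) → Fin (q ^ ℓ) → Bool) λ E → (BipGraph E -free Θ s (2 ℕ.* suc k′)) × q ^ (a ℕ.+ u) ≤ edges E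
    realise a≤ balanced ρ≤L w-big ρ≡ q-big T-big s s₀≤s = E , theta-free , edges≥
      where
      v : ∃ λ v → badness v ≡ 0
      v = Choice.good a≤ balanced ρ≤L w-big ρ≡ q-big
      open Realisation (decode (proj₁ v))
      s≥1 : 1 ≤ s
      s≥1 = ℕₚ.≤-trans (ℕₚ.*-mono-≤ (ℕₚ.≤-trans (s≤s z≤n) (ℕₚ.≤-reflexive (sym ρ≡))) (ℕₚ.≤-trans (s≤s z≤n) w-big)) s₀≤s
      theta-free : BipGraph E -free Θ s (2 ℕ.* suc k′)
      theta-free (f , f-inj , hom) =
        no-theta (badness⇒Good (proj₁ v) (proj₂ v)) T-big (fromℕ< s≥1) s₀≤s f f-inj hom

  -- The last hypothesis is the balance of unknowns and equations for ends in M. Both thresholds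
  -- come before the field, so they are uniform in q.
  sparse-graphs : ∀ k′ a t u → a ≤ t ℕ.+ u → 1 ≤ t → suc k′ ℕ.* (t ℕ.+ u) ℕ.+ k′ ℕ.* a ≤ suc k′ ℕ.* 2 ℕ.* t →
    Σ ℕ λ s₀ → Σ ℕ λ q₀ → ∀ {q} → FiniteDomain q → ∀ s → s₀ ≤ s → q₀ ≤ q →
    Σ (Fin (q ^ a) → Fin (q ^ (t ℕ.+ u)) → Bool) λ E → (BipGraph E -free Θ s (2 ℕ.* suc k′)) × q ^ (a ℕ.+ u) ≤ edges E
  -- The summands of q₀ give in turn q ≥ 2, room for T distinct θ_τ, and q > C for the union bound.
  sparse-graphs k′ a t u a≤ t≥1 balanced = ρ ℕ.* w , 2 ℕ.+ T ℕ.+ C , λ {q} 𝔽 s s₀≤s q₀≤q →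
    Graphs.realise 𝔽 k′ a t u ρ w T
      (ℕₚ.≤-trans (ℕₚ.≤-trans (ℕₚ.m≤m+n 2 T) (ℕₚ.m≤m+n (2 ℕ.+ T) C)) q₀≤q)
      (ℕₚ.≤-trans (ℕₚ.≤-trans (ℕₚ.m≤n+m T 2) (ℕₚ.m≤m+n (2 ℕ.+ T) C)) q₀≤q)
      a≤ balanced ρ≤L ℕₚ.≤-refl refl (ℕₚ.≤-trans (s≤s (ℕₚ.m≤n+m C (suc T))) q₀≤q) ℕₚ.≤-refl s s₀≤s
    where
    -- ρ makes the union bound over the pairs of endpoints work; w satisfies (1 + E w K)^L < w^E for L < E ≤ L + ρ
    -- in few-bad; with T values θ_τ, some ψ_τ separates all edges and paths of a theta graph with ρ w paths.
    ℓ ρ nE r L w T C : ℕ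
    ℓ  = t ℕ.+ u
    ρ  = suc (ℓ ℕ.+ ℓ)
    nE = suc k′ ℕ.* 2
    r  = ρ ℕ.* nE
    L  = t ℕ.* r
    w  = suc ((1 ℕ.+ (L ℕ.+ ρ) ℕ.* suc (degS r (suc r) 1)) ^ L)
    T  = suc ((ρ ℕ.* w ℕ.* nE) ℕ.* ((ρ ℕ.* w ℕ.* nE) ℕ.* (a ℕ.+ u)) ℕ.+
           ρ ℕ.* w ℕ.* (ρ ℕ.* w ℕ.* ((suc k′ ℕ.* ℓ ℕ.+ k′ ℕ.* a) ℕ.+ (suc k′ ℕ.* a ℕ.+ k′ ℕ.* ℓ))))
    C  = 2 ℕ.* (T ℕ.* (2 ^ L ℕ.* w ^ L))
    ρ≤L : ρ ≤ L
    ρ≤L = ℕₚ.≤-trans (ℕₚ.≤-reflexive (sym (ℕₚ.*-identityˡ ρ))) (ℕₚ.*-mono-≤ t≥1 (ℕₚ.m≤m*n ρ nE))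

-- Finite rings and maximal quotients

module FiniteRings where

  open import Level using (0ℓ)
  open import Algebra.Bundles using (CommutativeRing)
  open import Data.Nat using (ℕ; zero; suc; _≤_; _<_; z≤n; s≤s)
  import Data.Nat.Properties as ℕₚ
  open import Data.Fin using (Fin; zero; suc)
  open import Data.Fin.Properties using (any?)
  open import Data.Bool using (Bool; true; false; not)
  open import Data.Product using (Σ; ∃; _×_; _,_)
  open import Data.Sum using (_⊎_; inj₁; inj₂)
  open import Data.Empty using (⊥-elim)
  open import Function using (_∘_)
  open import Relation.Nullary using (¬_; Dec; yes; no; does)
  open import Relation.Nullary.Decidable using (_×-dec_; ¬?; map′; dec-true; dec-false)
  import Relation.Binary.PropositionalEquality as ≡
  open ≡ using (_≡_)
  import Algebra.Properties.Semiring.Mult as Mult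
  open Counting

  Ring₀ : Set₁
  Ring₀ = CommutativeRing 0ℓ 0ℓ

  record RingHom (A B : Ring₀) : Set where
    private
      module A = CommutativeRing A
      module B = CommutativeRing B
    field
      fun    : A.Carrier → B.Carrier
      cong   : ∀ {x y} → x A.≈ y → fun x B.≈ fun y
      +-homo : ∀ x y → fun (x A.+ y) B.≈ fun x B.+ fun y
      *-homo : ∀ x y → fun (x A.* y) B.≈ fun x B.* fun y
      0-homo : fun A.0# B.≈ B.0#
      1-homo : fun A.1# B.≈ B.1#

  open RingHom using (fun)

  id-hom : ∀ {A} → RingHom A A
  id-hom {A} = record
    { fun = λ x → x ; cong = λ e → e ; +-homo = λ _ _ → refl ; *-homo = λ _ _ → refl ; 0-homo = refl ; 1-homo = refl }
    where open CommutativeRing A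

  _∘ʰ_ : ∀ {A B C} → RingHom B C → RingHom A B → RingHom A C
  _∘ʰ_ {C = C} g f = record
    { fun    = λ x → G.fun (F.fun x)
    ; cong   = λ e → G.cong (F.cong e)
    ; +-homo = λ x y → trans (G.cong (F.+-homo x y)) (G.+-homo _ _)
    ; *-homo = λ x y → trans (G.cong (F.*-homo x y)) (G.*-homo _ _)
    ; 0-homo = trans (G.cong F.0-homo) G.0-homo
    ; 1-homo = trans (G.cong F.1-homo) G.1-homo
    }
    where
    open CommutativeRing C
    module F = RingHom f
    module G = RingHom g

  -- The quotient by the ideal (x) has the same carrier and a coarser equality.
  module Quotient (A : Ring₀) (x : CommutativeRing.Carrier A) where
    open CommutativeRing A
    open import Algebra.Solver.Ring.NaturalCoefficients.Default commutativeSemiring using (solve; _:=_; _:+_; _:*_; con)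
    open import Relation.Binary.Reasoning.Setoid setoid

    infix 4 _∼_
    _∼_ : Carrier → Carrier → Set
    a ∼ b = ∃ λ c → a ≈ b + c * x

    lift : ∀ {a b} → a ≈ b → a ∼ b
    lift {a} {b} e = 0# , trans e (solve 2 (λ b x → b := b :+ con 0 :* x) refl b x)

    private
      undo : ∀ {a b} c → a ≈ b + c * x → b ≈ a + - c * x
      undo {a} {b} c e = sym (begin
        a + - c * x           ≈⟨ +-congʳ e ⟩
        b + c * x + - c * x   ≈⟨ solve 4 (λ b c x m → b :+ c :* x :+ m :* x := b :+ (c :+ m) :* x) refl b c x (- c) ⟩
        b + (c + - c) * x     ≈⟨ +-congˡ (*-congʳ (-‿inverseʳ c)) ⟩
        b + 0# * x            ≈⟨ solve 2 (λ b x → b :+ con 0 :* x := b) refl b x ⟩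
        b                     ∎)

      neg : ∀ {a b} c → a ≈ b + c * x → - a ≈ - b + - c * x
      neg {a} {b} c e = trans (-‿cong e) (trans (sym (-‿+-comm b (c * x))) (+-congˡ (-‿distribˡ-* c x)))
        where open import Algebra.Properties.Ring ring using (-‿+-comm; -‿distribˡ-*)

    quotient : Ring₀
    quotient = record
      { Carrier = Carrier ; _≈_ = _∼_ ; _+_ = _+_ ; _*_ = _*_ ; -_ = -_ ; 0# = 0# ; 1# = 1#
      ; isCommutativeRing = record
        { isRing = record
          { +-isAbelianGroup = record
            { isGroup = record
              { isMonoid = record
                { isSemigroup = record
                  { isMagma = record
                    { isEquivalence = record
                      { refl  = lift refl
                      ; sym   = λ (c , e) → - c , undo c e
                      ; trans = λ {a} {b} {d} (c , e) (c′ , e′) → c + c′ , trans e (trans (+-congʳ e′)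
                          (solve 4 (λ d c c′ x → d :+ c′ :* x :+ c :* x := d :+ (c :+ c′) :* x) refl d c c′ x))
                      }
                    ; ∙-cong = λ {a} {b} {a′} {b′} (c , e) (c′ , e′) → c + c′ , trans (+-cong e e′)
                        (solve 5 (λ b b′ c c′ x → b :+ c :* x :+ (b′ :+ c′ :* x) := b :+ b′ :+ (c :+ c′) :* x) refl b b′ c c′ x)
                    }
                  ; assoc = λ a b c → lift (+-assoc a b c)
                  }
                ; identity = (λ a → lift (+-identityˡ a)) , (λ a → lift (+-identityʳ a))
                }
              ; inverse = (λ a → lift (-‿inverseˡ a)) , (λ a → lift (-‿inverseʳ a))
              ; ⁻¹-cong = λ (c , e) → - c , neg c e
              }
            ; comm = λ a b → lift (+-comm a b)
            }
          ; *-cong = λ {a} {b} {a′} {b′} (c , e) (c′ , e′) → b * c′ + c * b′ + c * x * c′ , trans (*-cong e e′)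
              (solve 5 (λ b b′ c c′ x → (b :+ c :* x) :* (b′ :+ c′ :* x)
                := b :* b′ :+ (b :* c′ :+ c :* b′ :+ c :* x :* c′) :* x) refl b b′ c c′ x)
          ; *-assoc = λ a b c → lift (*-assoc a b c)
          ; *-identity = (λ a → lift (*-identityˡ a)) , (λ a → lift (*-identityʳ a))
          ; distrib = (λ a b c → lift (distribˡ a b c)) , (λ a b c → lift (distribʳ a b c))
          }
        ; *-comm = λ a b → lift (*-comm a b)
        }
      }

    project : RingHom A quotient
    project = record
      { fun = λ a → a ; cong = lift ; +-homo = λ _ _ → lift refl ; *-homo = λ _ _ → lift refl
      ; 0-homo = lift refl ; 1-homo = lift refl }

    x∼0 : x ∼ 0#
    x∼0 = 1# , solve 1 (λ x → x := con 0 :+ con 1 :* x) refl x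

  HasChar : ℕ → Ring₀ → Set
  HasChar p A = p ×ᴬ 1# ≈ 0#
    where
    open CommutativeRing A
    open Mult semiring using () renaming (_×_ to _×ᴬ_)

  hom-char : ∀ {p A B} → RingHom A B → HasChar p A → HasChar p B
  hom-char {p} {A} {B} h e = B.trans (B.sym (mult p)) (B.trans (H.cong e) H.0-homo)
    where
    module A = CommutativeRing A
    module B = CommutativeRing B
    module H = RingHom h
    open Mult A.semiring using () renaming (_×_ to _×ᴬ_)
    open Mult B.semiring using () renaming (_×_ to _×ᴮ_)
    mult : ∀ n → H.fun (n ×ᴬ A.1#) B.≈ n ×ᴮ B.1#
    mult zero    = H.0-homo
    mult (suc n) = B.trans (H.+-homo _ _) (B.+-cong H.1-homo (mult n))

  -- The enumeration may repeat elements, so a quotient keeps it unchanged while its equality gets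
  -- coarser.
  record FiniteRing (p : ℕ) : Set₁ where
    field
      R : Ring₀
    open CommutativeRing R public hiding (zero)
    field
      _≈?_   : ∀ x y → Dec (x ≈ y)
      size   : ℕ
      enum   : Fin size → Carrier
      covers : ∀ x → ∃ λ i → enum i ≈ x
      1≉0    : ¬ (1# ≈ 0#)
      char   : HasChar p R

  ind-mono : ∀ b c → (b ≡ true → c ≡ true) → ind b ≤ ind c
  ind-mono false c h = z≤n
  ind-mono true  c h rewrite h ≡.refl = s≤s z≤n

  cnt-mono-< : ∀ {n} (P Q : Fin n → Bool) i → (∀ j → P j ≡ true → Q j ≡ true) → P i ≡ false → Q i ≡ true → cnt P < cnt Q
  cnt-mono-< P Q zero h p q rewrite p | q = s≤s (sum-mono (λ j → ind-mono (P (suc j)) (Q (suc j)) (h (suc j))))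
  cnt-mono-< P Q (suc i) h p q =
    ℕₚ.+-mono-≤-< (ind-mono (P zero) (Q zero) (h zero)) (cnt-mono-< (P ∘ suc) (Q ∘ suc) i (h ∘ suc) p q)

  IsField : Ring₀ → Set
  IsField A = ∀ x → x ≈ 0# ⊎ ∃ λ y → x * y ≈ 1#
    where open CommutativeRing A

  module _ {p : ℕ} (A : FiniteRing p) where
    open FiniteRing A

    invertible? : ∀ i → Dec (∃ λ j → (enum i * enum j) ≈ 1#)
    invertible? i = any? λ j → (enum i * enum j) ≈? 1#

    stuck? : Dec (∃ λ i → ¬ (enum i ≈ 0#) × ¬ (∃ λ j → (enum i * enum j) ≈ 1#))
    stuck? = any? λ i → ¬? (enum i ≈? 0#) ×-dec ¬? (invertible? i)

  -- Instead of choosing a maximal ideal, nonzero elements without inverse are divided out one after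
  -- another. Such an element does not generate 1, so the quotient stays nontrivial, and the number
  -- of enumerated entries that are nonzero drops.
  maximal-quotient : ∀ {p} (A : FiniteRing p) →
    Σ (FiniteRing p) λ E → RingHom (FiniteRing.R A) (FiniteRing.R E) × IsField (FiniteRing.R E)
  maximal-quotient {p} A = go _ A ℕₚ.≤-refl
    where
    nonzeros : FiniteRing p → ℕ
    nonzeros A = cnt (λ i → not (does (enum i ≈? 0#)))
      where open FiniteRing A
    go : ∀ n (A : FiniteRing p) → nonzeros A ≤ n →
      Σ (FiniteRing p) λ E → RingHom (FiniteRing.R A) (FiniteRing.R E) × IsField (FiniteRing.R E)
    go n A bound with stuck? A
    ... | no none = A , id-hom , field′
      where
      open FiniteRing A
      field′ : IsField R
      field′ x with x ≈? 0#
      ... | yes e = inj₁ e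
      ... | no x≉0 with covers x
      ...   | i , ei with invertible? A i
      ...     | yes (j , e) = inj₂ (enum j , trans (*-congʳ (sym ei)) e)
      ...     | no ¬inv = ⊥-elim (none (i , (λ e → x≉0 (trans (sym ei) e)) , ¬inv))
    ... | yes (i , nz , ¬inv) = recurse n bound
      where
      open FiniteRing A
      open Quotient R (enum i)
      A′ : FiniteRing p
      A′ = record
        { R      = quotient
        ; _≈?_   = λ x y → map′ (λ (j , e) → enum j , e)
                     (λ (c , e) → let j , ej = covers c in j , trans e (+-congˡ (*-congʳ (sym ej))))
                     (any? λ j → x ≈? (y + enum j * enum i))
        ; size   = size
        ; enum   = enum
        ; covers = λ x → let j , e = covers x in j , lift e
        ; 1≉0    = λ (c , e) → let j , ej = covers c in
                     ¬inv (j , trans (*-congˡ ej) (trans (*-comm (enum i) c) (sym (trans e (+-identityˡ _)))))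
        ; char   = hom-char {p} project char
        }
      fewer : nonzeros A′ < nonzeros A
      fewer = cnt-mono-< _ _ i imp gone here
        where
        imp : ∀ j → not (does (FiniteRing._≈?_ A′ (enum j) 0#)) ≡ true → not (does (enum j ≈? 0#)) ≡ true
        imp j e with enum j ≈? 0#
        ... | no _  = ≡.refl
        ... | yes z with ≡.trans (≡.sym e) (≡.cong not (dec-true (FiniteRing._≈?_ A′ (enum j) 0#) (lift z)))
        ...   | ()
        gone : not (does (FiniteRing._≈?_ A′ (enum i) 0#)) ≡ false
        gone = ≡.cong not (dec-true (FiniteRing._≈?_ A′ (enum i) 0#) x∼0)
        here : not (does (enum i ≈? 0#)) ≡ true
        here = ≡.cong not (dec-false (enum i ≈? 0#) nz)
      recurse : ∀ n → nonzeros A ≤ n → Σ (FiniteRing p) λ E → RingHom R (FiniteRing.R E) × IsField (FiniteRing.R E)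
      recurse zero    le = ⊥-elim (ℕₚ.n≮0 (ℕₚ.≤-trans fewer le))
      recurse (suc n) le = let E , h , fld = go n A′ (ℕₚ.≤-pred (ℕₚ.≤-trans fewer le)) in E , (h ∘ʰ project) , fld

-- Adjoining roots of monic polynomials

module RingExtensions where

  open import Algebra.Bundles using (CommutativeRing)
  import Algebra.Construct.Pointwise as Pointwise
  open import Data.Nat using (ℕ; zero; suc; _≤_; s≤s; _^_)
  import Data.Nat.Properties as ℕₚ
  open import Data.Fin using (Fin; zero; suc; toℕ; fromℕ; inject₁; finToFun; funToFin)
  open import Data.Fin.Properties using (all?; finToFun-funToFin; toℕ-fromℕ)
  open import Data.Product using (_,_; proj₁; proj₂)
  open import Function using (_∘_)
  import Relation.Binary.PropositionalEquality as ≡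
  open ≡ using (_≡_)
  open FiniteRings

  module MonicPolynomials (A : Ring₀) where
    open CommutativeRing A hiding (zero)
    open import Algebra.Solver.Ring.NaturalCoefficients.Default commutativeSemiring using (solve; _:=_; _:+_; _:*_; con)
    open import Relation.Binary.Reasoning.Setoid setoid

    -- The value at y of X^n + c_{n-1} X^{n-1} + ... + c_0.
    monic : ∀ {n} → (Fin n → Carrier) → Carrier → Carrier
    monic {zero}  c y = 1#
    monic {suc n} c y = c zero + y * monic (c ∘ suc) y

    monic-cong : ∀ {n} {c c′ : Fin n → Carrier} {y y′} → (∀ i → c i ≈ c′ i) → y ≈ y′ → monic c y ≈ monic c′ y′
    monic-cong {zero}  h e = refl
    monic-cong {suc n} h e = +-cong (h zero) (*-cong e (monic-cong (h ∘ suc) e))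

    -- Synthetic division by X - x again. The leading 1 is implicit, so the quotient is monic of
    -- degree one less.
    divide : ∀ {n} → (Fin (suc n) → Carrier) → Carrier → Fin n → Carrier
    divide c x zero    = monic (c ∘ suc) x
    divide c x (suc i) = divide (c ∘ suc) x i

    divide-correct : ∀ {n} (c : Fin (suc n) → Carrier) x y →
      monic c y + x * monic (divide c x) y ≈ monic c x + y * monic (divide c x) y
    divide-correct {zero}  c x y = solve 3 (λ c x y → c :+ y :* con 1 :+ x :* con 1 := c :+ x :* con 1 :+ y :* con 1) refl (c zero) x y
    divide-correct {suc n} c x y = begin
      (c zero + y * H y) + x * (H x + y * K)  ≈⟨ solve 6 (λ b x y hy hx k → (b :+ y :* hy) :+ x :* (hx :+ y :* k)
                                                     := (b :+ x :* hx) :+ y :* (hy :+ x :* k)) refl (c zero) x y (H y) (H x) K ⟩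
      (c zero + x * H x) + y * (H y + x * K)  ≈⟨ +-congˡ (*-congˡ (divide-correct (c ∘ suc) x y)) ⟩
      (c zero + x * H x) + y * (H x + y * K)  ∎
      where
      H = monic (c ∘ suc)
      K = monic (divide (c ∘ suc) x) y

    prod : ∀ {n} → (Fin n → Carrier) → Carrier
    prod {zero}  f = 1#
    prod {suc n} f = f zero * prod (f ∘ suc)

  module _ {A B : Ring₀} (h : RingHom A B) where
    private
      module A = CommutativeRing A
      module B = CommutativeRing B
      module MA = MonicPolynomials A
      module MB = MonicPolynomials B
    open RingHom h

    monic-hom : ∀ {n} (c : Fin n → A.Carrier) y → fun (MA.monic c y) B.≈ MB.monic (fun ∘ c) (fun y)
    monic-hom {zero}  c y = 1-homo
    monic-hom {suc n} c y = B.trans (+-homo _ _) (B.+-congˡ (B.trans (*-homo _ _) (B.*-congˡ (monic-hom (c ∘ suc) y))))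

    divide-hom : ∀ {n} (c : Fin (suc n) → A.Carrier) x i → fun (MA.divide c x i) B.≈ MB.divide (fun ∘ c) (fun x) i
    divide-hom c x zero    = monic-hom (c ∘ suc) x
    divide-hom c x (suc i) = divide-hom (c ∘ suc) x i

  -- A[X]/(X^n + c_{n-1} X^{n-1} + ... + c_0) for n = suc n′, as the module Aⁿ on which X acts by the
  -- companion operator S; an element a is identified with the operator a(S), and a with a(S) e₀.
  module Extension (A : Ring₀) {n′ : ℕ} (c : Fin (suc n′) → CommutativeRing.Carrier A) where
    open CommutativeRing A hiding (zero)
    open MonicPolynomials A
    open import Algebra.Solver.Ring.NaturalCoefficients.Default commutativeSemiring using (solve; _:=_; _:+_; _:*_; con)
    open import Relation.Binary.Reasoning.Setoid setoid

    V : Set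
    V = Fin (suc n′) → Carrier

    infix 4 _≋_
    _≋_ : V → V → Set
    u ≋ v = ∀ i → u i ≈ v i

    infixl 6 _⊕_
    _⊕_ : V → V → V
    (u ⊕ v) i = u i + v i

    infixr 7 _·_
    _·_ : Carrier → V → V
    (s · v) i = s * v i

    shift : V → V
    shift v zero    = 0#
    shift v (suc i) = v (inject₁ i)

    last : V → Carrier
    last v = v (fromℕ n′)

    S : V → V
    S v i = shift v i + - c i * last v

    S-cong : ∀ {u v} → u ≋ v → S u ≋ S v
    S-cong h zero    = +-congˡ (*-congˡ (h (fromℕ n′)))
    S-cong h (suc i) = +-cong (h (inject₁ i)) (*-congˡ (h (fromℕ n′)))

    S-⊕ : ∀ u v → S (u ⊕ v) ≋ S u ⊕ S v
    S-⊕ u v zero    = solve 3 (λ d x y → con 0 :+ d :* (x :+ y) := con 0 :+ d :* x :+ (con 0 :+ d :* y)) refl (- c zero) (last u) (last v)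
    S-⊕ u v (suc i) = solve 5 (λ a b d x y → a :+ b :+ d :* (x :+ y) := a :+ d :* x :+ (b :+ d :* y)) refl
                        (u (inject₁ i)) (v (inject₁ i)) (- c (suc i)) (last u) (last v)

    S-· : ∀ s v → S (s · v) ≋ s · S v
    S-· s v zero    = solve 3 (λ s d x → con 0 :+ d :* (s :* x) := s :* (con 0 :+ d :* x)) refl s (- c zero) (last v)
    S-· s v (suc i) = solve 4 (λ s a d x → s :* a :+ d :* (s :* x) := s :* (a :+ d :* x)) refl s (v (inject₁ i)) (- c (suc i)) (last v)

    op : ∀ {r} → (Fin r → Carrier) → V → V
    op {zero}  a v = λ _ → 0#
    op {suc r} a v = a zero · v ⊕ S (op (a ∘ suc) v)

    op-cong : ∀ {r} {a b : Fin r → Carrier} {u v} → (∀ i → a i ≈ b i) → u ≋ v → op a u ≋ op b v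
    op-cong {zero}  ha hv i = refl
    op-cong {suc r} ha hv i = +-cong (*-cong (ha zero) (hv i)) (S-cong (op-cong (ha ∘ suc) hv) i)

    op-+ˡ : ∀ {r} (a b : Fin r → Carrier) v → op (λ i → a i + b i) v ≋ op a v ⊕ op b v
    op-+ˡ {zero}  a b v i = sym (+-identityˡ 0#)
    op-+ˡ {suc r} a b v i = begin
      (a zero + b zero) * v i + S (op (λ i → a (suc i) + b (suc i)) v) i
        ≈⟨ +-congˡ (trans (S-cong (op-+ˡ (a ∘ suc) (b ∘ suc) v) i) (S-⊕ (op (a ∘ suc) v) (op (b ∘ suc) v) i)) ⟩
      (a zero + b zero) * v i + (S (op (a ∘ suc) v) i + S (op (b ∘ suc) v) i)
        ≈⟨ solve 5 (λ a b v x y → (a :+ b) :* v :+ (x :+ y) := a :* v :+ x :+ (b :* v :+ y)) refl (a zero) (b zero) (v i) _ _ ⟩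
      op a v i + op b v i ∎

    op-⊕ʳ : ∀ {r} (a : Fin r → Carrier) u v → op a (u ⊕ v) ≋ op a u ⊕ op a v
    op-⊕ʳ {zero}  a u v i = sym (+-identityˡ 0#)
    op-⊕ʳ {suc r} a u v i = begin
      a zero * (u i + v i) + S (op (a ∘ suc) (u ⊕ v)) i
        ≈⟨ +-congˡ (trans (S-cong (op-⊕ʳ (a ∘ suc) u v) i) (S-⊕ (op (a ∘ suc) u) (op (a ∘ suc) v) i)) ⟩
      a zero * (u i + v i) + (S (op (a ∘ suc) u) i + S (op (a ∘ suc) v) i)
        ≈⟨ solve 5 (λ a u v x y → a :* (u :+ v) :+ (x :+ y) := a :* u :+ x :+ (a :* v :+ y)) refl (a zero) (u i) (v i) _ _ ⟩
      op a u i + op a v i ∎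

    S-0 : S (λ _ → 0#) ≋ (λ _ → 0#)
    S-0 zero    = solve 1 (λ d → con 0 :+ d :* con 0 := con 0) refl (- c zero)
    S-0 (suc i) = solve 1 (λ d → con 0 :+ d :* con 0 := con 0) refl (- c (suc i))

    op-·ˡ : ∀ {r} s (a : Fin r → Carrier) v → op (λ i → s * a i) v ≋ s · op a v
    op-·ˡ {zero}  s a v i = sym (zeroʳ s)
    op-·ˡ {suc r} s a v i = begin
      s * a zero * v i + S (op (λ i → s * a (suc i)) v) i
        ≈⟨ +-congˡ (trans (S-cong (op-·ˡ s (a ∘ suc) v) i) (S-· s (op (a ∘ suc) v) i)) ⟩
      s * a zero * v i + s * S (op (a ∘ suc) v) i
        ≈⟨ solve 4 (λ s a v x → s :* a :* v :+ s :* x := s :* (a :* v :+ x)) refl s (a zero) (v i) _ ⟩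
      s * op a v i ∎

    op-·ʳ : ∀ {r} s (a : Fin r → Carrier) v → op a (s · v) ≋ s · op a v
    op-·ʳ {zero}  s a v i = sym (zeroʳ s)
    op-·ʳ {suc r} s a v i = begin
      a zero * (s * v i) + S (op (a ∘ suc) (s · v)) i
        ≈⟨ +-congˡ (trans (S-cong (op-·ʳ s (a ∘ suc) v) i) (S-· s (op (a ∘ suc) v) i)) ⟩
      a zero * (s * v i) + s * S (op (a ∘ suc) v) i
        ≈⟨ solve 4 (λ s a v x → a :* (s :* v) :+ s :* x := s :* (a :* v :+ x)) refl s (a zero) (v i) _ ⟩
      s * op a v i ∎

    op-S : ∀ {r} (a : Fin r → Carrier) v → op a (S v) ≋ S (op a v)
    op-S {zero}  a v i = sym (S-0 i)
    op-S {suc r} a v i = begin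
      a zero * S v i + S (op (a ∘ suc) (S v)) i           ≈⟨ +-cong (sym (S-· (a zero) v i)) (S-cong (op-S (a ∘ suc) v) i) ⟩
      S (a zero · v) i + S (S (op (a ∘ suc) v)) i         ≈⟨ S-⊕ (a zero · v) (S (op (a ∘ suc) v)) i ⟨
      S (op a v) i                                        ∎

    op-comm : ∀ {r r′} (a : Fin r → Carrier) (b : Fin r′ → Carrier) v → op a (op b v) ≋ op b (op a v)
    op-comm {zero}  a b v i = sym (zeros b i)
      where
      zeros : ∀ {r} (b : Fin r → Carrier) → op b (λ _ → 0#) ≋ (λ _ → 0#)
      zeros {zero}  b i = refl
      zeros {suc r} b i = trans (+-cong (zeroʳ _) (trans (S-cong (zeros (b ∘ suc)) i) (S-0 i))) (+-identityˡ 0#)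
    op-comm {suc r} a b v i = begin
      a zero * op b v i + S (op (a ∘ suc) (op b v)) i
        ≈⟨ +-cong (sym (op-·ʳ (a zero) b v i)) (trans (S-cong (op-comm (a ∘ suc) b v) i) (sym (op-S b (op (a ∘ suc) v) i))) ⟩
      op b (a zero · v) i + op b (S (op (a ∘ suc) v)) i
        ≈⟨ op-⊕ʳ b (a zero · v) (S (op (a ∘ suc) v)) i ⟨
      op b (op a v) i ∎

    e₀ : V
    e₀ zero    = 1#
    e₀ (suc _) = 0#

    private
      nth : ∀ {r m} → (Fin r → Carrier) → Fin m → Carrier
      nth {zero}  a i       = 0#
      nth {suc r} a zero    = a zero
      nth {suc r} a (suc i) = nth (a ∘ suc) i

      nth-full : ∀ {r} (a : Fin r → Carrier) i → nth a i ≡ a i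
      nth-full {suc r} a zero    = ≡.refl
      nth-full {suc r} a (suc i) = nth-full (a ∘ suc) i

      nth-inject₁ : ∀ {r m} (a : Fin r → Carrier) (i : Fin m) → nth a (inject₁ i) ≡ nth a i
      nth-inject₁ {zero}  a i       = ≡.refl
      nth-inject₁ {suc r} a zero    = ≡.refl
      nth-inject₁ {suc r} a (suc i) = nth-inject₁ (a ∘ suc) i

      nth-beyond : ∀ {r m} (a : Fin r → Carrier) (i : Fin m) → r ≤ toℕ i → nth a i ≡ 0#
      nth-beyond {zero}  a i       l       = ≡.refl
      nth-beyond {suc r} a (suc i) (s≤s l) = nth-beyond (a ∘ suc) i l

      -- As long as the degree stays below n, the last coordinate is zero before each application of
      -- S, so S only shifts. The function `nth` pads the coefficients with zeros.
      op-nth : ∀ {r} (a : Fin r → Carrier) → r ≤ suc n′ → ∀ i → op a e₀ i ≈ nth a i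
      op-nth {zero}  a l i = refl
      op-nth {suc r} a (s≤s l) i = go i
        where
        v = op (a ∘ suc) e₀
        v-last : last v ≈ 0#
        v-last = trans (op-nth (a ∘ suc) (ℕₚ.m≤n⇒m≤1+n l) (fromℕ n′))
          (reflexive (nth-beyond (a ∘ suc) (fromℕ n′) (ℕₚ.≤-trans l (ℕₚ.≤-reflexive (≡.sym (toℕ-fromℕ n′))))))
        go : ∀ i → a zero * e₀ i + S v i ≈ nth a i
        go zero = trans (+-congˡ (+-congˡ (*-congˡ v-last)))
          (solve 2 (λ a d → a :* con 1 :+ (con 0 :+ d :* con 0) := a) refl (a zero) (- c zero))
        go (suc i) = trans (+-congˡ (+-cong (trans (op-nth (a ∘ suc) (ℕₚ.m≤n⇒m≤1+n l) (inject₁ i)) (reflexive (nth-inject₁ (a ∘ suc) i))) (*-congˡ v-last)))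
          (solve 3 (λ a x d → a :* con 0 :+ (x :+ d :* con 0) := x) refl (a zero) (nth (a ∘ suc) i) (- c (suc i)))

    op-e₀ : ∀ (a : V) → op a e₀ ≋ a
    op-e₀ a i = trans (op-nth a ℕₚ.≤-refl i) (reflexive (nth-full a i))

    -- Both sides are the commuting operators a(S) and b(S) applied to e₀. Associativity follows
    -- from the same commutation.
    *ᵛ-comm : ∀ (a b : V) → op a b ≋ op b a
    *ᵛ-comm a b i = begin
      op a b i           ≈⟨ op-cong {a = a} {a} (λ _ → refl) (op-e₀ b) i ⟨
      op a (op b e₀) i   ≈⟨ op-comm a b e₀ i ⟩
      op b (op a e₀) i   ≈⟨ op-cong {a = b} {b} (λ _ → refl) (op-e₀ a) i ⟩
      op b a i           ∎

    *ᵛ-assoc : ∀ (a b d : V) → op (op a b) d ≋ op a (op b d)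
    *ᵛ-assoc a b d i = begin
      op (op a b) d i    ≈⟨ *ᵛ-comm (op a b) d i ⟩
      op d (op a b) i    ≈⟨ op-comm d a b i ⟩
      op a (op d b) i    ≈⟨ op-cong {a = a} {a} (λ _ → refl) (*ᵛ-comm d b) i ⟩
      op a (op b d) i    ∎

    extension : Ring₀
    extension = record
      { Carrier = V ; _≈_ = _≋_ ; _+_ = _⊕_ ; _*_ = op ; -_ = λ v i → - v i ; 0# = λ _ → 0# ; 1# = e₀
      ; isCommutativeRing = record
        { isRing = record
          { +-isAbelianGroup = Pointwise.isAbelianGroup (Fin (suc n′)) +-isAbelianGroup
          ; *-cong     = op-cong
          ; *-assoc    = *ᵛ-assoc
          ; *-identity = (λ a i → trans (*ᵛ-comm e₀ a i) (op-e₀ a i)) , op-e₀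
          ; distrib    = op-⊕ʳ , (λ a b d → op-+ˡ b d a)
          }
        ; *-comm = *ᵛ-comm
        }
      }

    private module B = CommutativeRing extension

    scalar : ∀ s v → op (s · e₀) v ≋ s · v
    scalar s v i = trans (op-·ˡ s e₀ v i) (*-congˡ (B.*-identityˡ v i))

    embed : RingHom A extension
    embed = record
      { fun    = _· e₀
      ; cong   = λ e i → *-congʳ e
      ; +-homo = λ x y i → distribʳ (e₀ i) x y
      ; *-homo = λ x y i → trans (*-assoc x y (e₀ i)) (sym (scalar x (y · e₀) i))
      ; 0-homo = λ i → zeroˡ (e₀ i)
      ; 1-homo = λ i → *-identityˡ (e₀ i)
      }

    X̄ : V
    X̄ = S e₀

    X̄-mult : ∀ v → op X̄ v ≋ S v
    X̄-mult v i = trans (*ᵛ-comm X̄ v i) (trans (op-S v e₀ i) (S-cong (op-e₀ v) i))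

    private
      snoc : ∀ {r} → (Fin r → Carrier) → Fin (suc r) → Carrier
      snoc {zero}  a _       = 1#
      snoc {suc r} a zero    = a zero
      snoc {suc r} a (suc i) = snoc (a ∘ suc) i

      snoc-inject₁ : ∀ {r} (a : Fin r → Carrier) i → snoc a (inject₁ i) ≡ a i
      snoc-inject₁ {suc r} a zero    = ≡.refl
      snoc-inject₁ {suc r} a (suc i) = snoc-inject₁ (a ∘ suc) i

      snoc-last : ∀ {r} (a : Fin r → Carrier) → snoc a (fromℕ r) ≡ 1#
      snoc-last {zero}  a = ≡.refl
      snoc-last {suc r} a = snoc-last (a ∘ suc)

      monic-op : ∀ {r} (a : Fin r → Carrier) → MonicPolynomials.monic extension (λ i → a i · e₀) X̄ ≋ op (snoc a) e₀
      monic-op {zero}  a i = sym (trans (+-congˡ (S-0 i)) (solve 1 (λ e → con 1 :* e :+ con 0 := e) refl (e₀ i)))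
      monic-op {suc r} a i = +-congˡ (trans (X̄-mult _ i) (S-cong (monic-op (a ∘ suc)) i))

    -- The polynomial is c₀ + X · h, where h is the vector (c₁, ..., c_{n-1}, 1). S shifts h up and
    -- turns its last entry 1 into -c, which cancels all coefficients.
    X̄-root : MonicPolynomials.monic extension (λ i → c i · e₀) X̄ ≋ (λ _ → 0#)
    X̄-root i = trans (monic-op c i) (trans (+-congˡ (S-cong (op-e₀ (snoc (c ∘ suc))) i)) (go i))
      where
      go : ∀ i → c zero * e₀ i + S (snoc (c ∘ suc)) i ≈ 0#
      cancel : ∀ i → c i + - c i * snoc (c ∘ suc) (fromℕ n′) ≈ 0#
      cancel i = trans (+-congˡ (trans (*-congˡ (reflexive (snoc-last (c ∘ suc)))) (*-identityʳ (- c i)))) (-‿inverseʳ (c i))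
      go zero    = trans (solve 2 (λ a b → a :* con 1 :+ (con 0 :+ b) := a :+ b) refl (c zero) _) (cancel zero)
      go (suc i) = trans (+-congˡ (+-congʳ (reflexive (snoc-inject₁ (c ∘ suc) i))))
        (trans (solve 3 (λ a x b → a :* con 0 :+ (x :+ b) := x :+ b) refl (c zero) (c (suc i)) _) (cancel (suc i)))

  extendFinite : ∀ {p} (A : FiniteRing p) {n′ : ℕ} (c : Fin (suc n′) → FiniteRing.Carrier A) → FiniteRing p
  extendFinite {p} A {n′} c = record
    { R      = extension
    ; _≈?_   = λ u v → all? λ i → u i ≈? v i
    ; size   = size ^ suc n′
    ; enum   = λ j i → enum (finToFun j i)
    ; covers = λ v → funToFin (λ i → proj₁ (covers (v i))) ,
        λ i → trans (reflexive (≡.cong enum (finToFun-funToFin (λ i → proj₁ (covers (v i))) i))) (proj₂ (covers (v i)))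
    ; 1≉0    = λ h → 1≉0 (h zero)
    ; char   = hom-char {p} embed char
    }
    where
    open FiniteRing A
    open Extension R c

  record Splitting {p : ℕ} (A : FiniteRing p) {n : ℕ} (c : Fin n → FiniteRing.Carrier A) : Set₁ where
    field
      B      : FiniteRing p
      φ      : RingHom (FiniteRing.R A) (FiniteRing.R B)
      roots  : Fin n → FiniteRing.Carrier B
      -- Quantifying over all B-algebras expresses an identity of polynomials.
      splits : ∀ (C : Ring₀) (ψ : RingHom (FiniteRing.R B) C) y → let open CommutativeRing C hiding (zero) in
               MonicPolynomials.monic C (λ i → RingHom.fun ψ (RingHom.fun φ (c i))) y
               ≈ MonicPolynomials.prod C (λ i → y + - RingHom.fun ψ (roots i))

  -- The root X̄ is adjoined for the whole polynomial, without an irreducible factor, and the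
  -- quotient by X - X̄ is split next. The rings on the way may have zero divisors; a field is
  -- obtained only at the end by `maximal-quotient`.
  split : ∀ {p} (A : FiniteRing p) n (c : Fin n → FiniteRing.Carrier A) → Splitting A c
  split A zero c = record { B = A ; φ = id-hom ; roots = λ () ; splits = λ C ψ y → CommutativeRing.refl C }
  split {p} A (suc n) c = record
    { B      = IH.B
    ; φ      = IH.φ ∘ʰ embed
    ; roots  = roots
    ; splits = splits
    }
    where
    open FiniteRing A using (R)
    open Extension R c
    A₁ : FiniteRing p
    A₁ = extendFinite A c
    c₁ : Fin n → V
    c₁ = MonicPolynomials.divide extension (λ i → RingHom.fun embed (c i)) X̄
    module IH = Splitting (split A₁ n c₁)
    roots : Fin (suc n) → FiniteRing.Carrier IH.B
    roots zero    = RingHom.fun IH.φ X̄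
    roots (suc i) = IH.roots i
    splits : ∀ (C : Ring₀) (ψ : RingHom (FiniteRing.R IH.B) C) y → let open CommutativeRing C hiding (zero) in
      MonicPolynomials.monic C (λ i → RingHom.fun ψ (RingHom.fun IH.φ (RingHom.fun embed (c i)))) y
      ≈ MonicPolynomials.prod C (λ i → y + - RingHom.fun ψ (roots i))
    splits C ψ y = begin
      monic cC y                               ≈⟨ factor ⟩
      (y + - xC) * monic (divide cC xC) y      ≈⟨ *-congˡ (monic-cong (λ i → sym (divide-hom χ (λ i → RingHom.fun embed (c i)) X̄ i)) refl) ⟩
      (y + - xC) * monic (λ i → RingHom.fun χ (c₁ i)) y ≈⟨ *-congˡ (IH.splits C ψ y) ⟩
      (y + - xC) * prod (λ i → y + - RingHom.fun ψ (IH.roots i)) ∎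
      where
      open CommutativeRing C hiding (zero)
      open MonicPolynomials C
      open import Relation.Binary.Reasoning.Setoid setoid
      open import Algebra.Solver.Ring.NaturalCoefficients.Default commutativeSemiring using (solve; _:=_; _:+_; _:*_; con)
      open import Algebra.Properties.Ring ring using (+-cancelʳ)
      χ : RingHom extension C
      χ = ψ ∘ʰ IH.φ
      cC : Fin (suc n) → Carrier
      cC i = RingHom.fun χ (RingHom.fun embed (c i))
      xC : Carrier
      xC = RingHom.fun χ X̄
      root : monic cC xC ≈ 0#
      root = trans (sym (monic-hom χ (λ i → RingHom.fun embed (c i)) X̄)) (trans (RingHom.cong χ X̄-root) (RingHom.0-homo χ))
      K = monic (divide cC xC) y
      factor : monic cC y ≈ (y + - xC) * K
      factor = +-cancelʳ (xC * K) _ _ (begin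
        monic cC y + xC * K            ≈⟨ divide-correct cC xC y ⟩
        monic cC xC + y * K            ≈⟨ +-congʳ root ⟩
        0# + y * K                     ≈⟨ solve 2 (λ y K → con 0 :+ y :* K := y :* K :+ con 0 :* K) refl y K ⟩
        y * K + 0# * K                 ≈⟨ +-congˡ (*-congʳ (-‿inverseʳ xC)) ⟨
        y * K + (xC + - xC) * K        ≈⟨ solve 4 (λ y K x m → y :* K :+ (x :+ m) :* K := (y :+ m) :* K :+ x :* K) refl y K xC (- xC) ⟩
        (y + - xC) * K + xC * K        ∎)

-- Prime characteristic and the Frobenius map

module Characteristic where

  open import Algebra.Bundles using (CommutativeRing)
  open import Data.Nat as ℕ using (ℕ; zero; suc; _<_; z≤n; s≤s; _∸_; _!)
  import Data.Nat.Properties as ℕₚ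
  import Data.Nat.Divisibility as ℕᵈ
  open import Data.Nat.DivMod using (m/n*n≡m)
  open import Data.Nat.Combinatorics using (_C_; nCk≡n!/k![n-k]!; k![n∸k]!∣n!; nCn≡1)
  open import Data.Nat.Primality using (Prime; euclidsLemma; prime⇒nonTrivial; prime⇒nonZero)
  open import Data.Integer as ℤ using (ℤ; +_)
  import Data.Integer.Properties as ℤₚ
  import Data.Integer.Divisibility.Signed as ℤᵈ
  open import Data.Integer.DivMod using (_%ℕ_; _/ℕ_; a≡a%ℕn+[a/ℕn]*n; n%ℕd<d)
  open import Data.Fin using (Fin; zero; suc; toℕ; fromℕ; fromℕ<; inject₁)
  open import Data.Fin.Properties using (toℕ-fromℕ<; toℕ-fromℕ; toℕ-inject₁; toℕ<n)
  open import Data.Product using (_,_)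
  open import Data.Sum using (inj₁; inj₂)
  open import Data.Empty using (⊥-elim)
  open import Relation.Nullary using (¬_)
  open import Relation.Nullary.Decidable using (map′)
  import Relation.Binary.PropositionalEquality as ≡
  open ≡ using (_≡_)
  open FiniteRings
  open RingExtensions

  prime∤! : ∀ {p} → Prime p → ∀ k → k < p → ¬ (p ℕᵈ.∣ k !)
  prime∤! {p} pp zero    k<p d = ℕₚ.<⇒≢ (ℕ.nonTrivial⇒n>1 p {{prime⇒nonTrivial pp}}) (≡.sym (ℕᵈ.∣1⇒≡1 d))
  prime∤! {p} pp (suc k) k<p d with euclidsLemma (suc k) (k !) pp d
  ... | inj₁ d₁ = ℕₚ.<⇒≱ k<p (ℕᵈ.∣⇒≤ d₁)
  ... | inj₂ d₂ = prime∤! pp k (ℕₚ.<-trans (ℕₚ.n<1+n k) k<p) d₂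

  -- The prime p divides p!, but neither k! nor (p - k)!, so it remains in the quotient.
  prime∣C : ∀ {p k} → Prime p → 0 < k → k < p → p ℕᵈ.∣ (p C k)
  prime∣C {p@(suc p′)} {k@(suc k′)} pp _ k<p with euclidsLemma (p C k) (k ! ℕ.* (p ∸ k) !) pp p∣
    where
    k≤p = ℕₚ.<⇒≤ k<p
    instance _ = k ℕₚ.!* (p ∸ k) !≢0
    p∣ : p ℕᵈ.∣ (p C k) ℕ.* (k ! ℕ.* (p ∸ k) !)
    p∣ = ≡.subst (p ℕᵈ.∣_) (≡.sym (≡.trans (≡.cong (ℕ._* (k ! ℕ.* (p ∸ k) !)) (nCk≡n!/k![n-k]! k≤p)) (m/n*n≡m (k![n∸k]!∣n! k≤p))))
           (ℕᵈ.m∣m*n (p′ !))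
  ... | inj₁ d = d
  ... | inj₂ d with euclidsLemma (k !) ((p ∸ k) !) pp d
  ...   | inj₁ d₁ = ⊥-elim (prime∤! pp k k<p d₁)
  ...   | inj₂ d₂ = ⊥-elim (prime∤! pp (p ∸ k) (ℕₚ.∸-monoʳ-< (s≤s z≤n) (ℕₚ.<⇒≤ k<p)) d₂)

  module Frobenius {p : ℕ} (pp : Prime p) (A : Ring₀) (char : HasChar p A) where
    open CommutativeRing A hiding (zero)
    open import Algebra.Properties.Semiring.Exp semiring using (_^_; ^-congˡ; ^-congʳ; ^-assocʳ)
    open import Algebra.Properties.Semiring.Mult semiring using (×-congʳ; ×-assoc-*; ×-assocˡ; ×-congˡ) renaming (_×_ to _×ᴬ_)
    open import Algebra.Properties.Semiring.Sum semiring using (sum; sum-cong-≋; sum-replicate-zero; sum-init-last)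
    open import Algebra.Properties.CommutativeSemiring.Binomial commutativeSemiring using (theorem; binomialTerm)
    open import Algebra.Solver.Ring.NaturalCoefficients.Default commutativeSemiring using (solve; _:=_; _:+_; _:*_; con)
    open import Relation.Binary.Reasoning.Setoid setoid

    private
      multiple : ∀ {n} → p ℕᵈ.∣ n → ∀ z → n ×ᴬ z ≈ 0#
      multiple (ℕᵈ.divides d ≡.refl) z = trans (sym (×-assocˡ z d p)) (trans (×-congʳ d pz) (zeros d))
        where
        pz : p ×ᴬ z ≈ 0#
        pz = trans (×-congʳ p (sym (*-identityˡ z))) (trans (sym (×-assoc-* p 1# z)) (trans (*-congʳ char) (zeroˡ z)))
        zeros : ∀ d → d ×ᴬ 0# ≈ 0#
        zeros zero    = refl
        zeros (suc d) = trans (+-identityˡ _) (zeros d)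

      frobenius₁ : ∀ q → p ≡ suc q → ∀ x y → (x + y) ^ p ≈ x ^ p + y ^ p
      frobenius₁ q ≡.refl x y = begin
        (x + y) ^ p                              ≈⟨ theorem p x y ⟩
        t zero + sum {suc q} (λ k → t (suc k))   ≈⟨ +-congˡ (sum-init-last (λ k → t (suc k))) ⟩
        t zero + (sum {q} (λ k → t (suc (inject₁ k))) + t (suc (fromℕ q)))
          ≈⟨ +-cong first (+-cong (trans (sum-cong-≋ middle) (sum-replicate-zero q)) final) ⟩
        y ^ p + (0# + x ^ p)                     ≈⟨ solve 2 (λ x y → y :+ (con 0 :+ x) := x :+ y) refl (x ^ p) (y ^ p) ⟩
        x ^ p + y ^ p                            ∎
        where
        t : Fin (suc p) → Carrier
        t = binomialTerm x y p
        first : t zero ≈ y ^ p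
        first = solve 1 (λ y → con 1 :* y :+ con 0 := y) refl (y ^ p)
        middle : ∀ k → t (suc (inject₁ k)) ≈ 0#
        middle k = multiple (prime∣C pp (s≤s z≤n) (s≤s (ℕₚ.<-≤-trans (ℕₚ.≤-reflexive (≡.cong suc (toℕ-inject₁ k))) (toℕ<n k)))) _
        final : t (suc (fromℕ q)) ≈ x ^ p
        final = trans (×-congˡ {x ^ toℕ (suc (fromℕ q)) * y ^ (p ∸ toℕ (suc (fromℕ q)))}
                        (≡.trans (≡.cong (p C_) e) (nCn≡1 p)))
          (trans (+-identityʳ _) (trans (*-cong (^-congʳ x e) (^-congʳ y (≡.trans (≡.cong (p ∸_) e) (ℕₚ.n∸n≡0 p)))) (*-identityʳ _)))
          where
          e : toℕ (suc (fromℕ q)) ≡ p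
          e = ≡.cong suc (toℕ-fromℕ q)

    frobenius : ∀ m x y → (x + y) ^ (p ℕ.^ m) ≈ x ^ (p ℕ.^ m) + y ^ (p ℕ.^ m)
    frobenius zero    x y = solve 2 (λ x y → (x :+ y) :* con 1 := x :* con 1 :+ y :* con 1) refl x y
    frobenius (suc m) x y = begin
      (x + y) ^ (p ℕ.* P)            ≈⟨ ^-assocʳ (x + y) p P ⟨
      ((x + y) ^ p) ^ P              ≈⟨ ^-congˡ P (frobenius₁ (ℕ.pred p) (≡.sym (ℕₚ.suc-pred p {{prime⇒nonZero pp}})) x y) ⟩
      (x ^ p + y ^ p) ^ P            ≈⟨ frobenius m (x ^ p) (y ^ p) ⟩
      (x ^ p) ^ P + (y ^ p) ^ P      ≈⟨ +-cong (^-assocʳ x p P) (^-assocʳ y p P) ⟩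
      x ^ (p ℕ.* P) + y ^ (p ℕ.* P)  ∎
      where P = p ℕ.^ m

  primeRing : ∀ {p} → Prime p → FiniteRing p
  primeRing {p} pp = record
    { R      = quotient
    ; _≈?_   = λ a b → map′ (λ (ℤᵈ.divides c e) → c , back a b e) (λ (c , e) → ℤᵈ.divides c (forth a b e)) (+ p ℤᵈ.∣? (a ℤ.- b))
    ; size   = p
    ; enum   = λ i → + toℕ i
    ; covers = λ a → fromℕ< (n%ℕd<d a p) , ℤ.- (a /ℕ p) ,
        (≡.trans (≡.cong +_ (toℕ-fromℕ< (n%ℕd<d a p))) (residue a))
    ; 1≉0    = λ (c , e) → ℕₚ.<⇒≢ (ℕ.nonTrivial⇒n>1 p {{prime⇒nonTrivial pp}})
        (≡.sym (ℕᵈ.∣1⇒≡1 (ℤᵈ.∣⇒∣ᵤ {+ p} {+ 1} (ℤᵈ.divides c (≡.trans e (ℤₚ.+-identityˡ _))))))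
    ; char   = + 1 , ≡.trans (mult p) (≡.sym (≡.trans (ℤₚ.+-identityˡ _) (ℤₚ.*-identityˡ (+ p))))
    }
    where
    instance _ = prime⇒nonZero pp
    open Quotient ℤₚ.+-*-commutativeRing (+ p)
    open import Data.Integer.Solver using (module +-*-Solver)
    open +-*-Solver
    open import Algebra.Properties.Semiring.Mult (CommutativeRing.semiring quotient) using () renaming (_×_ to _×ᴬ_)
    open ≡ using (refl)
    back : ∀ a b {d} → a ℤ.- b ≡ d → a ≡ b ℤ.+ d
    back a b refl = solve 2 (λ a b → a := b :+ (a :- b)) refl a b
    forth : ∀ a b {d} → a ≡ b ℤ.+ d → a ℤ.- b ≡ d
    forth a b {d} refl = solve 2 (λ b d → (b :+ d) :- b := d) refl b d
    residue : ∀ a → + (a %ℕ p) ≡ a ℤ.+ (ℤ.- (a /ℕ p)) ℤ.* + p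
    residue a = ≡.sym (≡.trans (≡.cong (λ x → x ℤ.+ (ℤ.- (a /ℕ p)) ℤ.* + p) (a≡a%ℕn+[a/ℕn]*n a p))
      (solve 3 (λ r d p → (r :+ d :* p) :+ (:- d) :* p := r) refl (+ (a %ℕ p)) (a /ℕ p) (+ p)))
    mult : ∀ n → n ×ᴬ (+ 1) ≡ + n
    mult zero    = refl
    mult (suc n) = ≡.cong (λ x → (+ 1) ℤ.+ x) (mult n)

-- Fields of prime power order

module GaloisFields where

  open import Algebra.Bundles using (CommutativeRing; RawRing)
  open import Algebra.Morphism.Structures using (module RingMorphisms)
  import Algebra.Morphism.RingMonomorphism as Mono
  import Algebra.Properties.Semiring.Exp as Exp
  open import Data.Nat as ℕ using (ℕ; zero; suc; _≤_; z≤n; s≤s)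
  import Data.Nat.Properties as ℕₚ
  open import Data.Nat.Primality using (Prime; prime⇒nonTrivial)
  open import Data.Fin using (Fin; zero; suc; _≟_)
  open import Data.Product using (∃; _,_; proj₁; proj₂)
  open import Data.Sum as Sum using (_⊎_; inj₁; inj₂)
  open import Data.Empty using (⊥-elim)
  open import Function using (_∘_)
  open import Relation.Nullary using (¬_; yes; no)
  import Relation.Binary.PropositionalEquality as ≡
  open ≡ using (_≡_; _≢_)
  open PolynomialFunctions using (FiniteDomain)
  open FiniteRings
  open RingExtensions
  open Characteristic

  module Products (A : Ring₀) where
    open CommutativeRing A hiding (zero)
    open MonicPolynomials A using (prod)
    open import Algebra.Solver.Ring.NaturalCoefficients.Default commutativeSemiring using (solve; _:=_; _:+_; _:*_; con)

    prod-factor : ∀ {n} (f : Fin n → Carrier) i → ∃ λ r → prod f ≈ f i * r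
    prod-factor f zero    = prod (f ∘ suc) , refl
    prod-factor f (suc i) = let r , e = prod-factor (f ∘ suc) i in f zero * r ,
      trans (*-congˡ e) (solve 3 (λ a b r → a :* (b :* r) := b :* (a :* r)) refl (f zero) (f (suc i)) r)

    prod-zero : ∀ {n} (f : Fin n → Carrier) i → f i ≈ 0# → prod f ≈ 0#
    prod-zero f i e = let r , e′ = prod-factor f i in trans e′ (trans (*-congʳ e) (zeroˡ r))

    prod-pair : ∀ {n} (f : Fin n → Carrier) i j → i ≢ j → f i * f j ≈ 0# → prod f ≈ 0#
    prod-pair f zero zero i≢j e = ⊥-elim (i≢j ≡.refl)
    prod-pair f zero (suc j) i≢j e = let r , e′ = prod-factor (f ∘ suc) j in
      trans (*-congˡ e′) (trans (sym (*-assoc _ _ r)) (trans (*-congʳ e) (zeroˡ r)))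
    prod-pair f (suc i) zero i≢j e = let r , e′ = prod-factor (f ∘ suc) i in
      trans (*-congˡ e′) (trans (sym (*-assoc _ _ r)) (trans (*-congʳ (trans (*-comm _ _) e)) (zeroˡ r)))
    prod-pair f (suc i) (suc j) i≢j e = trans (*-congˡ (prod-pair (f ∘ suc) i j (i≢j ∘ ≡.cong suc) e)) (zeroʳ _)

    module _ (fld : IsField A) where
      cancel-nonzero : ∀ {x y} → x * y ≈ 0# → x ≈ 0# ⊎ y ≈ 0#
      cancel-nonzero {x} {y} e with fld x
      ... | inj₁ z       = inj₁ z
      ... | inj₂ (x⁻¹ , i) = inj₂ (trans (trans (sym (*-identityˡ y)) (*-congʳ (sym i)))
              (trans (solve 3 (λ x z y → (x :* z) :* y := z :* (x :* y)) refl x x⁻¹ y) (trans (*-congˡ e) (zeroʳ x⁻¹))))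

      prod-zero⁻¹ : ¬ (1# ≈ 0#) → ∀ {n} (f : Fin n → Carrier) → prod f ≈ 0# → ∃ λ i → f i ≈ 0#
      prod-zero⁻¹ 1≉0 {zero}  f e = ⊥-elim (1≉0 e)
      prod-zero⁻¹ 1≉0 {suc n} f e with cancel-nonzero e
      ... | inj₁ z = zero , z
      ... | inj₂ z = let i , e′ = prod-zero⁻¹ 1≉0 (f ∘ suc) z in suc i , e′

  hom-neg1 : ∀ {A B} (h : RingHom A B) → let open CommutativeRing B in
    RingHom.fun h (CommutativeRing.-_ A (CommutativeRing.1# A)) ≈ - 1#
  hom-neg1 {A} {B} h = inverseʳ-unique B.1# _ (B.trans (B.+-congʳ (B.sym 1-homo))
      (B.trans (B.sym (+-homo A.1# (A.- A.1#))) (B.trans (cong (A.-‿inverseʳ A.1#)) 0-homo)))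
    where
    module A = CommutativeRing A
    module B = CommutativeRing B
    open RingHom h
    open import Algebra.Properties.Group B.+-group using (inverseʳ-unique)

  module _ (q″ : ℕ) where

    -- The lower coefficients of X^q − X, q = q″ + 2.
    coeffs : (A : Ring₀) → Fin (suc (suc q″)) → CommutativeRing.Carrier A
    coeffs A zero          = CommutativeRing.0# A
    coeffs A (suc zero)    = CommutativeRing.-_ A (CommutativeRing.1# A)
    coeffs A (suc (suc _)) = CommutativeRing.0# A

    coeffs-hom : ∀ {A B} (h : RingHom A B) i → CommutativeRing._≈_ B (RingHom.fun h (coeffs A i)) (coeffs B i)
    coeffs-hom h zero          = RingHom.0-homo h
    coeffs-hom h (suc zero)    = hom-neg1 h
    coeffs-hom h (suc (suc _)) = RingHom.0-homo h

    monic-coeffs : ∀ (C : Ring₀) y → let open CommutativeRing C hiding (zero) in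
      MonicPolynomials.monic C (coeffs C) y ≈ Exp._^_ semiring y (suc (suc q″)) + - y
    monic-coeffs C y = trans (+-congˡ (*-congˡ (+-congˡ (*-congˡ (monic-0 q″)))))
        (trans (solve 3 (λ y m z → con 0 :+ y :* (m :+ y :* z) := y :* (y :* z) :+ m :* y) refl y (- 1#) (y ^ q″))
          (+-congˡ (-1*x≈-x y)))
      where
      open CommutativeRing C hiding (zero)
      open Exp semiring using (_^_)
      open MonicPolynomials C
      open import Algebra.Solver.Ring.NaturalCoefficients.Default commutativeSemiring using (solve; _:=_; _:+_; _:*_; con)
      open import Algebra.Properties.Ring ring using (-1*x≈-x)
      monic-0 : ∀ n → monic {n} (λ _ → 0#) y ≈ y ^ n
      monic-0 zero    = refl
      monic-0 (suc n) = trans (+-identityˡ _) (*-congˡ (monic-0 n))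

    Factorisation : (E : Ring₀) → (Fin (suc (suc q″)) → CommutativeRing.Carrier E) → Set₁
    Factorisation E root = ∀ (C : Ring₀) (ψ : RingHom E C) y → let open CommutativeRing C hiding (zero) in
      Exp._^_ semiring y (suc (suc q″)) + - y ≈ MonicPolynomials.prod C (λ i → y + - RingHom.fun ψ (root i))

    factorisation : ∀ {p} {A : FiniteRing p} (Sp : Splitting A (coeffs (FiniteRing.R A))) {E : Ring₀}
      (π : RingHom (FiniteRing.R (Splitting.B Sp)) E) → Factorisation E (λ i → RingHom.fun π (Splitting.roots Sp i))
    factorisation {A = A} Sp π C ψ y = trans (sym (monic-coeffs C y))
        (trans (sym (monic-cong (coeffs-hom ((ψ ∘ʰ π) ∘ʰ Splitting.φ Sp)) refl)) (Splitting.splits Sp C (ψ ∘ʰ π) y))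
      where
      open CommutativeRing C hiding (zero)
      open MonicPolynomials C using (monic-cong)

  -- The field with q = p^m elements, as the set of roots of X^q − X in a field where it splits.
  module RootField {p : ℕ} (pp : Prime p) (m q″ : ℕ) (q≡ : suc (suc q″) ≡ p ℕ.^ m)
    (E : FiniteRing p) (fld : IsField (FiniteRing.R E)) (root : Fin (suc (suc q″)) → FiniteRing.Carrier E)
    (factor-E : Factorisation q″ (FiniteRing.R E) root) where

    q : ℕ
    q = suc (suc q″)

    frobenius-q : ∀ (C : Ring₀) (charC : HasChar p C) → let open CommutativeRing C in
      ∀ x y → Exp._^_ semiring (x + y) q ≈ Exp._^_ semiring x q + Exp._^_ semiring y q
    frobenius-q C charC x y = ≡.subst (λ n → (x + y) ^ n ≈ (x ^ n) + (y ^ n)) (≡.sym q≡) (Frobenius.frobenius pp C charC m x y)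
      where
      open CommutativeRing C
      open Exp semiring using (_^_)

    open FiniteRing E
    open Products R
    open Exp semiring using (_^_; ^-congˡ)
    open import Algebra.Properties.Ring ring using (-0#≈0#)
      renaming (x∙y⁻¹≈ε⇒x≈y to x-y≈0⇒x≈y; x≈y⇒x∙y⁻¹≈ε to x≈y⇒x-y≈0; +-inverseʳ-unique to -‿unique)

    IsRoot : Carrier → Set
    IsRoot y = y ^ q ≈ y

    root-isRoot : ∀ i → IsRoot (root i)
    root-isRoot i = x-y≈0⇒x≈y _ _ (trans (factor-E R id-hom (root i))
      (prod-zero (λ j → root i + - root j) i (-‿inverseʳ (root i))))

    index : ∀ y → IsRoot y → ∃ λ i → y ≈ root i
    index y e = let i , z = prod-zero⁻¹ fld 1≉0 (λ j → y + - root j)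
                      (trans (sym (factor-E R id-hom y)) (x≈y⇒x-y≈0 e))
                in i , x-y≈0⇒x≈y _ _ z

    -- If two roots coincide, evaluating at root + ε where ε² = 0 gives −ε = 0.
    module _ (D : Ring₀) (ι : RingHom R D) (ε : CommutativeRing.Carrier D)
             (ε²≈0 : CommutativeRing._≈_ D (CommutativeRing._*_ D ε ε) (CommutativeRing.0# D)) where
      private
        module D = CommutativeRing D
        module DP = Products D
        module DR = MonicPolynomials D
      open Exp D.semiring using () renaming (_^_ to _^ᴰ_)
      open import Algebra.Solver.Ring.NaturalCoefficients.Default D.commutativeSemiring using (solve; _:=_; _:+_; _:*_; con)
      open RingHom ι using () renaming (fun to emb; cong to emb-cong; *-homo to emb-*; 1-homo to emb-1)

      emb-pow : ∀ n x → emb x ^ᴰ n D.≈ emb (x ^ n)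
      emb-pow zero    x = D.sym emb-1
      emb-pow (suc n) x = D.trans (D.*-congˡ (emb-pow n x)) (D.sym (emb-* x (x ^ n)))

      double-root : ∀ {i j} → i ≢ j → root i ≈ root j → ε D.≈ D.0#
      double-root {i} {j} i≢j e = D.trans (D.sym (D.+-identityʳ ε))
          (D.trans (D.+-congˡ (D.sym (D.trans (D.sym (D.+-congʳ Y^q)) (D.trans (factor-E D ι Y) vanish))))
            (D.trans (solve 3 (λ x a m → x :+ (a :+ m) := (a :+ x) :+ m) D.refl ε (emb (root i)) (D.- Y)) (D.-‿inverseʳ Y)))
        where
        Y : D.Carrier
        Y = emb (root i) D.+ ε
        factor : ∀ l → root i ≈ root l → (Y D.+ D.- emb (root l)) D.≈ ε
        factor l el = D.trans (D.+-congˡ (D.-‿cong (emb-cong (sym el))))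
          (D.trans (solve 3 (λ a x m → (a :+ x) :+ m := x :+ (a :+ m)) D.refl (emb (root i)) ε (D.- emb (root i)))
            (D.trans (D.+-congˡ (D.-‿inverseʳ (emb (root i)))) (D.+-identityʳ ε)))
        vanish : DR.prod (λ l → Y D.+ D.- emb (root l)) D.≈ D.0#
        vanish = DP.prod-pair (λ l → Y D.+ D.- emb (root l)) i j i≢j (D.trans (D.*-cong (factor i refl) (factor j e)) ε²≈0)
        Y^q : Y ^ᴰ q D.≈ emb (root i)
        Y^q = D.trans (frobenius-q D (hom-char {p} ι char) (emb (root i)) ε)
          (D.trans (D.+-cong (D.trans (emb-pow q (root i)) (emb-cong (root-isRoot i)))
                     (D.trans (D.sym (D.*-assoc ε ε (ε ^ᴰ q″))) (D.trans (D.*-congʳ ε²≈0) (D.zeroˡ _))))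
            (D.+-identityʳ _))

    root-injective : ∀ {i j} → root i ≈ root j → i ≡ j
    root-injective {i} {j} e with i ≟ j
    ... | yes i≡j = i≡j
    ... | no  i≢j = ⊥-elim (1≉0 (trans (sym (trans (+-congˡ (trans (*-congʳ -0#≈0#) (zeroˡ _))) (+-identityʳ 1#)))
                      (double-root extension embed X̄ ε²≈0 i≢j e (suc zero))))
      where
      -- The dual numbers R[X]/(X²), with ε the class of X. Its coordinate at X is 1, so ε = 0 would
      -- give 1 = 0 in E.
      open Extension R {1} (λ _ → 0#) using (_≋_; S; extension; embed; X̄; X̄-mult)
      ε²≈0 : CommutativeRing._≈_ extension (CommutativeRing._*_ extension X̄ X̄) (CommutativeRing.0# extension)
      ε²≈0 i = trans (X̄-mult X̄ i) (square i)
        where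
        drop : ∀ x y → x ≈ 0# → x + - 0# * y ≈ 0#
        drop x y e = trans (+-cong e (trans (*-congʳ -0#≈0#) (zeroˡ y))) (+-identityˡ 0#)
        square : S X̄ ≋ (λ _ → 0#)
        square zero       = drop _ _ refl
        square (suc zero) = drop _ _ (drop _ _ refl)

    private
      powq-neg : ∀ y → (- y) ^ q ≈ - (y ^ q)
      powq-neg y = -‿unique (y ^ q) _ (trans (sym (frobenius-q R char y (- y)))
        (trans (^-congˡ q (-‿inverseʳ y)) (zeroˡ _)))

      open import Algebra.Properties.CommutativeSemiring.Exp commutativeSemiring using (^-distrib-*)

      one-pow : ∀ n → 1# ^ n ≈ 1#
      one-pow zero    = refl
      one-pow (suc n) = trans (*-identityˡ _) (one-pow n)

      sum-root : ∀ {x y} → IsRoot x → IsRoot y → IsRoot (x + y)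
      sum-root {x} {y} ex ey = trans (frobenius-q R char x y) (+-cong ex ey)

      prod-root : ∀ {x y} → IsRoot x → IsRoot y → IsRoot (x * y)
      prod-root {x} {y} ex ey = trans (^-distrib-* x y q) (*-cong ex ey)

      neg-root : ∀ {x} → IsRoot x → IsRoot (- x)
      neg-root {x} ex = trans (powq-neg x) (-‿cong ex)

      add mul : Fin q → Fin q → Fin q
      add i j = proj₁ (index (root i + root j) (sum-root (root-isRoot i) (root-isRoot j)))
      mul i j = proj₁ (index (root i * root j) (prod-root (root-isRoot i) (root-isRoot j)))

      neg : Fin q → Fin q
      neg i = proj₁ (index (- root i) (neg-root (root-isRoot i)))

      nil one : Fin q
      nil = proj₁ (index 0# (zeroˡ _))
      one = proj₁ (index 1# (one-pow q))

      raw : RawRing _ _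
      raw = record { Carrier = Fin q ; _≈_ = _≡_ ; _+_ = add ; _*_ = mul ; -_ = neg ; 0# = nil ; 1# = one }

      nil-root : root nil ≈ 0#
      nil-root = sym (proj₂ (index 0# (zeroˡ _)))

      one-root : root one ≈ 1#
      one-root = sym (proj₂ (index 1# (one-pow q)))

      mul-root : ∀ i j → root (mul i j) ≈ root i * root j
      mul-root i j = sym (proj₂ (index (root i * root j) (prod-root (root-isRoot i) (root-isRoot j))))

      -- The roots are closed under the ring operations, sums by the Frobenius map, so `Fin q`
      -- inherits all ring laws from E along the injection `root`.
      mono : RingMorphisms.IsRingMonomorphism raw (CommutativeRing.rawRing R) root
      mono = record
        { isRingHomomorphism = record
          { isSemiringHomomorphism = record
            { isNearSemiringHomomorphism = record
              { +-isMonoidHomomorphism = record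
                { isMagmaHomomorphism = record
                  { isRelHomomorphism = record { cong = λ { ≡.refl → refl } }
                  ; homo = λ i j → sym (proj₂ (index (root i + root j) (sum-root (root-isRoot i) (root-isRoot j))))
                  }
                ; ε-homo = nil-root
                }
              ; *-homo = mul-root
              }
            ; 1#-homo = one-root
            }
          ; -‿homo = λ i → sym (proj₂ (index (- root i) (neg-root (root-isRoot i))))
          }
        ; injective = root-injective
        }

    finiteDomain : FiniteDomain q
    finiteDomain = record
      { _+_ = add ; _*_ = mul ; -_ = neg ; 0# = nil ; 1# = one
      ; isCommutativeRing = Mono.isCommutativeRing mono isCommutativeRing
      ; noZeroDivisors = λ {i} {j} e → zero-divisors i j e
      ; 1≢0 = λ e → 1≉0 (trans (sym one-root) (trans (reflexive (≡.cong root e)) nil-root))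
      }
      where
      zero-divisors : ∀ i j → mul i j ≡ nil → i ≡ nil ⊎ j ≡ nil
      zero-divisors i j e = Sum.map (λ z → root-injective (trans z (sym nil-root))) (λ z → root-injective (trans z (sym nil-root)))
        (cancel-nonzero fld (trans (sym (mul-root i j)) (trans (reflexive (≡.cong root e)) nil-root)))

  -- The carrier is the index set of the roots of X^q - X, so its size is q by construction. Since q
  -- ≥ 2, the term -X is among the lower coefficients.
  galoisField : ∀ {p} → Prime p → ∀ m → 1 ≤ m → FiniteDomain (p ℕ.^ m)
  galoisField {p} pp m m≥1 = at (p ℕ.^ m) ≡.refl 2≤
    where
    2≤p : 2 ≤ p
    2≤p = ℕ.nonTrivial⇒n>1 p {{prime⇒nonTrivial pp}}
    2≤ : 2 ≤ p ℕ.^ m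
    2≤ = ℕₚ.≤-trans 2≤p (ℕₚ.≤-trans (ℕₚ.≤-reflexive (≡.sym (ℕₚ.*-identityʳ p)))
           (ℕₚ.^-monoʳ-≤ p {{ℕ.>-nonZero (ℕₚ.≤-trans (s≤s z≤n) 2≤p)}} m≥1))
    at : ∀ q → q ≡ p ℕ.^ m → 2 ≤ q → FiniteDomain q
    at (suc (suc q″)) e (s≤s (s≤s _)) =
      let Sp = split (primeRing pp) (suc (suc q″)) (coeffs q″ (FiniteRing.R (primeRing pp)))
          E , π , fld = maximal-quotient (Splitting.B Sp)
      in RootField.finiteDomain pp m q″ e E fld (λ i → RingHom.fun π (Splitting.roots Sp i)) (factorisation q″ Sp π)

-- Arithmetic of the exponents and the theorem

open import Defs
open import Data.Nat using (ℕ; suc; _+_; _*_; _^_; _≤_)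
open import Data.Integer using (+_)
open import Data.Rational using (ℚ; _/_; 1ℚ) renaming (_≤_ to _≤ℚ_; _*_ to _*ℚ_)
open import Data.Fin using (Fin)
open import Data.Bool using (Bool)
open import Data.Product using (Σ; _×_)
open import Relation.Binary.PropositionalEquality using (_≡_)

open import Data.Nat using (z≤n; s≤s)
import Data.Nat.Properties as ℕₚ
open import Data.Nat.Divisibility using (divides)
open import Data.Integer as ℤ using (ℤ)
import Data.Integer.Properties as ℤₚ
import Data.Rational as ℚ
import Data.Rational.Properties as ℚₚ
open import Data.Rational.Unnormalised as ℚᵘ using (mkℚᵘ; *≡*; *≤*)
import Data.Rational.Unnormalised.Properties as ℚᵘₚ
open import Data.Product using (_,_)
open import Relation.Binary.PropositionalEquality
open Configurations using (module S)
open AlgebraicGraphs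
open GaloisFields

-- In unnormalised rationals with denominator 1 this is an integer equation. The absolute value
-- spares a proof that z is nonnegative.
integer-product : ∀ {a b} {z : ℤ} → ℕ→ℚ a ≡ ℤ→ℚ z *ℚ ℕ→ℚ b → a ≡ ℤ.∣ z ∣ * b
integer-product {a} {b} {z} e with a≃zb
  where
  a≃zb : mkℚᵘ (+ a) 0 ℚᵘ.≃ mkℚᵘ z 0 ℚᵘ.* mkℚᵘ (+ b) 0
  a≃zb = ℚᵘₚ.≃-trans (ℚᵘₚ.≃-sym (ℚₚ.toℚᵘ-fromℚᵘ (mkℚᵘ (+ a) 0)))
    (ℚᵘₚ.≃-trans (ℚᵘₚ.≃-reflexive (cong ℚ.toℚᵘ e)) (ℚᵘₚ.≃-trans (ℚₚ.toℚᵘ-homo-* (ℤ→ℚ z) (ℕ→ℚ b))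
      (ℚᵘₚ.*-cong (ℚₚ.toℚᵘ-fromℚᵘ (mkℚᵘ z 0)) (ℚₚ.toℚᵘ-fromℚᵘ (mkℚᵘ (+ b) 0)))))
... | *≡* p = trans (cong ℤ.∣_∣ (trans (sym (ℤₚ.*-identityʳ (+ a))) (trans p (ℤₚ.*-identityʳ (z ℤ.* + b))))) (ℤₚ.abs-* z (+ b))

scaled-≤ : ∀ {a ℓ α} → α ≤ℚ 1ℚ → ℕ→ℚ a ≡ α *ℚ ℕ→ℚ ℓ → a ≤ ℓ
scaled-≤ {a} {ℓ} {α} α≤1 e with a≤ℓ
  where
  instance _ = ℚₚ.normalize-nonNeg ℓ 1
  a≤ℓ : mkℚᵘ (+ a) 0 ℚᵘ.≤ mkℚᵘ (+ ℓ) 0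
  a≤ℓ = ℚᵘₚ.≤-respˡ-≃ (ℚₚ.toℚᵘ-fromℚᵘ (mkℚᵘ (+ a) 0)) (ℚᵘₚ.≤-respʳ-≃ (ℚₚ.toℚᵘ-fromℚᵘ (mkℚᵘ (+ ℓ) 0))
    (ℚₚ.toℚᵘ-mono-≤ (subst₂ _≤ℚ_ (sym e) (ℚₚ.*-identityˡ (ℕ→ℚ ℓ)) (ℚₚ.*-monoʳ-≤-nonNeg (ℕ→ℚ ℓ) α≤1))))
... | *≤* p = ℤₚ.drop‿+≤+ (subst₂ ℤ._≤_ (ℤₚ.*-identityʳ (+ a)) (ℤₚ.*-identityʳ (+ ℓ)) p)

Conclusion : ℕ → ℕ → ℕ → ℕ → ℕ → Set
Conclusion k s q a ℓ = Σ (Fin (q ^ a) → Fin (q ^ ℓ) → Bool) λ E →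
  (BipGraph E -free Θ s (2 * k)) × ((q ^ a) ^ (k + 1) * (q ^ ℓ) ^ k ≤ (2 * edges E) ^ (2 * k))

module _ (k′ a′ δ : ℕ) (ℓ′≥1 : 1 ≤ a′ + δ) where
  private
    ℓ′ = a′ + δ
    t  = k′ * a′ + suc k′ * ℓ′
    -- This is 2kℓ′ - t, written without subtraction by means of δ = ℓ′ - a′.
    u  = ℓ′ + k′ * δ
    a  = a′ * (2 * suc k′)

    ℓ≡ : ℓ′ * (2 * suc k′) ≡ t + u
    ℓ≡ = S.solve 3 (λ k a d → (a S.:+ d) S.:* (S.con 2 S.:* (S.con 1 S.:+ k))
           S.:= (k S.:* a S.:+ (S.con 1 S.:+ k) S.:* (a S.:+ d)) S.:+ ((a S.:+ d) S.:+ k S.:* d)) refl k′ a′ δ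

    a≤ : a ≤ t + u
    a≤ = ℕₚ.≤-trans (ℕₚ.*-monoˡ-≤ (2 * suc k′) (ℕₚ.m≤m+n a′ δ)) (ℕₚ.≤-reflexive ℓ≡)

    t≥1 : 1 ≤ t
    t≥1 = ℕₚ.≤-trans ℓ′≥1 (ℕₚ.≤-trans (ℕₚ.m≤m+n ℓ′ (k′ * ℓ′)) (ℕₚ.m≤n+m (suc k′ * ℓ′) (k′ * a′)))

    -- The unknown coordinates of a path between two vertices of M are as many as its equations.
    balanced : suc k′ * (t + u) + k′ * a ≡ suc k′ * 2 * t
    balanced = S.solve 3 (λ k a d →
      (S.con 1 S.:+ k) S.:* ((k S.:* a S.:+ (S.con 1 S.:+ k) S.:* (a S.:+ d)) S.:+ ((a S.:+ d) S.:+ k S.:* d)) S.:+ k S.:* (a S.:* (S.con 2 S.:* (S.con 1 S.:+ k)))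
      S.:= (S.con 1 S.:+ k) S.:* S.con 2 S.:* (k S.:* a S.:+ (S.con 1 S.:+ k) S.:* (a S.:+ d))) refl k′ a′ δ

    -- The exponent of q in |M|^(1/2 + 1/(2k)) |N|^(1/2), multiplied by 2k. It equals 2k(a + u)
    -- exactly, so the balanced t also gives the required number of edges.
    exponent : a * (suc k′ + 1) + (t + u) * suc k′ ≡ (a + u) * (2 * suc k′)
    exponent = S.solve 3 (λ k a d →
        (a S.:* (S.con 2 S.:* (S.con 1 S.:+ k))) S.:* ((S.con 1 S.:+ k) S.:+ S.con 1)
          S.:+ ((k S.:* a S.:+ (S.con 1 S.:+ k) S.:* (a S.:+ d)) S.:+ ((a S.:+ d) S.:+ k S.:* d)) S.:* (S.con 1 S.:+ k)
        S.:= (a S.:* (S.con 2 S.:* (S.con 1 S.:+ k)) S.:+ ((a S.:+ d) S.:+ k S.:* d)) S.:* (S.con 2 S.:* (S.con 1 S.:+ k))) refl k′ a′ δ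

    many-edges : ∀ q {e} → q ^ (a + u) ≤ e → (q ^ a) ^ (suc k′ + 1) * (q ^ (t + u)) ^ suc k′ ≤ (2 * e) ^ (2 * suc k′)
    many-edges q {e} h = begin
      (q ^ a) ^ (suc k′ + 1) * (q ^ (t + u)) ^ suc k′      ≡⟨ cong₂ _*_ (ℕₚ.^-*-assoc q a (suc k′ + 1)) (ℕₚ.^-*-assoc q (t + u) (suc k′)) ⟩
      q ^ (a * (suc k′ + 1)) * q ^ ((t + u) * suc k′)      ≡⟨ ℕₚ.^-distribˡ-+-* q (a * (suc k′ + 1)) ((t + u) * suc k′) ⟨
      q ^ (a * (suc k′ + 1) + (t + u) * suc k′)            ≡⟨ cong (q ^_) exponent ⟩
      q ^ ((a + u) * (2 * suc k′))                         ≡⟨ ℕₚ.^-*-assoc q (a + u) (2 * suc k′) ⟨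
      -- The construction has at least q^(a+u) edges; the factor 1/2 of the theorem is given away
      -- here.
      (q ^ (a + u)) ^ (2 * suc k′)                         ≤⟨ ℕₚ.^-monoˡ-≤ (2 * suc k′) (ℕₚ.≤-trans h (ℕₚ.m≤m+n e (e + 0))) ⟩
      (2 * e) ^ (2 * suc k′)                               ∎
      where open ℕₚ.≤-Reasoning

  construction : Σ ℕ λ s₀ → Σ ℕ λ q₀ → (s q : ℕ) → s₀ ≤ s → q₀ ≤ q → IsPrimePower q →
    Conclusion (suc k′) s q a (ℓ′ * (2 * suc k′))
  construction =
    let s₀ , q₀ , graph = sparse-graphs k′ a t u a≤ t≥1 (ℕₚ.≤-reflexive balanced) in
    s₀ , q₀ , λ { s q s₀≤s q₀≤q (p , m , pp , m≥1 , refl) →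
      let E , free , many = graph (galoisField pp m m≥1) s s₀≤s q₀≤q in
      subst (Conclusion (suc k′) s (p ^ m) a) (sym ℓ≡) (E , free , many-edges (p ^ m) many) }

theorem5p7 : (k : ℕ) → 1 ≤ k →
    (α : ℚ) → (+ k / suc k) ≤ℚ α → α ≤ℚ 1ℚ →
    (ℓ : ℕ) → IsSmallestℓ k α ℓ →
    (a : ℕ) → ℕ→ℚ a ≡ α *ℚ ℕ→ℚ ℓ →
    Σ ℕ λ s₀ → Σ ℕ λ q₀ →
    (s q : ℕ) → s₀ ≤ s → q₀ ≤ q → IsPrimePower q →
    Σ (Fin (q ^ a) → Fin (q ^ ℓ) → Bool) λ E →
    (BipGraph E -free Θ s (2 * k)) ×
    ((q ^ a) ^ (k + 1) * (q ^ ℓ) ^ k ≤ (2 * edges E) ^ (2 * k))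
theorem5p7 (suc k′) _ α _ α≤1 ℓ (ℓ≥1 , (divides ℓ′ ℓ≡ , z , eq) , _) a ea =
  reduce ℤ.∣ z ∣ ℓ′ (integer-product {a} {2 * suc k′} {z} (trans ea eq)) ℓ≡ (scaled-≤ {a} {ℓ} {α} α≤1 ea) ℓ≥1
  where
  positive : ∀ n {m} → 1 ≤ n * m → 1 ≤ n
  positive (suc n) h = s≤s z≤n
  -- Here a and ℓ are variables, so that both equations can be matched with `refl`; cancelling 2k in
  -- a ≤ ℓ then provides δ.
  reduce : ∀ a′ ℓ′ {a ℓ} → a ≡ a′ * (2 * suc k′) → ℓ ≡ ℓ′ * (2 * suc k′) → a ≤ ℓ → 1 ≤ ℓ →
    Σ ℕ λ s₀ → Σ ℕ λ q₀ → (s q : ℕ) → s₀ ≤ s → q₀ ≤ q → IsPrimePower q → Conclusion (suc k′) s q a ℓ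
  reduce a′ ℓ′ refl refl a≤ℓ ℓ≥1 with ℕₚ.m≤n⇒∃[o]m+o≡n (ℕₚ.*-cancelʳ-≤ a′ ℓ′ (2 * suc k′) a≤ℓ)
  ... | δ , refl = construction k′ a′ δ (positive _ ℓ≥1)
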